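{- There exists an absolute constant $C > 0$ such that the following holds. Let $R$ be a ring, and let $A \subset R$ be finite and non-empty. Suppose that $|A \cdot A - A \cdot A| \leq K |A|$ and $|A \cdot A| \geq |A|/K$ for some $K \geq 1$. Then at least one of the following holds: (i) ($A-A$ has many zero divisors) $|(A-A) \setminus R^*| \geq C^{ -1} K^{ -C} |A|$; or (ii) (Ring structure in a Freiman model) there exist a finite ring $R_0$ of cardinality between $|A|$ and $CK^C |A|$, an outer automorphism $\phi: R_0 \to R_0$ of that ring, and, for every $n \geq 1$, an embedding (injective map) $\iota_n: \langle A^n \rangle \to R_0 \cdot t^n$ from the additive group $\langle A^n \rangle$ generated by the $n$-fold product set $A^n$ to the degree $n$ component $R_0 \cdot t^n$ of the twisted polynomial ring $R_0[t]_\phi$, such that each $\iota_n$ is an additive homomorphism, and such that $\iota_n(g_n)\, \iota_m(g_m) = \iota_{n+m}(g_n g_m)$ for all $n,m \geq 1$ and all $g_n \in \langle A^n \rangle$ and $g_m \in \langle A^m \rangle$.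
   Context: Rings are associative, but need not be commutative and need not contain a multiplicative identity. For subsets $A,B$ of a ring $R$: $A-B := \{a-b : a \in A, b\in B\}$, $A\cdot B := \{ab : a\in A, b\in B\}$, and $A^n := A\cdot \ldots \cdot A$ ($n$ factors) is the set of all products $a_1\cdots a_n$ with $a_i\in A$. $\langle A^n\rangle$ is the additive subgroup of $R$ generated by $A^n$. $|A|$ denotes the cardinality of a finite set $A$. $R^*$ denotes the set of non-zero-divisors of $R$, i.e. the elements $r \in R$ such that $ra \neq 0$ and $ar \neq 0$ whenever $a \in R$, $a \neq 0$. An "outer automorphism" $\phi$ of a ring $R_0$ here just means a ring automorphism $\phi: R_0\to R_0$ (not required to be inner). The twisted polynomial ring $R_0[t]_\phi$ is the ring generated by $R_0$ and a formal variable $t$ subject to the relations $ta = \phi(a)t$ for $a\in R_0$; concretely, it consists of formal sums $\sum_{n=0}^d a_n t^n$ with $a_n \in R_0$, $d \ge 0$, added coefficientwise and multiplied via $(a t^n)(b t^m) = a\,\phi^n(b)\, t^{n+m}$. Its degree $n$ component is $R_0\cdot t^n = \{ a t^n : a \in R_0\}$. -}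

module Defs where

open import Level using (Level; _⊔_)
open import Algebra.Bundles using (AbelianGroup; RingWithoutOne)
open import Algebra.Morphism.Structures
  using (IsGroupMonomorphism; IsRingWithoutOneHomomorphism; IsRingWithoutOneIsoMorphism)
import Algebra.Properties.CommutativeSemigroup as CommutativeSemigroupProperties
import Algebra.Properties.RingWithoutOne as RingProperties
open import Data.List.Base using (List; []; _∷_; length; map; replicate; _++_; [_])
import Data.List.Membership.Setoid as Membership
import Data.List.Relation.Unary.Unique.Setoid as UniqueSetoid
open import Data.Nat.Base as ℕ using (ℕ; zero; suc)
import Data.Nat.Properties as ℕ
open import Data.Integer.Base as ℤ using (+_)
open import Data.Product.Base using (Σ; ∃; ∃₂; _×_; _,_; proj₁; proj₂)
open import Data.Rational.Base as ℚ using (ℚ; 0ℚ; 1ℚ; ½; ∣_∣)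
import Data.Rational.Properties as ℚ
open import Function.Bundles using (_⇔_)
open import Relation.Binary.Bundles using (Setoid)
open import Relation.Binary.PropositionalEquality as ≡ using (_≡_)
import Relation.Binary.Reasoning.Setoid as SetoidReasoning
open import Relation.Nullary using (¬_)
open import Relation.Unary using (Pred)

private
  variable
    c ℓ p q : Level

-- Counted up to the setoid's equality. The equivalence forces P to respect
-- that equality, and n is then determined by P.
record HasCardinality (S : Setoid c ℓ) (P : Pred (Setoid.Carrier S) p) (n : ℕ)
       : Set (c ⊔ ℓ ⊔ p) where
  open Setoid S using (Carrier)
  open Membership S using (_∈_)
  open UniqueSetoid S using (Unique)
  field
    elements : List Carrier
    unique   : Unique elements
    complete : ∀ x → P x ⇔ x ∈ elements
    size     : length elements ≡ n

-- Cauchy sequences of rationals. There is no quotient; _≤ᴿ_ is the order on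
-- the represented limits, and does not distinguish sequences with equal limits.
record ℝ : Set where
  constructor mkℝ
  field
    seq    : ℕ → ℚ
    cauchy : ∀ ε → 0ℚ ℚ.< ε →
             ∃ λ N → ∀ m n → N ℕ.≤ m → N ℕ.≤ n → ∣ seq m ℚ.- seq n ∣ ℚ.< ε

open ℝ public

infix  4 _≤ᴿ_
infixl 7 _*ᴿ_
infixr 8 _^ᴿ_

_≤ᴿ_ : ℝ → ℝ → Set
x ≤ᴿ y = ∀ ε → 0ℚ ℚ.< ε →
         ∃ λ N → ∀ n → N ℕ.≤ n → seq x n ℚ.≤ seq y n ℚ.+ ε

fromℚ : ℚ → ℝ
fromℚ r = mkℝ (λ _ → r) λ ε 0<ε → 0 , λ _ _ _ _ →
  ≡.subst (λ s → ∣ s ∣ ℚ.< ε) (≡.sym (ℚ.+-inverseʳ r)) 0<ε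

fromℕ : ℕ → ℝ
fromℕ n = fromℚ (+ n ℚ./ 1)

private
  bounded : (x : ℝ) → ∃₂ λ B N → 0ℚ ℚ.< B × (∀ n → N ℕ.≤ n → ∣ seq x n ∣ ℚ.≤ B)
  bounded x with cauchy x 1ℚ (ℚ.positive⁻¹ 1ℚ)
  ... | N , near = 1ℚ ℚ.+ ∣ seq x N ∣ , N , 0<B , below
    where
    0<B : 0ℚ ℚ.< 1ℚ ℚ.+ ∣ seq x N ∣
    0<B = ≡.subst (ℚ._< 1ℚ ℚ.+ ∣ seq x N ∣) (ℚ.+-identityˡ 0ℚ)
      (ℚ.+-mono-<-≤ (ℚ.positive⁻¹ 1ℚ) (ℚ.0≤∣p∣ (seq x N)))

    split : ∀ u v → u ≡ (u ℚ.- v) ℚ.+ v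
    split u v = ≡.sym (≡.trans (ℚ.+-assoc u (ℚ.- v) v)
      (≡.trans (≡.cong (u ℚ.+_) (ℚ.+-inverseˡ v)) (ℚ.+-identityʳ u)))

    below : ∀ n → N ℕ.≤ n → ∣ seq x n ∣ ℚ.≤ 1ℚ ℚ.+ ∣ seq x N ∣
    below n N≤n = begin
      ∣ seq x n ∣                                ≡⟨ ≡.cong ∣_∣ (split (seq x n) (seq x N)) ⟩
      ∣ (seq x n ℚ.- seq x N) ℚ.+ seq x N ∣      ≤⟨ ℚ.∣p+q∣≤∣p∣+∣q∣ (seq x n ℚ.- seq x N) (seq x N) ⟩
      ∣ seq x n ℚ.- seq x N ∣ ℚ.+ ∣ seq x N ∣    ≤⟨ ℚ.+-monoˡ-≤ ∣ seq x N ∣ (ℚ.<⇒≤ (near n N N≤n ℕ.≤-refl)) ⟩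
      1ℚ ℚ.+ ∣ seq x N ∣                         ∎
      where open ℚ.≤-Reasoning

  -- For 0 < B and 0 < ε, the number δ = ε / 2B satisfies B δ = ε / 2.
  fraction : ∀ B ε → 0ℚ ℚ.< B → 0ℚ ℚ.< ε → ∃ λ δ → 0ℚ ℚ.< δ × B ℚ.* δ ≡ ½ ℚ.* ε
  fraction B ε 0<B 0<ε = δ , 0<δ , eq
    where
    instance
      B>0 : ℚ.Positive B
      B>0 = ℚ.positive 0<B
      ε>0 : ℚ.Positive ε
      ε>0 = ℚ.positive 0<ε
      B≢0 : ℚ.NonZero B
      B≢0 = ℚ.pos⇒nonZero B
      1/B>0 : ℚ.Positive (ℚ.1/ B)
      1/B>0 = ℚ.1/pos⇒pos B
      ½ε>0 : ℚ.Positive (½ ℚ.* ε)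
      ½ε>0 = ℚ.pos*pos⇒pos ½ ε
    δ : ℚ
    δ = ℚ.1/ B ℚ.* (½ ℚ.* ε)
    0<δ : 0ℚ ℚ.< δ
    0<δ = ℚ.positive⁻¹ δ {{ℚ.pos*pos⇒pos (ℚ.1/ B) (½ ℚ.* ε)}}
    eq : B ℚ.* δ ≡ ½ ℚ.* ε
    eq = ≡.trans (≡.sym (ℚ.*-assoc B (ℚ.1/ B) (½ ℚ.* ε)))
      (≡.trans (≡.cong (ℚ._* (½ ℚ.* ε)) (ℚ.*-inverseʳ B)) (ℚ.*-identityˡ (½ ℚ.* ε)))

  halves : ∀ ε → ½ ℚ.* ε ℚ.+ ½ ℚ.* ε ≡ ε
  halves ε = ≡.trans (≡.sym (ℚ.*-distribʳ-+ ε ½ ½)) (ℚ.*-identityˡ ε)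

  difference : ∀ u v u′ v′ →
    u ℚ.* v ℚ.- u′ ℚ.* v′ ≡ u ℚ.* (v ℚ.- v′) ℚ.+ v′ ℚ.* (u ℚ.- u′)
  difference = solve 4 (λ u v u′ v′ →
      u :* v :- u′ :* v′ := u :* (v :- v′) :+ v′ :* (u :- u′)) ≡.refl
    where
    open import Data.Rational.Solver
    open +-*-Solver

  scaled : ∀ B δ u w → 0ℚ ℚ.< B → ∣ u ∣ ℚ.≤ B → ∣ w ∣ ℚ.< δ → ∣ u ℚ.* w ∣ ℚ.< B ℚ.* δ
  scaled B δ u w 0<B u≤B w<δ = begin-strict
    ∣ u ℚ.* w ∣        ≡⟨ ℚ.∣p*q∣≡∣p∣*∣q∣ u w ⟩
    ∣ u ∣ ℚ.* ∣ w ∣    ≤⟨ ℚ.*-monoʳ-≤-nonNeg ∣ w ∣ {{ℚ.nonNegative (ℚ.0≤∣p∣ w)}} u≤B ⟩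
    B ℚ.* ∣ w ∣        <⟨ ℚ.*-monoʳ-<-pos B {{ℚ.positive 0<B}} w<δ ⟩
    B ℚ.* δ            ∎
    where open ℚ.≤-Reasoning

_*ᴿ_ : ℝ → ℝ → ℝ
x *ᴿ y = mkℝ (λ n → seq x n ℚ.* seq y n) product-cauchy
  where
  product-cauchy : ∀ ε → 0ℚ ℚ.< ε → ∃ λ N → ∀ m n → N ℕ.≤ m → N ℕ.≤ n →
    ∣ seq x m ℚ.* seq y m ℚ.- seq x n ℚ.* seq y n ∣ ℚ.< ε
  product-cauchy ε 0<ε with bounded x | bounded y
  ... | Bx , Nx , 0<Bx , x≤Bx | By , Ny , 0<By , y≤By
    with fraction Bx ε 0<Bx 0<ε | fraction By ε 0<By 0<ε
  ... | δy , 0<δy , Bxδy | δx , 0<δx , Byδx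
    with cauchy x δx 0<δx | cauchy y δy 0<δy
  ... | Mx , x-near | My , y-near = (Nx ℕ.⊔ Ny) ℕ.⊔ (Mx ℕ.⊔ My) , near
    where
    open ℚ.≤-Reasoning
    N = (Nx ℕ.⊔ Ny) ℕ.⊔ (Mx ℕ.⊔ My)
    Nx≤N = ℕ.≤-trans (ℕ.m≤m⊔n Nx Ny) (ℕ.m≤m⊔n (Nx ℕ.⊔ Ny) (Mx ℕ.⊔ My))
    Ny≤N = ℕ.≤-trans (ℕ.m≤n⊔m Nx Ny) (ℕ.m≤m⊔n (Nx ℕ.⊔ Ny) (Mx ℕ.⊔ My))
    Mx≤N = ℕ.≤-trans (ℕ.m≤m⊔n Mx My) (ℕ.m≤n⊔m (Nx ℕ.⊔ Ny) (Mx ℕ.⊔ My))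
    My≤N = ℕ.≤-trans (ℕ.m≤n⊔m Mx My) (ℕ.m≤n⊔m (Nx ℕ.⊔ Ny) (Mx ℕ.⊔ My))
    near : ∀ m n → N ℕ.≤ m → N ℕ.≤ n →
      ∣ seq x m ℚ.* seq y m ℚ.- seq x n ℚ.* seq y n ∣ ℚ.< ε
    near m n N≤m N≤n = begin-strict
      ∣ seq x m ℚ.* seq y m ℚ.- seq x n ℚ.* seq y n ∣
        ≡⟨ ≡.cong ∣_∣ (difference (seq x m) (seq y m) (seq x n) (seq y n)) ⟩
      ∣ seq x m ℚ.* (seq y m ℚ.- seq y n) ℚ.+ seq y n ℚ.* (seq x m ℚ.- seq x n) ∣
        ≤⟨ ℚ.∣p+q∣≤∣p∣+∣q∣ (seq x m ℚ.* (seq y m ℚ.- seq y n)) (seq y n ℚ.* (seq x m ℚ.- seq x n)) ⟩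
      ∣ seq x m ℚ.* (seq y m ℚ.- seq y n) ∣ ℚ.+ ∣ seq y n ℚ.* (seq x m ℚ.- seq x n) ∣
        <⟨ ℚ.+-mono-<
             (scaled Bx δy (seq x m) (seq y m ℚ.- seq y n) 0<Bx
               (x≤Bx m (ℕ.≤-trans Nx≤N N≤m))
               (y-near m n (ℕ.≤-trans My≤N N≤m) (ℕ.≤-trans My≤N N≤n)))
             (scaled By δx (seq y n) (seq x m ℚ.- seq x n) 0<By
               (y≤By n (ℕ.≤-trans Ny≤N N≤n))
               (x-near m n (ℕ.≤-trans Mx≤N N≤m) (ℕ.≤-trans Mx≤N N≤n))) ⟩
      Bx ℚ.* δy ℚ.+ By ℚ.* δx
        ≡⟨ ≡.cong₂ ℚ._+_ Bxδy Byδx ⟩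
      ½ ℚ.* ε ℚ.+ ½ ℚ.* ε
        ≡⟨ halves ε ⟩
      ε ∎

_^ᴿ_ : ℝ → ℕ → ℝ
x ^ᴿ zero  = fromℕ 1
x ^ᴿ suc n = x *ᴿ x ^ᴿ n

module Subsets (R : RingWithoutOne c ℓ) where
  open RingWithoutOne R hiding (zero)
  open RingProperties R using (-‿distribˡ-*; -‿distribʳ-*)

  infixl 6 _⊖_
  infixl 7 _·_
  infixr 8 _^_

  _⊖_ : Pred Carrier p → Pred Carrier q → Pred Carrier (c ⊔ ℓ ⊔ p ⊔ q)
  (A ⊖ B) x = ∃₂ λ a b → A a × B b × x ≈ a + - b

  _·_ : Pred Carrier p → Pred Carrier q → Pred Carrier (c ⊔ ℓ ⊔ p ⊔ q)
  (A · B) x = ∃₂ λ a b → A a × B b × x ≈ a * b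

  -- n-fold product sets for n ≥ 1. In the absence of a unit there is no
  -- meaningful A ^ 0; here it is empty.
  data _^_ (A : Pred Carrier p) : ℕ → Pred Carrier (c ⊔ ℓ ⊔ p) where
    single : ∀ {a} → A a → (A ^ 1) a
    times  : ∀ {n a y x} → A a → (A ^ n) y → x ≈ a * y → (A ^ suc n) x

  NonZeroDivisor : Pred Carrier (c ⊔ ℓ)
  NonZeroDivisor r = ∀ a → ¬ (a ≈ 0#) → ¬ (r * a ≈ 0#) × ¬ (a * r ≈ 0#)

  data Generated (A : Pred Carrier p) : Pred Carrier (c ⊔ ℓ ⊔ p) where
    gen  : ∀ {x} → A x → Generated A x
    gen0 : Generated A 0#
    add  : ∀ {x y} → Generated A x → Generated A y → Generated A (x + y)
    neg  : ∀ {x} → Generated A x → Generated A (- x)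
    resp : ∀ {x y} → x ≈ y → Generated A x → Generated A y

  ⟨_⟩ : Pred Carrier p → AbelianGroup (c ⊔ ℓ ⊔ p) ℓ
  ⟨ A ⟩ = record
    { Carrier = Σ Carrier (Generated A)
    ; _≈_     = λ x y → proj₁ x ≈ proj₁ y
    ; _∙_     = λ x y → proj₁ x + proj₁ y , add (proj₂ x) (proj₂ y)
    ; ε       = 0# , gen0
    ; _⁻¹     = λ x → - proj₁ x , neg (proj₂ x)
    ; isAbelianGroup = record
      { isGroup = record
        { isMonoid = record
          { isSemigroup = record
            { isMagma = record
              { isEquivalence = record
                { refl  = refl
                ; sym   = sym
                ; trans = trans
                }
              ; ∙-cong = +-cong
              }
            ; assoc = λ x y z → +-assoc (proj₁ x) (proj₁ y) (proj₁ z)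
            }
          ; identity = (λ x → +-identityˡ (proj₁ x)) , (λ x → +-identityʳ (proj₁ x))
          }
        ; inverse = (λ x → -‿inverseˡ (proj₁ x)) , (λ x → -‿inverseʳ (proj₁ x))
        ; ⁻¹-cong = -‿cong
        }
      ; comm = λ x y → +-comm (proj₁ x) (proj₁ y)
      }
    }

  private
    powers-* : ∀ {A : Pred Carrier p} {n m x y} → (A ^ n) x → (A ^ m) y → (A ^ (n ℕ.+ m)) (x * y)
    powers-* (single a∈A) y∈ = times a∈A y∈ (refl)
    powers-* {y = y} (times {a = a} {y = z} a∈A z∈ x≈az) y∈ =
      times a∈A (powers-* z∈ y∈) (trans (*-congʳ x≈az) (*-assoc a z y))

    generated-* : ∀ {A : Pred Carrier p} {n m x y} →
      Generated (A ^ n) x → Generated (A ^ m) y → Generated (A ^ (n ℕ.+ m)) (x * y)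
    generated-* (gen x∈) (gen y∈)        = gen (powers-* x∈ y∈)
    generated-* {x = x} (gen x∈) gen0    = resp (sym (zeroʳ x)) gen0
    generated-* {x = x} (gen x∈) (add {y} {z} y∈ z∈) =
      resp (sym (distribˡ x y z)) (add (generated-* (gen x∈) y∈) (generated-* (gen x∈) z∈))
    generated-* {x = x} (gen x∈) (neg {y} y∈) =
      resp (-‿distribʳ-* x y) (neg (generated-* (gen x∈) y∈))
    generated-* (gen x∈) (resp y≈z y∈)   = resp (*-congˡ y≈z) (generated-* (gen x∈) y∈)
    generated-* {y = y} gen0 y∈          = resp (sym (zeroˡ y)) gen0
    generated-* {y = y} (add {x} {z} x∈ z∈) y∈ =
      resp (sym (distribʳ y x z)) (add (generated-* x∈ y∈) (generated-* z∈ y∈))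
    generated-* {y = y} (neg {x} x∈) y∈  = resp (-‿distribˡ-* x y) (neg (generated-* x∈ y∈))
    generated-* (resp x≈z x∈) y∈         = resp (*-congʳ x≈z) (generated-* x∈ y∈)

  graded-* : (A : Pred Carrier p) (n m : ℕ) →
    AbelianGroup.Carrier ⟨ A ^ n ⟩ → AbelianGroup.Carrier ⟨ A ^ m ⟩ →
    AbelianGroup.Carrier ⟨ A ^ (n ℕ.+ m) ⟩
  graded-* A n m g h = proj₁ g * proj₁ h , generated-* (proj₂ g) (proj₂ h)

module Twisted (R : RingWithoutOne c ℓ) (φ : RingWithoutOne.Carrier R → RingWithoutOne.Carrier R)
  (φ-hom : IsRingWithoutOneHomomorphism
             (RingWithoutOne.rawRingWithoutOne R) (RingWithoutOne.rawRingWithoutOne R) φ) where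

  open RingWithoutOne R hiding (zero)
  open IsRingWithoutOneHomomorphism φ-hom
    using (0#-homo; +-homo; *-homo) renaming (⟦⟧-cong to φ-cong)
  open RingProperties R using (-0#≈0#)
  open CommutativeSemigroupProperties
    (AbelianGroup.commutativeSemigroup +-abelianGroup) using (interchange)
  private
    module ≈-Reasoning = SetoidReasoning setoid

  -- The list a₀ ∷ a₁ ∷ … ∷ a_d ∷ [] stands for a₀ + a₁ t + … + a_d t^d.
  Poly : Set c
  Poly = List Carrier

  coeff : Poly → ℕ → Carrier
  coeff []      n       = 0#
  coeff (a ∷ p) zero    = a
  coeff (a ∷ p) (suc n) = coeff p n

  infix 4 _≋_
  record _≋_ (p q : Poly) : Set ℓ where
    constructor coeffs
    field coeff-≈ : ∀ n → coeff p n ≈ coeff q n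
  open _≋_ public

  infixl 6 _⊕_
  infixl 7 _⊛_
  infixr 7 _◃_

  _⊕_ : Poly → Poly → Poly
  []      ⊕ q       = q
  (a ∷ p) ⊕ []      = a ∷ p
  (a ∷ p) ⊕ (b ∷ q) = a + b ∷ p ⊕ q

  ⊝_ : Poly → Poly
  ⊝ p = map -_ p

  _◃_ : Carrier → Poly → Poly
  a ◃ p = map (a *_) p

  -- twist q is the polynomial satisfying t q = (twist q) t.
  twist : Poly → Poly
  twist = map φ

  -- (a + p t) q = a q + p (twist q) t
  _⊛_ : Poly → Poly → Poly
  []      ⊛ q = []
  (a ∷ p) ⊛ q = (a ◃ q) ⊕ (0# ∷ (p ⊛ twist q))

  monomial : Carrier → ℕ → Poly
  monomial a n = replicate n 0# ++ [ a ]

  Homogeneous : ℕ → Pred Poly (c ⊔ ℓ)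
  Homogeneous n p = ∃ λ a → p ≋ monomial a n

  coeff-⊕ : ∀ p q n → coeff (p ⊕ q) n ≈ coeff p n + coeff q n
  coeff-⊕ []      q       n       = sym (+-identityˡ _)
  coeff-⊕ (a ∷ p) []      n       = sym (+-identityʳ _)
  coeff-⊕ (a ∷ p) (b ∷ q) zero    = refl
  coeff-⊕ (a ∷ p) (b ∷ q) (suc n) = coeff-⊕ p q n

  coeff-map : ∀ f → f 0# ≈ 0# → ∀ p n → coeff (map f p) n ≈ f (coeff p n)
  coeff-map f f0 []      n       = sym f0
  coeff-map f f0 (a ∷ p) zero    = refl
  coeff-map f f0 (a ∷ p) (suc n) = coeff-map f f0 p n

  coeff-⊝ : ∀ p n → coeff (⊝ p) n ≈ - coeff p n
  coeff-⊝ = coeff-map -_ -0#≈0#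

  coeff-◃ : ∀ a p n → coeff (a ◃ p) n ≈ a * coeff p n
  coeff-◃ a = coeff-map (a *_) (zeroʳ a)

  coeff-twist : ∀ p n → coeff (twist p) n ≈ φ (coeff p n)
  coeff-twist = coeff-map φ 0#-homo

  private
    ≋-refl : ∀ {p} → p ≋ p
    ≋-refl = coeffs λ _ → refl

    ≋-sym : ∀ {p q} → p ≋ q → q ≋ p
    ≋-sym e = coeffs λ n → sym (coeff-≈ e n)

    ≋-trans : ∀ {p q r} → p ≋ q → q ≋ r → p ≋ r
    ≋-trans e f = coeffs λ n → trans (coeff-≈ e n) (coeff-≈ f n)

    poly-setoid : Setoid c ℓ
    poly-setoid = record
      { Carrier = Poly ; _≈_ = _≋_
      ; isEquivalence = record { refl = ≋-refl ; sym = ≋-sym ; trans = ≋-trans } }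

    module ≋-Reasoning = SetoidReasoning poly-setoid

    ∷-cong : ∀ {a b p q} → a ≈ b → p ≋ q → (a ∷ p) ≋ (b ∷ q)
    ∷-cong a≈b p≋q = coeffs λ { zero → a≈b ; (suc n) → coeff-≈ p≋q n }

    0∷[] : (0# ∷ []) ≋ []
    0∷[] = coeffs λ { zero → refl ; (suc n) → refl }

    ⊕-cong : ∀ {p p′ q q′} → p ≋ p′ → q ≋ q′ → p ⊕ q ≋ p′ ⊕ q′
    ⊕-cong {p} {p′} {q} {q′} e f = coeffs λ n →
      trans (coeff-⊕ p q n)
        (trans (+-cong (coeff-≈ e n) (coeff-≈ f n)) (sym (coeff-⊕ p′ q′ n)))

    ⊕-assoc : ∀ p q r → (p ⊕ q) ⊕ r ≋ p ⊕ (q ⊕ r)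
    ⊕-assoc p q r = coeffs λ n → let open ≈-Reasoning in begin
      coeff ((p ⊕ q) ⊕ r) n                  ≈⟨ coeff-⊕ (p ⊕ q) r n ⟩
      coeff (p ⊕ q) n + coeff r n            ≈⟨ +-congʳ (coeff-⊕ p q n) ⟩
      (coeff p n + coeff q n) + coeff r n    ≈⟨ +-assoc _ _ _ ⟩
      coeff p n + (coeff q n + coeff r n)    ≈⟨ +-congˡ (coeff-⊕ q r n) ⟨
      coeff p n + coeff (q ⊕ r) n            ≈⟨ coeff-⊕ p (q ⊕ r) n ⟨
      coeff (p ⊕ (q ⊕ r)) n                  ∎

    ⊕-comm : ∀ p q → p ⊕ q ≋ q ⊕ p
    ⊕-comm p q = coeffs λ n →
      trans (coeff-⊕ p q n) (trans (+-comm _ _) (sym (coeff-⊕ q p n)))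

    ⊕-identityʳ : ∀ p → p ⊕ [] ≋ p
    ⊕-identityʳ p = ⊕-comm p []

    ⊝-cong : ∀ {p q} → p ≋ q → ⊝ p ≋ ⊝ q
    ⊝-cong {p} {q} e = coeffs λ n →
      trans (coeff-⊝ p n) (trans (-‿cong (coeff-≈ e n)) (sym (coeff-⊝ q n)))

    ⊝-inverseˡ : ∀ p → ⊝ p ⊕ p ≋ []
    ⊝-inverseˡ p = coeffs λ n →
      trans (coeff-⊕ (⊝ p) p n) (trans (+-congʳ (coeff-⊝ p n)) (-‿inverseˡ _))

    ⊝-inverseʳ : ∀ p → p ⊕ ⊝ p ≋ []
    ⊝-inverseʳ p = ≋-trans (⊕-comm p (⊝ p)) (⊝-inverseˡ p)

    ⊕-interchange : ∀ p q r s → (p ⊕ q) ⊕ (r ⊕ s) ≋ (p ⊕ r) ⊕ (q ⊕ s)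
    ⊕-interchange p q r s = coeffs λ n → let open ≈-Reasoning in begin
      coeff ((p ⊕ q) ⊕ (r ⊕ s)) n
        ≈⟨ trans (coeff-⊕ (p ⊕ q) (r ⊕ s) n) (+-cong (coeff-⊕ p q n) (coeff-⊕ r s n)) ⟩
      (coeff p n + coeff q n) + (coeff r n + coeff s n)
        ≈⟨ interchange _ _ _ _ ⟩
      (coeff p n + coeff r n) + (coeff q n + coeff s n)
        ≈⟨ trans (coeff-⊕ (p ⊕ r) (q ⊕ s) n) (+-cong (coeff-⊕ p r n) (coeff-⊕ q s n)) ⟨
      coeff ((p ⊕ r) ⊕ (q ⊕ s)) n ∎

    ◃-cong : ∀ {a b p q} → a ≈ b → p ≋ q → a ◃ p ≋ b ◃ q
    ◃-cong {a} {b} {p} {q} a≈b e = coeffs λ n →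
      trans (coeff-◃ a p n) (trans (*-cong a≈b (coeff-≈ e n)) (sym (coeff-◃ b q n)))

    ◃-zero : ∀ {a} p → a ≈ 0# → a ◃ p ≋ []
    ◃-zero {a} p a≈0 = coeffs λ n →
      trans (coeff-◃ a p n) (trans (*-congʳ a≈0) (zeroˡ _))

    ◃-⊕ : ∀ a p q → a ◃ (p ⊕ q) ≋ (a ◃ p) ⊕ (a ◃ q)
    ◃-⊕ a p q = coeffs λ n → let open ≈-Reasoning in begin
      coeff (a ◃ (p ⊕ q)) n              ≈⟨ trans (coeff-◃ a (p ⊕ q) n) (*-congˡ (coeff-⊕ p q n)) ⟩
      a * (coeff p n + coeff q n)        ≈⟨ distribˡ _ _ _ ⟩
      a * coeff p n + a * coeff q n      ≈⟨ +-cong (coeff-◃ a p n) (coeff-◃ a q n) ⟨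
      coeff (a ◃ p) n + coeff (a ◃ q) n  ≈⟨ coeff-⊕ (a ◃ p) (a ◃ q) n ⟨
      coeff ((a ◃ p) ⊕ (a ◃ q)) n        ∎

    +-◃ : ∀ a b p → (a + b) ◃ p ≋ (a ◃ p) ⊕ (b ◃ p)
    +-◃ a b p = coeffs λ n → let open ≈-Reasoning in begin
      coeff ((a + b) ◃ p) n              ≈⟨ coeff-◃ (a + b) p n ⟩
      (a + b) * coeff p n                ≈⟨ distribʳ _ _ _ ⟩
      a * coeff p n + b * coeff p n      ≈⟨ +-cong (coeff-◃ a p n) (coeff-◃ b p n) ⟨
      coeff (a ◃ p) n + coeff (b ◃ p) n  ≈⟨ coeff-⊕ (a ◃ p) (b ◃ p) n ⟨
      coeff ((a ◃ p) ⊕ (b ◃ p)) n        ∎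

    *-◃ : ∀ a b p → (a * b) ◃ p ≋ a ◃ (b ◃ p)
    *-◃ a b p = coeffs λ n → let open ≈-Reasoning in begin
      coeff ((a * b) ◃ p) n    ≈⟨ coeff-◃ (a * b) p n ⟩
      (a * b) * coeff p n      ≈⟨ *-assoc _ _ _ ⟩
      a * (b * coeff p n)      ≈⟨ *-congˡ (coeff-◃ b p n) ⟨
      a * coeff (b ◃ p) n      ≈⟨ coeff-◃ a (b ◃ p) n ⟨
      coeff (a ◃ (b ◃ p)) n    ∎

    twist-cong : ∀ {p q} → p ≋ q → twist p ≋ twist q
    twist-cong {p} {q} e = coeffs λ n →
      trans (coeff-twist p n) (trans (φ-cong (coeff-≈ e n)) (sym (coeff-twist q n)))

    twist-⊕ : ∀ p q → twist (p ⊕ q) ≋ twist p ⊕ twist q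
    twist-⊕ p q = coeffs λ n → let open ≈-Reasoning in begin
      coeff (twist (p ⊕ q)) n                  ≈⟨ trans (coeff-twist (p ⊕ q) n) (φ-cong (coeff-⊕ p q n)) ⟩
      φ (coeff p n + coeff q n)                ≈⟨ +-homo _ _ ⟩
      φ (coeff p n) + φ (coeff q n)            ≈⟨ +-cong (coeff-twist p n) (coeff-twist q n) ⟨
      coeff (twist p) n + coeff (twist q) n    ≈⟨ coeff-⊕ (twist p) (twist q) n ⟨
      coeff (twist p ⊕ twist q) n              ∎

    twist-◃ : ∀ a p → twist (a ◃ p) ≋ φ a ◃ twist p
    twist-◃ a p = coeffs λ n → let open ≈-Reasoning in begin
      coeff (twist (a ◃ p)) n    ≈⟨ trans (coeff-twist (a ◃ p) n) (φ-cong (coeff-◃ a p n)) ⟩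
      φ (a * coeff p n)          ≈⟨ *-homo _ _ ⟩
      φ a * φ (coeff p n)        ≈⟨ *-congˡ (coeff-twist p n) ⟨
      φ a * coeff (twist p) n    ≈⟨ coeff-◃ (φ a) (twist p) n ⟨
      coeff (φ a ◃ twist p) n    ∎

    []-⊛ : ∀ p q → p ≋ [] → p ⊛ q ≋ []
    []-⊛ []      q e = ≋-refl
    []-⊛ (a ∷ p) q e = ≋-trans
      (⊕-cong (◃-zero q (coeff-≈ e 0))
        (∷-cong refl ([]-⊛ p (twist q) (coeffs λ n → coeff-≈ e (suc n)))))
      0∷[]

    ⊛-congʳ : ∀ p p′ q → p ≋ p′ → p ⊛ q ≋ p′ ⊛ q
    ⊛-congʳ []      p′       q e = ≋-sym ([]-⊛ p′ q (≋-sym e))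
    ⊛-congʳ (a ∷ p) []       q e = []-⊛ (a ∷ p) q e
    ⊛-congʳ (a ∷ p) (b ∷ p′) q e =
      ⊕-cong (◃-cong (coeff-≈ e 0) ≋-refl)
        (∷-cong refl (⊛-congʳ p p′ (twist q) (coeffs λ n → coeff-≈ e (suc n))))

    ⊛-congˡ : ∀ p q q′ → q ≋ q′ → p ⊛ q ≋ p ⊛ q′
    ⊛-congˡ []      q q′ e = ≋-refl
    ⊛-congˡ (a ∷ p) q q′ e =
      ⊕-cong (◃-cong refl e) (∷-cong refl (⊛-congˡ p _ _ (twist-cong e)))

    ⊛-cong : ∀ {p p′ q q′} → p ≋ p′ → q ≋ q′ → p ⊛ q ≋ p′ ⊛ q′
    ⊛-cong {p} {p′} {q} {q′} e f = ≋-trans (⊛-congʳ p p′ q e) (⊛-congˡ p′ q q′ f)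

    0∷-⊕ : ∀ p q → (0# ∷ (p ⊕ q)) ≋ (0# ∷ p) ⊕ (0# ∷ q)
    0∷-⊕ p q = ∷-cong (sym (+-identityˡ 0#)) ≋-refl

    ⊛-distribˡ : ∀ p q r → p ⊛ (q ⊕ r) ≋ (p ⊛ q) ⊕ (p ⊛ r)
    ⊛-distribˡ []      q r = ≋-refl
    ⊛-distribˡ (a ∷ p) q r = let open ≋-Reasoning in begin
      (a ◃ (q ⊕ r)) ⊕ (0# ∷ (p ⊛ twist (q ⊕ r)))
        ≈⟨ ⊕-cong (◃-⊕ a q r) (∷-cong refl
             (≋-trans (⊛-congˡ p _ _ (twist-⊕ q r)) (⊛-distribˡ p (twist q) (twist r)))) ⟩
      ((a ◃ q) ⊕ (a ◃ r)) ⊕ (0# ∷ ((p ⊛ twist q) ⊕ (p ⊛ twist r)))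
        ≈⟨ ⊕-cong ≋-refl (0∷-⊕ (p ⊛ twist q) (p ⊛ twist r)) ⟩
      ((a ◃ q) ⊕ (a ◃ r)) ⊕ ((0# ∷ (p ⊛ twist q)) ⊕ (0# ∷ (p ⊛ twist r)))
        ≈⟨ ⊕-interchange (a ◃ q) (a ◃ r) (0# ∷ (p ⊛ twist q)) (0# ∷ (p ⊛ twist r)) ⟩
      ((a ∷ p) ⊛ q) ⊕ ((a ∷ p) ⊛ r) ∎

    ⊛-distribʳ : ∀ r p q → (p ⊕ q) ⊛ r ≋ (p ⊛ r) ⊕ (q ⊛ r)
    ⊛-distribʳ r []      q       = ≋-refl
    ⊛-distribʳ r (a ∷ p) []      = ≋-sym (⊕-identityʳ _)
    ⊛-distribʳ r (a ∷ p) (b ∷ q) = let open ≋-Reasoning in begin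
      ((a + b) ◃ r) ⊕ (0# ∷ ((p ⊕ q) ⊛ twist r))
        ≈⟨ ⊕-cong (+-◃ a b r) (≋-trans
             (∷-cong refl (⊛-distribʳ (twist r) p q))
             (0∷-⊕ (p ⊛ twist r) (q ⊛ twist r))) ⟩
      ((a ◃ r) ⊕ (b ◃ r)) ⊕ ((0# ∷ (p ⊛ twist r)) ⊕ (0# ∷ (q ⊛ twist r)))
        ≈⟨ ⊕-interchange (a ◃ r) (b ◃ r) (0# ∷ (p ⊛ twist r)) (0# ∷ (q ⊛ twist r)) ⟩
      ((a ∷ p) ⊛ r) ⊕ ((b ∷ q) ⊛ r) ∎

    0∷-⊛ : ∀ p q → (0# ∷ p) ⊛ q ≋ (0# ∷ (p ⊛ twist q))
    0∷-⊛ p q = ⊕-cong (◃-zero q refl) ≋-refl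

    ◃-⊛ : ∀ a p q → (a ◃ p) ⊛ q ≋ a ◃ (p ⊛ q)
    ◃-⊛ a []      q = ≋-refl
    ◃-⊛ a (b ∷ p) q = let open ≋-Reasoning in begin
      ((a * b) ◃ q) ⊕ (0# ∷ ((a ◃ p) ⊛ twist q))
        ≈⟨ ⊕-cong (*-◃ a b q) (∷-cong (sym (zeroʳ a)) (◃-⊛ a p (twist q))) ⟩
      (a ◃ (b ◃ q)) ⊕ (a ◃ (0# ∷ (p ⊛ twist q)))
        ≈⟨ ◃-⊕ a (b ◃ q) (0# ∷ (p ⊛ twist q)) ⟨
      a ◃ ((b ∷ p) ⊛ q) ∎

    twist-⊛ : ∀ p q → twist (p ⊛ q) ≋ twist p ⊛ twist q
    twist-⊛ []      q = ≋-refl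
    twist-⊛ (a ∷ p) q = let open ≋-Reasoning in begin
      twist ((a ◃ q) ⊕ (0# ∷ (p ⊛ twist q)))
        ≈⟨ twist-⊕ (a ◃ q) (0# ∷ (p ⊛ twist q)) ⟩
      twist (a ◃ q) ⊕ (φ 0# ∷ twist (p ⊛ twist q))
        ≈⟨ ⊕-cong (twist-◃ a q) (∷-cong 0#-homo (twist-⊛ p (twist q))) ⟩
      twist (a ∷ p) ⊛ twist q ∎

    ⊛-assoc : ∀ p q r → (p ⊛ q) ⊛ r ≋ p ⊛ (q ⊛ r)
    ⊛-assoc []      q r = ≋-refl
    ⊛-assoc (a ∷ p) q r = let open ≋-Reasoning in begin
      ((a ◃ q) ⊕ (0# ∷ (p ⊛ twist q))) ⊛ r
        ≈⟨ ⊛-distribʳ r (a ◃ q) (0# ∷ (p ⊛ twist q)) ⟩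
      ((a ◃ q) ⊛ r) ⊕ ((0# ∷ (p ⊛ twist q)) ⊛ r)
        ≈⟨ ⊕-cong (◃-⊛ a q r) (0∷-⊛ (p ⊛ twist q) r) ⟩
      (a ◃ (q ⊛ r)) ⊕ (0# ∷ ((p ⊛ twist q) ⊛ twist r))
        ≈⟨ ⊕-cong ≋-refl (∷-cong refl (≋-trans (⊛-assoc p (twist q) (twist r))
             (⊛-congˡ p _ _ (≋-sym (twist-⊛ q r))))) ⟩
      (a ∷ p) ⊛ (q ⊛ r) ∎

  R[t] : RingWithoutOne c ℓ
  R[t] = record
    { Carrier = Poly
    ; _≈_     = _≋_
    ; _+_     = _⊕_
    ; _*_     = _⊛_
    ; -_      = ⊝_
    ; 0#      = []
    ; isRingWithoutOne = record
      { +-isAbelianGroup = record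
        { isGroup = record
          { isMonoid = record
            { isSemigroup = record
              { isMagma = record
                { isEquivalence = Setoid.isEquivalence poly-setoid
                ; ∙-cong = ⊕-cong
                }
              ; assoc = ⊕-assoc
              }
            ; identity = (λ p → ≋-refl) , ⊕-identityʳ
            }
          ; inverse = ⊝-inverseˡ , ⊝-inverseʳ
          ; ⁻¹-cong = ⊝-cong
          }
        ; comm = ⊕-comm
        }
      ; *-cong  = ⊛-cong
      ; *-assoc = ⊛-assoc
      ; distrib = ⊛-distribˡ , ⊛-distribʳ
      }
    }

  φ^_ : ℕ → Carrier → Carrier
  (φ^ zero)  b = b
  (φ^ suc n) b = φ ((φ^ n) b)

  private
    φ^-φ : ∀ n b → (φ^ n) (φ b) ≡ φ ((φ^ n) b)
    φ^-φ zero    b = ≡.refl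
    φ^-φ (suc n) b = ≡.cong φ (φ^-φ n b)

    monomial-cong : ∀ {a b} n → a ≈ b → monomial a n ≋ monomial b n
    monomial-cong zero    a≈b = ∷-cong a≈b ≋-refl
    monomial-cong (suc n) a≈b = ∷-cong refl (monomial-cong n a≈b)

    twist-monomial : ∀ b m → twist (monomial b m) ≋ monomial (φ b) m
    twist-monomial b zero    = ≋-refl
    twist-monomial b (suc m) = ∷-cong 0#-homo (twist-monomial b m)

    ◃-monomial : ∀ a b m → a ◃ monomial b m ≋ monomial (a * b) m
    ◃-monomial a b zero    = ≋-refl
    ◃-monomial a b (suc m) = ∷-cong (zeroʳ a) (◃-monomial a b m)

  monomial-⊛ : ∀ a n b m → monomial a n ⊛ monomial b m ≋ monomial (a * (φ^ n) b) (n ℕ.+ m)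
  monomial-⊛ a zero b m = ≋-trans (⊕-cong (◃-monomial a b m) 0∷[]) (⊕-identityʳ _)
  monomial-⊛ a (suc n) b m = let open ≋-Reasoning in begin
    (0# ∷ monomial a n) ⊛ monomial b m
      ≈⟨ 0∷-⊛ (monomial a n) (monomial b m) ⟩
    (0# ∷ (monomial a n ⊛ twist (monomial b m)))
      ≈⟨ ∷-cong refl (≋-trans (⊛-congˡ (monomial a n) _ _ (twist-monomial b m))
           (monomial-⊛ a n (φ b) m)) ⟩
    (0# ∷ monomial (a * (φ^ n) (φ b)) (n ℕ.+ m))
      ≡⟨ ≡.cong (λ x → 0# ∷ monomial (a * x) (n ℕ.+ m)) (φ^-φ n b) ⟩
    monomial (a * (φ^ suc n) b) (suc n ℕ.+ m) ∎

module _ (R₀ : RingWithoutOne c ℓ) where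
  open RingWithoutOne R₀ using (Carrier; rawRingWithoutOne)

  IsAutomorphism : (Carrier → Carrier) → Set (c ⊔ ℓ)
  IsAutomorphism = IsRingWithoutOneIsoMorphism rawRingWithoutOne rawRingWithoutOne

-- Injective additive maps ι n from ⟨ A ^ n ⟩ to the degree n component of the
-- twisted polynomial ring, n ≥ 1, compatible with multiplication. The map
-- ι 0 is present only to avoid carrying proofs of n ≥ 1, and is unconstrained.
record GradedEmbedding
  {c₀ ℓ₀} (R : RingWithoutOne c ℓ) (A : Pred (RingWithoutOne.Carrier R) p)
  (R₀ : RingWithoutOne c₀ ℓ₀)
  (φ : RingWithoutOne.Carrier R₀ → RingWithoutOne.Carrier R₀) (φ-auto : IsAutomorphism R₀ φ)
  : Set (c ⊔ ℓ ⊔ p ⊔ c₀ ⊔ ℓ₀) where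
  open Subsets R
  open Twisted R₀ φ (IsRingWithoutOneIsoMorphism.isRingWithoutOneHomomorphism φ-auto)
    using (R[t]; Homogeneous)
  open RingWithoutOne R[t] using () renaming
    (Carrier to R₀[t]; _≈_ to _≈ₜ_; _*_ to _*ₜ_; +-rawGroup to R₀[t]-rawGroup)
  field
    ι           : ∀ n → AbelianGroup.Carrier ⟨ A ^ n ⟩ → R₀[t]
    homogeneous : ∀ n → 1 ℕ.≤ n → ∀ g → Homogeneous n (ι n g)
    embedding   : ∀ n → 1 ℕ.≤ n →
                  IsGroupMonomorphism (AbelianGroup.rawGroup ⟨ A ^ n ⟩) R₀[t]-rawGroup (ι n)
    ι-*         : ∀ n m → 1 ℕ.≤ n → 1 ℕ.≤ m → ∀ g h →
                  ι n g *ₜ ι m h ≈ₜ ι (n ℕ.+ m) (graded-* A n m g h)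

{-# OPTIONS --safe #-}
module Submission where

-- Write D for A·A. Since |D - D| ≤ K |A| and |A| ≤ K |D|, the set D is covered by K^C translates of the
-- set of differences with many representations in D, so all iterated sums of D - D have size at most
-- K^C |A|. If A - A has few zero divisors, it contains a non-zero-divisor u. Call x rational over w if
-- x s = w t for some s, t ∈ A - A with s a non-zero-divisor. By Ruzsa covering, x A + w A is then small,
-- and conversely, if x A + w A is small, the collisions x a + w b = x a′ + w b′ produce many such pairs
-- (s , t), because few of the differences a - a′ are zero divisors. This gap makes the rational elements
-- over w = u^n an additive group of size at most K^C |A|, uniformly in n, and it contains A^n. So the
-- groups ⟨ A^n ⟩ have bounded size; they embed into one another by multiplication by u on either side,
-- and hence for some m all maps x ↦ x u^n and x ↦ u^n x from ⟨ A^m ⟩ to ⟨ A^(m+n) ⟩ are bijective. The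
-- formal fractions x u^(-m), x ∈ ⟨ A^m ⟩, form the ring R₀, conjugation by u is φ, and
-- ι n g = (g u^(-n)) t^n.

open import Defs
open import Level using (Level; _⊔_; 0ℓ; Lift; lift; lower)
open import Algebra.Bundles using (AbelianGroup; RingWithoutOne)
open import Algebra.Morphism.Structures using (IsRingWithoutOneIsoMorphism)
import Algebra.Properties.AbelianGroup as AbelianGroupProperties
import Algebra.Properties.CommutativeSemigroup as CommutativeSemigroupProperties
import Algebra.Properties.RingWithoutOne as RingProperties
import Algebra.Solver.CommutativeMonoid.Normal as CommutativeMonoidNormal
open import Axiom.ExcludedMiddle using (ExcludedMiddle)
open import Data.Fin.Base using (Fin; zero; suc)
open import Data.Fin.Properties using (injective⇒≤)
open import Data.Integer.Base as ℤ using (+_)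
import Data.Integer.Properties as ℤ
open import Data.List.Base using (List; []; _∷_; length; map; _++_; filter; lookup; cartesianProduct; allFin)
open import Data.List.Properties using (length-map; length-++; length-tabulate)
import Data.List.Membership.Setoid as Membership
import Data.List.Membership.Setoid.Properties as ∈
open import Data.List.Membership.Propositional.Properties using (∈-lookup; ∈-allFin)
open import Data.List.Relation.Unary.All as All using (All; []; _∷_)
import Data.List.Relation.Unary.All.Properties as All
open import Data.List.Relation.Unary.AllPairs using (AllPairs; []; _∷_)
open import Data.List.Relation.Unary.Any as Any using (Any; here; there)
import Data.List.Relation.Unary.Any.Properties as Any
import Data.List.Relation.Unary.Unique.Setoid as UniqueSetoid
import Data.List.Relation.Unary.Unique.Setoid.Properties as Unique
import Data.List.Relation.Unary.Unique.Propositional.Properties as UniqueP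
open import Data.Nat.Base as ℕ using (ℕ; zero; suc; _≤_; _<_; _∸_; z≤n; s≤s)
open import Data.Nat.DivMod using (_/_; _%_; m≡m%n+[m/n]*n; m%n<n; m/n*n≤m)
import Data.Nat.Properties as ℕ
open import Data.Nat.Properties
  using (module ≤-Reasoning; ≤-trans; ≤-refl; ≤-reflexive; <-irrefl; <⇒≱; <⇒≤; ≰⇒>; n≤1+n; 1+n≰n;
    m≤n⇒m≤1+n; _≤?_; m≤n*m; m^n>0; n≤0⇒n≡0; m∸n≡0⇒m≤n; m∸n+n≡m; m+n∸n≡m; +-suc; +-mono-≤;
    +-monoʳ-≤; +-monoˡ-<; +-cancelʳ-≤; *-mono-≤; *-monoʳ-≤; *-monoˡ-≤; *-monoˡ-<; *-cancelˡ-<;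
    *-cancelʳ-≤; ∸-monoʳ-≤; ∸-monoˡ-≤)
open import Data.Nat.Solver using (module +-*-Solver)
open import Data.Product.Base using (Σ; ∃; ∃₂; _×_; _,_; proj₁; proj₂)
open import Data.Product.Relation.Binary.Pointwise.NonDependent using (_×ₛ_)
open import Data.Rational.Base as ℚ using (ℚ; 0ℚ; 1ℚ; ½; mkℚ; toℚᵘ)
import Data.Rational.Properties as ℚ
import Data.Rational.Solver as ℚSolver
open import Data.Rational.Unnormalised.Base as ℚᵘ using (mkℚᵘ; *≡*; *≤*)
import Data.Rational.Unnormalised.Properties as ℚᵘ
open import Data.Sum.Base as Sum using (_⊎_; inj₁; inj₂; [_,_]′)
open import Data.Vec.Base as Vec using (Vec; []; _∷_)
open import Function.Base using (_∘_; id)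
open import Function.Bundles using (Equivalence; mk⇔)
open import Relation.Binary.Bundles using (Setoid)
open import Relation.Binary.Definitions using () renaming (_Respects_ to _Resp_)
open import Relation.Binary.PropositionalEquality as ≡ using (_≡_)
import Relation.Binary.Reasoning.Setoid as SetoidReasoning
open import Relation.Nullary using (¬_; Dec; yes; no; contradiction)
open import Relation.Nullary.Decidable using (map′; ¬?; decidable-stable)
open import Relation.Unary using (Pred; Satisfiable; U; _⊆_; _∪_; _∩_; _∖_; Decidable)

-- The obstacle is uniformity in n: bounding sums and products of rational elements step by step
-- would lose a constant each time. Here a closure step starts from a single pair (s , t) for each
-- element and returns more than k₀ pairs for the result, with k₀ about N / K^C, so that all losses
-- are regained. Over a fixed w the pairs of different elements are disjoint subsets of (A - A)²,
-- which bounds the number of rational elements independently of w.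
--
-- The hypothesis controls only D = A·A, so every set has to be moved into D - D. The
-- non-zero-divisor u is a difference of elements of A, hence A u and u A lie in D - D, and even |A
-- - A| is bounded only through u (A - A).
--
-- R need not embed in a ring of fractions. Rationality is therefore an equation x s = w t, with s
-- acting on the right of x; it suffices because x s a = w t a. For the same reason R₀ consists of
-- numerators of one fixed degree m. Choosing |⟨ A^m ⟩| maximal makes it possible to divide by
-- powers of u from there on.

private
  variable
    c c₁ ℓ ℓ₁ p q r : Level
    k m n : ℕ

-- Finite subsets of setoids

module _ (S : Setoid c ℓ) where
  open Setoid S
  open Membership S using (_∈_)
  open UniqueSetoid S using (Unique)

  -- Counts are kept as one-sided bounds. A covering list may repeat elements or leave P, so upper
  -- bounds pass to subsets, unions and images without deciding membership; lower bounds need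
  -- distinct elements. The two meet in `AtLeast≤AtMost`.
  AtMost : Pred Carrier p → ℕ → Set _
  AtMost P n = ∃ λ ys → length ys ≤ n × (∀ {x} → P x → x ∈ ys)

  AtLeast : Pred Carrier p → ℕ → Set _
  AtLeast P n = ∃ λ xs → Unique xs × All P xs × n ≤ length xs

  AtMost-⊆ : {P : Pred Carrier p} {Q : Pred Carrier q} → P ⊆ Q → AtMost Q n → AtMost P n
  AtMost-⊆ P⊆Q (ys , ys≤n , Q⊆ys) = ys , ys≤n , Q⊆ys ∘ P⊆Q

  AtMost-≤ : {P : Pred Carrier p} → m ≤ n → AtMost P m → AtMost P n
  AtMost-≤ m≤n (ys , ys≤m , P⊆ys) = ys , ≤-trans ys≤m m≤n , P⊆ys

  AtLeast-≤ : {P : Pred Carrier p} → m ≤ n → AtLeast P n → AtLeast P m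
  AtLeast-≤ m≤n (xs , xs! , xs⊆P , n≤) = xs , xs! , xs⊆P , ≤-trans m≤n n≤

  AtLeast-⊆ : {P : Pred Carrier p} {Q : Pred Carrier q} → P ⊆ Q → AtLeast P n → AtLeast Q n
  AtLeast-⊆ P⊆Q (xs , xs! , xs⊆P , n≤) = xs , xs! , All.map P⊆Q xs⊆P , n≤

  AtMost-⋃ : {I : Set c₁} {F : I → Pred Carrier p} (is : List I) → All (λ i → AtMost (F i) n) is →
             AtMost (λ x → Any (λ i → F i x) is) (length is ℕ.* n)
  AtMost-⋃ []       []                          = [] , z≤n , λ ()
  AtMost-⋃ (i ∷ is) ((ys , ys≤n , F⊆ys) ∷ rest) with AtMost-⋃ is rest
  ... | zs , zs≤ , ⋃⊆zs = ys ++ zs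
      , ≤-trans (≤-reflexive (length-++ ys)) (+-mono-≤ ys≤n zs≤)
      , λ { (here x∈F) → ∈.∈-++⁺ˡ S (F⊆ys x∈F) ; (there x∈⋃) → ∈.∈-++⁺ʳ S ys (⋃⊆zs x∈⋃) }

  AtLeast-∪ : {P : Pred Carrier p} {Q : Pred Carrier q} → (∀ {x y} → P x → Q y → ¬ x ≈ y) →
              AtLeast P m → AtLeast Q n → AtLeast (P ∪ Q) (m ℕ.+ n)
  AtLeast-∪ P#Q (xs , xs! , xs⊆P , m≤) (ys , ys! , ys⊆Q , n≤) = xs ++ ys
    , Unique.++⁺ S xs! ys! disjoint
    , All.++⁺ (All.map inj₁ xs⊆P) (All.map inj₂ ys⊆Q)
    , ≤-trans (+-mono-≤ m≤ n≤) (≤-reflexive (≡.sym (length-++ xs)))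
    where
    disjoint : ∀ {v} → ¬ (v ∈ xs × v ∈ ys)
    disjoint (v∈xs , v∈ys) with All.lookupAny xs⊆P v∈xs | All.lookupAny ys⊆Q v∈ys
    ... | Px , v≈x | Qy , v≈y = P#Q Px Qy (trans (sym v≈x) v≈y)

  lookup-injective : ∀ {xs} → Unique xs → ∀ {i j} → lookup xs i ≈ lookup xs j → i ≡ j
  lookup-injective (x∉xs ∷ xs!) {zero}  {zero}  _ = ≡.refl
  lookup-injective (x∉xs ∷ xs!) {zero}  {suc j} e = contradiction e (All.lookup x∉xs (∈-lookup j))
  lookup-injective (x∉xs ∷ xs!) {suc i} {zero}  e = contradiction (sym e) (All.lookup x∉xs (∈-lookup i))
  lookup-injective (x∉xs ∷ xs!) {suc i} {suc j} e = ≡.cong suc (lookup-injective xs! e)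

  -- Pigeonhole: two distinct elements cannot occupy the same position of the covering list.
  AtLeast≤AtMost : {P : Pred Carrier p} → AtLeast P m → AtMost P n → m ≤ n
  AtLeast≤AtMost (xs , xs! , xs⊆P , m≤) (ys , ≤n , P⊆ys) =
    ≤-trans m≤ (≤-trans (injective⇒≤ {f = position} position-injective) ≤n)
    where
    in-ys : ∀ i → lookup xs i ∈ ys
    in-ys i = P⊆ys (All.lookup xs⊆P (∈-lookup i))

    position : Fin (length xs) → Fin (length ys)
    position i = Any.index (in-ys i)

    position-injective : ∀ {i j} → position i ≡ position j → i ≡ j
    position-injective {i} {j} e =
      lookup-injective xs! (∈.index-injective S (in-ys i) (in-ys j) e)

  AtLeast-filter : {P : Pred Carrier p} {Q : Pred Carrier q} → Decidable Q →
                   AtLeast P m → AtMost (P ∖ Q) n → AtLeast (P ∩ Q) (m ∸ n)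
  AtLeast-filter {n = n} {P = P} {Q} Q? (xs , xs! , xs⊆P , m≤) P∖Q≤n =
      filter Q? xs , Unique.filter⁺ S Q? xs!
    , All.zip (All.filter⁺ Q? xs⊆P , All.all-filter Q? xs)
    , ≤-trans (∸-monoʳ-≤ _ removed)
        (≤-trans (∸-monoˡ-≤ (length (filter ∁Q? xs)) (≤-trans m≤ (split xs)))
          (≤-reflexive (m+n∸n≡m (length (filter Q? xs)) (length (filter ∁Q? xs)))))
    where
    ∁Q? = λ x → ¬? (Q? x)

    removed : length (filter ∁Q? xs) ≤ n
    removed = AtLeast≤AtMost
      (filter ∁Q? xs , Unique.filter⁺ S ∁Q? xs!
      , All.zip (All.filter⁺ ∁Q? xs⊆P , All.all-filter ∁Q? xs) , ≤-refl) P∖Q≤n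

    split : ∀ xs → length xs ≤ length (filter Q? xs) ℕ.+ length (filter ∁Q? xs)
    split []       = z≤n
    split (x ∷ xs) with Q? x
    ... | yes _ = s≤s (split xs)
    ... | no  _ = ≤-trans (s≤s (split xs)) (≤-reflexive (≡.sym (+-suc _ _)))

  module _ {r} (em : ExcludedMiddle (c ⊔ ℓ ⊔ r)) where

    -- A greedy choice of new elements of P either reaches n + 1 of them or
    -- gets stuck at a complete enumeration.
    dichotomy : (P : Pred Carrier (c ⊔ ℓ ⊔ r)) → ∀ n → AtLeast P (suc n) ⊎
      (∃ λ xs → Unique xs × All P xs × length xs ≤ n × (∀ {x} → P x → x ∈ xs))
    dichotomy P zero with em {∃ P}
    ... | yes (x , Px) = inj₁ (x ∷ [] , [] ∷ [] , Px ∷ [] , s≤s z≤n)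
    ... | no  ¬∃P      = inj₂ ([] , [] , [] , z≤n , λ Px → contradiction (_ , Px) ¬∃P)
    dichotomy P (suc n) with dichotomy P n
    ... | inj₂ (xs , xs! , xs⊆P , ≤n , P⊆xs) = inj₂ (xs , xs! , xs⊆P , m≤n⇒m≤1+n ≤n , P⊆xs)
    ... | inj₁ (xs , xs! , xs⊆P , n<) with em {∃ λ x → P x × ¬ x ∈ xs} | length xs ≤? suc n
    ...   | yes (x , Px , x∉xs) | _ =
      inj₁ (x ∷ xs , ∈.∉⇒All[≉] S x∉xs ∷ xs! , Px ∷ xs⊆P , s≤s n<)
    ...   | no _ | no ≰n = inj₁ (xs , xs! , xs⊆P , ≰⇒> ≰n)
    ...   | no ¬new | yes ≤n = inj₂ (xs , xs! , xs⊆P , ≤n , λ {x} Px →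
      decidable-stable (map′ lower (lift {ℓ = r}) em) λ x∉xs → ¬new (x , Px , x∉xs))

    AtMost-dichotomy : (P : Pred Carrier (c ⊔ ℓ ⊔ r)) → ∀ n → AtLeast P (suc n) ⊎ AtMost P n
    AtMost-dichotomy P n with dichotomy P n
    ... | inj₁ many = inj₁ many
    ... | inj₂ (xs , _ , _ , ≤n , P⊆xs) = inj₂ (xs , ≤n , P⊆xs)

    enumerate : {P : Pred Carrier (c ⊔ ℓ ⊔ r)} → P Resp _≈_ → AtMost P n →
                ∃ λ k → HasCardinality S P k
    enumerate {n = n} {P = P} resp P≤n with dichotomy P n
    ... | inj₁ many = contradiction (AtLeast≤AtMost many P≤n) 1+n≰n
    ... | inj₂ (xs , xs! , xs⊆P , _ , P⊆xs) = length xs , record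
      { elements = xs
      ; unique   = xs!
      ; complete = λ x → mk⇔ P⊆xs λ x∈xs →
          let (Py , x≈y) = All.lookupAny xs⊆P x∈xs in resp (sym x≈y) Py
      ; size     = ≡.refl
      }

    -- Injections and double counting limit the number of distinct elements; this turns such a limit
    -- into a covering list.
    AtMost-from-bound : (P : Pred Carrier (c ⊔ ℓ ⊔ r)) → (∀ {k} → AtLeast P k → k ≤ n) → AtMost P n
    AtMost-from-bound P bound with AtMost-dichotomy P _
    ... | inj₁ many = contradiction (bound many) 1+n≰n
    ... | inj₂ few  = few

  HasCardinality⇒AtMost : {P : Pred Carrier p} → HasCardinality S P n → AtMost P n
  HasCardinality⇒AtMost #P = elements , ≤-reflexive size , λ Px → Equivalence.to (complete _) Px
    where open HasCardinality #P

  HasCardinality⇒AtLeast : {P : Pred Carrier p} → HasCardinality S P n → AtLeast P n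
  HasCardinality⇒AtLeast #P = elements , unique
    , All.tabulateₛ S (λ x∈ → Equivalence.from (complete _) x∈) , ≤-reflexive (≡.sym size)
    where open HasCardinality #P

  HasCardinality⇒Respects : {P : Pred Carrier p} → HasCardinality S P n → P Resp _≈_
  HasCardinality⇒Respects #P x≈y Px =
    Equivalence.from (complete _) (∈.∈-resp-≈ S x≈y (Equivalence.to (complete _) Px))
    where open HasCardinality #P

-- Images, fibres and products of finite sets

module _ (S : Setoid c ℓ) (T : Setoid c₁ ℓ₁) where
  private
    module S = Setoid S
    module T = Setoid T

  AtMost-image : {P : Pred S.Carrier p} {Q : Pred T.Carrier q} (f : S.Carrier → T.Carrier) →
    (∀ {x y} → x S.≈ y → f x T.≈ f y) → (∀ {y} → Q y → ∃ λ x → P x × y T.≈ f x) →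
    AtMost S P n → AtMost T Q n
  AtMost-image f f-cong Q⊆fP (xs , xs≤n , P⊆xs) = map f xs
    , ≤-trans (≤-reflexive (length-map f xs)) xs≤n
    , λ Qy → let (x , Px , y≈fx) = Q⊆fP Qy in
        ∈.∈-resp-≈ T (T.sym y≈fx) (∈.∈-map⁺ S T f-cong (P⊆xs Px))

  AtLeast-image : {P : Pred S.Carrier p} {Q : Pred T.Carrier q} (f : S.Carrier → T.Carrier) →
    (∀ {x y} → P x → P y → f x T.≈ f y → x S.≈ y) → (∀ {x} → P x → Q (f x)) →
    AtLeast S P n → AtLeast T Q n
  AtLeast-image {P = P} f f-injective fP⊆Q (xs , xs! , xs⊆P , n≤) = map f xs
    , unique xs! xs⊆P , All.map⁺ (All.map fP⊆Q xs⊆P)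
    , ≤-trans n≤ (≤-reflexive (≡.sym (length-map f xs)))
    where
    unique : ∀ {xs} → UniqueSetoid.Unique S xs → All P xs → UniqueSetoid.Unique T (map f xs)
    unique []           []          = []
    unique (x∉xs ∷ xs!) (Px ∷ Pxs) =
      All.map⁺ (All.zipWith (λ (x≉y , Py) fx≈fy → x≉y (f-injective Px Py fx≈fy)) (x∉xs , Pxs))
      ∷ unique xs! Pxs

  AtMost-injection : ∀ {r} (em : ExcludedMiddle (c ⊔ ℓ ⊔ r))
    {P : Pred S.Carrier (c ⊔ ℓ ⊔ r)} {Q : Pred T.Carrier q} (f : S.Carrier → T.Carrier) →
    (∀ {x y} → P x → P y → f x T.≈ f y → x S.≈ y) → (∀ {x} → P x → Q (f x)) →
    AtMost T Q n → AtMost S P n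
  AtMost-injection {r = r} em {P} f f-injective fP⊆Q Q≤n = AtMost-from-bound S {r} em P
    λ many → AtLeast≤AtMost T (AtLeast-image f f-injective fP⊆Q many) Q≤n

  -- Double counting, for the situation where each element has at least k representations and a
  -- representation determines its element.
  AtLeast-fibres : {P : Pred S.Carrier p} {Q : Pred T.Carrier q} (F : S.Carrier → Pred T.Carrier r) →
    (∀ {x} → P x → AtLeast T (F x) k) → (∀ {x y} → P x → F x y → Q y) →
    (∀ {x x′ y y′} → P x → P x′ → F x y → F x′ y′ → y T.≈ y′ → x S.≈ x′) →
    AtLeast S P n → AtLeast T Q (n ℕ.* k)
  AtLeast-fibres {k = k} {P = P} F F≥k F⊆Q F# (xs , xs! , xs⊆P , n≤) =
    AtLeast-≤ T (*-monoˡ-≤ k n≤) (AtLeast-⊆ T ⋃⊆Q (union xs! xs⊆P))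
    where
    ⋃⊆Q : ∀ {y} → Any (λ x → P x × F x y) xs → _
    ⋃⊆Q y∈⋃ = let (_ , Px , y∈F) = Any.satisfied y∈⋃ in F⊆Q Px y∈F

    union : ∀ {xs} → UniqueSetoid.Unique S xs → All P xs →
            AtLeast T (λ y → Any (λ x → P x × F x y) xs) (length xs ℕ.* k)
    union []           []         = [] , [] , [] , z≤n
    union (x∉xs ∷ xs!) (Px ∷ Pxs) = AtLeast-⊆ T [ (λ y∈F → here (Px , y∈F)) , there ]′
      (AtLeast-∪ T (λ y∈F y∈⋃ y≈y′ → disjoint x∉xs Px y∈F y≈y′ y∈⋃) (F≥k Px) (union xs! Pxs))
      where
      disjoint : ∀ {x y y′ xs} → All (λ x′ → ¬ x S.≈ x′) xs → P x → F x y → y T.≈ y′ →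
                 ¬ Any (λ x → P x × F x y′) xs
      disjoint (x≉x′ ∷ _) Px y∈F y≈y′ (here (Px′ , y′∈F)) = x≉x′ (F# Px Px′ y∈F y′∈F y≈y′)
      disjoint (_ ∷ x∉)  Px y∈F y≈y′ (there y′∈⋃)        = disjoint x∉ Px y∈F y≈y′ y′∈⋃

  -- If the fibre over every point of the covering list of Q had at most k elements, P would be
  -- covered by m k elements.
  large-fibre : ∀ {r} (em : ExcludedMiddle (c ⊔ ℓ ⊔ ℓ₁ ⊔ r)) {P : Pred S.Carrier (c ⊔ ℓ ⊔ ℓ₁ ⊔ r)}
    {Q : Pred T.Carrier q} (f : S.Carrier → T.Carrier) → (∀ {x} → P x → Q (f x)) →
    AtLeast S P n → AtMost T Q m → m ℕ.* k < n →
    ∃ λ y → AtLeast S (λ x → P x × f x T.≈ y) (suc k)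
  large-fibre {k = k} {r} em {P} f fP⊆Q P≥n (ys , ys≤m , Q⊆ys) mk<n with search ys
    where
    Fibre : T.Carrier → Pred S.Carrier _
    Fibre y x = P x × f x T.≈ y

    search : ∀ ys → (∃ λ y → AtLeast S (Fibre y) (suc k)) ⊎ All (λ y → AtMost S (Fibre y) k) ys
    search []       = inj₂ []
    search (y ∷ ys) with AtMost-dichotomy S {ℓ₁ ⊔ r} em (Fibre y) k | search ys
    ... | inj₁ many | _          = inj₁ (y , many)
    ... | inj₂ _    | inj₁ found = inj₁ found
    ... | inj₂ few  | inj₂ rest  = inj₂ (few ∷ rest)
  ... | inj₁ found = found
  ... | inj₂ small = contradiction
    (≤-trans (AtLeast≤AtMost S P≥n (AtMost-⊆ S (λ Px → Any.map (Px ,_) (Q⊆ys (fP⊆Q Px)))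
      (AtMost-⋃ S ys small))) (*-monoˡ-≤ k ys≤m))
    (<⇒≱ mk<n)

  length-cartesianProduct : (xs : List S.Carrier) (ys : List T.Carrier) →
                            length (cartesianProduct xs ys) ≡ length xs ℕ.* length ys
  length-cartesianProduct []       ys = ≡.refl
  length-cartesianProduct (x ∷ xs) ys = ≡.trans (length-++ (map (x ,_) ys))
    (≡.cong₂ ℕ._+_ (length-map (x ,_) ys) (length-cartesianProduct xs ys))

  AtMost-× : {P : Pred S.Carrier p} {Q : Pred T.Carrier q} → AtMost S P m → AtMost T Q n →
             AtMost (S ×ₛ T) (λ (x , y) → P x × Q y) (m ℕ.* n)
  AtMost-× (xs , xs≤m , P⊆xs) (ys , ys≤n , Q⊆ys) = cartesianProduct xs ys
    , ≤-trans (≤-reflexive (length-cartesianProduct xs ys)) (*-mono-≤ xs≤m ys≤n)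
    , λ (Px , Qy) → ∈.∈-cartesianProduct⁺ S T (P⊆xs Px) (Q⊆ys Qy)

  AtLeast-× : {P : Pred S.Carrier p} {Q : Pred T.Carrier q} → AtLeast S P m → AtLeast T Q n →
              AtLeast (S ×ₛ T) (λ (x , y) → P x × Q y) (m ℕ.* n)
  AtLeast-× {P = P} {Q} (xs , xs! , xs⊆P , m≤) (ys , ys! , ys⊆Q , n≤) = cartesianProduct xs ys
    , Unique.cartesianProduct⁺ S T xs! ys!
    , All.cartesianProduct⁺ (≡.setoid _) (≡.setoid _) xs ys
        (λ x∈ y∈ → All.lookup xs⊆P x∈ , All.lookup ys⊆Q y∈)
    , ≤-trans (*-mono-≤ m≤ n≤) (≤-reflexive (≡.sym (length-cartesianProduct xs ys)))

-- Sumsets in abelian groups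

module AbelianGroupSolver (G : AbelianGroup c ℓ) where
  open AbelianGroup G
  open AbelianGroupProperties G
  open CommutativeSemigroupProperties commutativeSemigroup using (interchange)
  open SetoidReasoning setoid
  private
    module CM = CommutativeMonoidNormal commutativeMonoid

  infixl 6 _:+_ _:-_
  infix  8 :-_

  data Expr (n : ℕ) : Set where
    var  : Fin n → Expr n
    :0   : Expr n
    _:+_ : Expr n → Expr n → Expr n
    :-_  : Expr n → Expr n

  v₀ : ∀ {n} → Expr (suc n)
  v₀ = var zero

  v₁ : ∀ {n} → Expr (2 ℕ.+ n)
  v₁ = var (suc zero)

  v₂ : ∀ {n} → Expr (3 ℕ.+ n)
  v₂ = var (suc (suc zero))

  v₃ : ∀ {n} → Expr (4 ℕ.+ n)
  v₃ = var (suc (suc (suc zero)))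

  v₄ : ∀ {n} → Expr (5 ℕ.+ n)
  v₄ = var (suc (suc (suc (suc zero))))

  v₅ : ∀ {n} → Expr (6 ℕ.+ n)
  v₅ = var (suc (suc (suc (suc (suc zero)))))

  _:-_ : ∀ {n} → Expr n → Expr n → Expr n
  e :- f = e :+ :- f

  ⟦_⟧ : ∀ {n} → Expr n → Vec Carrier n → Carrier
  ⟦ var i ⟧  ρ = Vec.lookup ρ i
  ⟦ :0 ⟧     ρ = ε
  ⟦ e :+ f ⟧ ρ = ⟦ e ⟧ ρ ∙ ⟦ f ⟧ ρ
  ⟦ :- e ⟧   ρ = ⟦ e ⟧ ρ ⁻¹

  positive negative : ∀ {n} → Expr n → CM.Expr n
  positive (var i)  = CM.var i
  positive :0       = CM.id
  positive (e :+ f) = positive e CM.⊕ positive f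
  positive (:- e)   = negative e
  negative (var i)  = CM.id
  negative :0       = CM.id
  negative (e :+ f) = negative e CM.⊕ negative f
  negative (:- e)   = positive e

  private
    split : ∀ {n} (e : Expr n) ρ → ⟦ e ⟧ ρ ∙ CM.⟦ negative e ⟧ ρ ≈ CM.⟦ positive e ⟧ ρ
    split (var i)  ρ = identityʳ _
    split :0       ρ = identityʳ _
    split (e :+ f) ρ = trans (interchange _ _ _ _) (∙-cong (split e ρ) (split f ρ))
    split (:- e)   ρ = begin
      ⟦ e ⟧ ρ ⁻¹ ∙ CM.⟦ positive e ⟧ ρ                 ≈⟨ ∙-congˡ (split e ρ) ⟨
      ⟦ e ⟧ ρ ⁻¹ ∙ (⟦ e ⟧ ρ ∙ CM.⟦ negative e ⟧ ρ)     ≈⟨ \\-leftDividesʳ _ _ ⟩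
      CM.⟦ negative e ⟧ ρ                              ∎

  -- By `split`, an expression is the difference of two negation-free ones. Moving the negative
  -- parts across the equation leaves an identity of commutative monoids, settled by normal forms.
  prove : ∀ {n} (ρ : Vec Carrier n) (e f : Expr n) →
          CM.normalise (positive e CM.⊕ negative f) ≡ CM.normalise (positive f CM.⊕ negative e) →
          ⟦ e ⟧ ρ ≈ ⟦ f ⟧ ρ
  prove ρ e f eq = ∙-cancelʳ _ _ _ (begin
    ⟦ e ⟧ ρ ∙ (CM.⟦ negative e ⟧ ρ ∙ CM.⟦ negative f ⟧ ρ)    ≈⟨ assoc _ _ _ ⟨
    ⟦ e ⟧ ρ ∙ CM.⟦ negative e ⟧ ρ ∙ CM.⟦ negative f ⟧ ρ      ≈⟨ ∙-congʳ (split e ρ) ⟩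
    CM.⟦ positive e CM.⊕ negative f ⟧ ρ                      ≈⟨ CM.correct (positive e CM.⊕ negative f) ρ ⟨
    CM.⟦ CM.normalise (positive e CM.⊕ negative f) ⟧⇓ ρ      ≡⟨ ≡.cong (λ v → CM.⟦ v ⟧⇓ ρ) eq ⟩
    CM.⟦ CM.normalise (positive f CM.⊕ negative e) ⟧⇓ ρ      ≈⟨ CM.correct (positive f CM.⊕ negative e) ρ ⟩
    CM.⟦ positive f CM.⊕ negative e ⟧ ρ                      ≈⟨ ∙-congʳ (split f ρ) ⟨
    ⟦ f ⟧ ρ ∙ CM.⟦ negative f ⟧ ρ ∙ CM.⟦ negative e ⟧ ρ      ≈⟨ assoc _ _ _ ⟩
    ⟦ f ⟧ ρ ∙ (CM.⟦ negative f ⟧ ρ ∙ CM.⟦ negative e ⟧ ρ)    ≈⟨ ∙-congˡ (comm _ _) ⟩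
    ⟦ f ⟧ ρ ∙ (CM.⟦ negative e ⟧ ρ ∙ CM.⟦ negative f ⟧ ρ)    ∎)

-- Constants for sums of differences

opaque
  -- Here κ bounds |B - B| / |B|. `coverSize` is a number μ of translates by which the popular
  -- differences, those with more than |B| / 2μ realisations, cover B. `stepGrowth` is the cost of
  -- adding a popular difference, and `growth` that of adding B - B: two coverings and two popular
  -- differences.
  coverSize stepGrowth growth : ℕ → ℕ
  coverSize  κ = 4 ℕ.* κ
  stepGrowth κ = 2 ℕ.* coverSize κ ℕ.* κ
  growth     κ = coverSize κ ℕ.* (coverSize κ ℕ.* (stepGrowth κ ℕ.* stepGrowth κ))

  coverSize-≡ : ∀ κ → coverSize κ ≡ 4 ℕ.* κ
  coverSize-≡ κ = ≡.refl

  stepGrowth-≡ : ∀ κ → stepGrowth κ ≡ 2 ℕ.* coverSize κ ℕ.* κ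
  stepGrowth-≡ κ = ≡.refl

  growth-≡ : ∀ κ → growth κ ≡ coverSize κ ℕ.* (coverSize κ ℕ.* (stepGrowth κ ℕ.* stepGrowth κ))
  growth-≡ κ = ≡.refl

  growth-positive : ∀ {κ} → 0 < κ → 0 < growth κ
  growth-positive {κ} 0<κ = *-mono-≤ 0<μ (*-mono-≤ 0<μ (*-mono-≤ 0<s 0<s))
    where
    0<μ : 1 ≤ coverSize κ
    0<μ = *-mono-≤ (s≤s (z≤n {3})) 0<κ
    0<s : 1 ≤ stepGrowth κ
    0<s = *-mono-≤ (*-mono-≤ (s≤s (z≤n {1})) 0<μ) 0<κ

-- Ruzsa covering and popular differences

module Sumsets (G : AbelianGroup c ℓ) (r : Level) (em : ExcludedMiddle (c ⊔ ℓ ⊔ r)) where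
  open AbelianGroup G renaming (_∙_ to _+_; ε to 0#; _⁻¹ to infix 8 -_; ∙-cong to +-cong; ∙-congˡ to +-congˡ; ∙-congʳ to +-congʳ; _-_ to infixl 6 _-_)
  open AbelianGroupProperties G using (∙-cancelˡ; ⁻¹-injective)
  open AbelianGroupSolver G

  private
    Subset = Pred Carrier (c ⊔ ℓ ⊔ r)
    S = setoid

  infixl 6 _⊕_ _⊝_

  _⊕_ _⊝_ : Subset → Subset → Subset
  (P ⊕ Q) x = ∃₂ λ a b → P a × Q b × x ≈ a + b
  (P ⊝ Q) x = ∃₂ λ a b → P a × Q b × x ≈ a + - b

  -- The b that realise p as a difference (p + b) - b of two elements of B.
  Realises : Subset → Carrier → Subset
  Realises B p b = B b × B (p + b)

  module _ {Y B : Subset} (B-resp : B Resp _≈_) {b M m t : ℕ} where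

    private
      Far Near : Carrier → Carrier → Set _
      Far  y x = AtMost S (Realises B (y - x)) t
      Near y x = AtLeast S (Realises B (y - x)) (suc t)

      Shifted : Carrier → Subset
      Shifted x v = ∃ λ b → B b × v ≈ x - b

      Shifted-resp : ∀ x → Shifted x Resp _≈_
      Shifted-resp x v≈w (b , Bb , e) = b , Bb , trans (sym v≈w) e

      -- A common point x - b = x′ - b′ gives b = (x - x′) + b′, so b′ realises x - x′, and b′
      -- determines the point.
      intersection : ∀ {x x′} → Far x x′ → AtMost S (Shifted x ∩ Shifted x′) t
      intersection {x} {x′} = AtMost-image S S (λ b → x′ - b) (λ e → +-congˡ (⁻¹-cong e))
        λ { {v} ((b , Bb , e) , (b′ , Bb′ , e′)) → b′
          , (Bb′ , B-resp (trans (prove (x ∷ b ∷ []) v₁ (v₀ :- (v₀ :- v₁)) ≡.refl)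
                    (trans (+-congˡ (⁻¹-cong (trans (sym e) e′)))
                      (prove (x ∷ x′ ∷ b′ ∷ []) (v₀ :- (v₁ :- v₂)) ((v₀ :- v₁) :+ v₂) ≡.refl)))
                    Bb)
          , e′ }

      -- Each translate loses at most t points to each of the fewer than m translates after it in
      -- the list, so b ∸ m t of its points are new.
      spread : AtLeast S B b → ∀ {X} → AllPairs Far X → length X ≤ m →
               AtLeast S (λ v → Any (λ x → Shifted x v) X) (length X ℕ.* (b ∸ m ℕ.* t))
      spread B≥b []                        _   = [] , [] , [] , z≤n
      spread B≥b {x ∷ X} (x-far ∷ X-far) X≤m =
        AtLeast-⊆ S [ (λ (v∈ , _) → here v∈) , there ]′
          (AtLeast-∪ S (λ (_ , v∉) w∈ v≈w → v∉ (Any.map (λ {x} → Shifted-resp x (sym v≈w)) w∈))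
            (AtLeast-≤ S (∸-monoʳ-≤ b (*-monoˡ-≤ t (<⇒≤ X≤m)))
              (AtLeast-filter S (λ v → em)
                (AtLeast-image S S (λ b → x - b) (λ _ _ e → ⁻¹-injective (∙-cancelˡ x _ _ e))
                  (λ Bb → _ , Bb , refl) B≥b)
                (AtMost-⊆ S (λ (v∈ , ¬v∉) → Any.map (v∈ ,_) (decidable-stable em ¬v∉))
                  (AtMost-⋃ S X (All.map intersection x-far)))))
            (spread B≥b X-far (<⇒≤ X≤m)))

      far⊎near : ∀ y X → All (Far y) X ⊎ Any (Near y) X
      far⊎near y []      = inj₁ []
      far⊎near y (x ∷ X) with AtMost-dichotomy S {r} em (Realises B (y - x)) t | far⊎near y X
      ... | inj₁ near | _         = inj₂ (here near)
      ... | inj₂ _    | inj₂ near = inj₂ (there near)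
      ... | inj₂ far  | inj₁ fars = inj₁ (far ∷ fars)

      greedy : ∀ n → (∃ λ X → All Y X × AllPairs Far X × length X ≡ n) ⊎
                     (∃ λ X → length X ≤ n × All Y X × (∀ {y} → Y y → Any (Near y) X))
      greedy zero = inj₁ ([] , [] , [] , ≡.refl)
      greedy (suc n) with greedy n
      ... | inj₂ (X , X≤n , X⊆Y , near) = inj₂ (X , m≤n⇒m≤1+n X≤n , X⊆Y , near)
      ... | inj₁ (X , X⊆Y , far , ≡.refl) with em {∃ λ y → Y y × All (Far y) X}
      ...   | yes (y , Yy , y-far) = inj₁ (y ∷ X , Yy ∷ X⊆Y , y-far ∷ far , ≡.refl)
      ...   | no  none             = inj₂ (X , n≤1+n _ , X⊆Y , near)
        where
        near : ∀ {y} → Y y → Any (Near y) X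
        near {y} Yy with far⊎near y X
        ... | inj₁ y-far = contradiction (y , Yy , y-far) none
        ... | inj₂ near  = near

    -- Ruzsa's covering argument. A subset X of Y whose differences all have few
    -- realisations has almost disjoint translates x - B inside Y - B, hence is small.
    covering : AtLeast S B b → AtMost S (Y ⊝ B) M → M < m ℕ.* (b ∸ m ℕ.* t) →
      ∃ λ X → length X ≤ m × (∀ {y} → Y y →
        Any (λ x → AtLeast S (Realises B (y - x)) (suc t)) X)
    covering B≥b Y⊝B≤M M< with greedy m
    ... | inj₂ (X , X≤m , _ , near) = X , X≤m , near
    ... | inj₁ (X , X⊆Y , far , ≡.refl) = contradiction
      (AtLeast≤AtMost S (AtLeast-⊆ S ⊆Y⊝B (spread B≥b far ≤-refl)) Y⊝B≤M) (<⇒≱ M<)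
      where
      ⊆Y⊝B : ∀ {v} → Any (λ x → Shifted x v) X → (Y ⊝ B) v
      ⊆Y⊝B v∈ with All.lookupAny X⊆Y v∈
      ... | Yx , (b , Bb , e) = _ , b , Yx , Bb , e

  Popular : Subset → ℕ → Subset
  Popular B n p = AtLeast S (Realises B p) n

  -- Each realisation p = (p + x) - x splits y + p + (d - d′) as
  -- (y + (p + x - d′)) + (d - x).
  popular-sumset : {Y B : Subset} → AtMost S (Y ⊕ (B ⊝ B)) m → AtMost S (B ⊝ B) n →
    ∀ {j} → AtLeast S ((Y ⊕ Popular B k) ⊕ (B ⊝ B)) j → j ℕ.* k ≤ m ℕ.* n
  popular-sumset {k = k} {Y} {B} YΔ≤ Δ≤ many =
    AtLeast≤AtMost (S ×ₛ S)
      (AtLeast-fibres S (S ×ₛ S) splittings enough (λ _ → proj₂)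
        (λ _ _ (e , _) (e′ , _) (e₁ , e₂) → trans (sym e) (trans (+-cong e₁ e₂) e′)) many)
      (AtMost-× S S YΔ≤ Δ≤)
    where
    splittings : Carrier → Pred (Carrier × Carrier) _
    splittings z (u , v) = u + v ≈ z × (Y ⊕ (B ⊝ B)) u × (B ⊝ B) v

    enough : ∀ {z} → ((Y ⊕ Popular B k) ⊕ (B ⊝ B)) z → AtLeast (S ×ₛ S) (splittings z) k
    enough {z} (yp , δ , (y , p , Yy , popular , yp≈) , (d , d′ , Bd , Bd′ , δ≈) , z≈) =
      AtLeast-image S (S ×ₛ S) (λ x → y + ((p + x) - d′) , d - x)
        (λ _ _ (_ , e) → ⁻¹-injective (∙-cancelˡ d _ _ e))
        (λ {x} (Bx , Bpx) →
            trans (prove (y ∷ p ∷ x ∷ d ∷ d′ ∷ [])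
                     ((v₀ :+ ((v₁ :+ v₂) :- v₄)) :+ (v₃ :- v₂)) ((v₀ :+ v₁) :+ (v₃ :- v₄)) ≡.refl)
              (sym (trans z≈ (+-cong yp≈ δ≈)))
          , (y , (p + x) - d′ , Yy , (p + x , d′ , Bpx , Bd′ , refl) , refl)
          , (d , x , Bd , Bx , refl))
        popular

  -- Translation by p carries realisations of p to realisations of - p. Hence both terms of a
  -- difference d - d′ can be replaced by popular elements.
  Popular-neg : {B : Subset} → B Resp _≈_ → ∀ {p} → Popular B k p → Popular B k (- p)
  Popular-neg B-resp {p} = AtLeast-image S S (λ b → p + b) (λ _ _ → ∙-cancelˡ p _ _)
    λ {b} (Bb , Bpb) → Bpb , B-resp (prove (p ∷ b ∷ []) v₁ (:- v₀ :+ (v₀ :+ v₁)) ≡.refl) Bb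

  AtMost-translates : {W : Pred Carrier p} {Q : Pred Carrier q} → W Resp _≈_ → (f : Carrier → Carrier) (X : List Carrier) →
    length X ≤ m → AtMost S W n → (∀ {v} → Q v → Any (λ x → W (v - f x)) X) → AtMost S Q (m ℕ.* n)
  AtMost-translates {W = W} W-resp f X X≤m W≤n Q⊆ = AtMost-≤ S (*-monoˡ-≤ _ X≤m)
    (AtMost-⊆ S Q⊆ (AtMost-⋃ S X (All.universal (λ x →
      AtMost-image S S (λ w → w + f x) +-congʳ
        (λ {v} Wv → v - f x , Wv , prove (v ∷ f x ∷ []) v₀ ((v₀ :- v₁) :+ v₁) ≡.refl) W≤n) X)))

  ⊕-resp : (P Q : Subset) → (P ⊕ Q) Resp _≈_
  ⊕-resp P Q x≈y (a , b , Pa , Qb , e) = a , b , Pa , Qb , trans (sym x≈y) e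

  -- Iterated differences of a set of small doubling

  module Doubling (B : Subset) (B-resp : B Resp _≈_) {d M κ : ℕ} (B≥d : AtLeast S B d)
    (Δ≤M : AtMost S (B ⊝ B) M) (0<d : 0 < d) (0<κ : 0 < κ) (M≤κd : M ≤ κ ℕ.* d) where

    Δ : Subset
    Δ = B ⊝ B

    private
      μ step : ℕ
      μ    = coverSize κ
      step = stepGrowth κ

      instance
        2μ≢0 : ℕ.NonZero (2 ℕ.* μ)
        2μ≢0 = ℕ.>-nonZero (*-mono-≤ (s≤s (z≤n {1})) (≤-trans (*-mono-≤ (s≤s (z≤n {3})) 0<κ)
          (≤-reflexive (≡.sym (coverSize-≡ κ)))))
        d≢0 : ℕ.NonZero d
        d≢0 = ℕ.>-nonZero 0<d

      -- The threshold balances two demands: μ t ≤ d / 2 leaves at least half of each translate new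
      -- in `covering`, and 2 μ (t + 1) > d gives a popular difference enough realisations for
      -- `popular-step`.
      t : ℕ
      t = d / (2 ℕ.* μ)

      2μt≤d : 2 ℕ.* μ ℕ.* t ≤ d
      2μt≤d = ≤-trans (≤-reflexive (ℕ.*-comm (2 ℕ.* μ) t)) (m/n*n≤m d (2 ℕ.* μ))

      d<2μ⟨1+t⟩ : d < 2 ℕ.* μ ℕ.* suc t
      d<2μ⟨1+t⟩ = begin-strict
        d                                          ≡⟨ m≡m%n+[m/n]*n d (2 ℕ.* μ) ⟩
        d % (2 ℕ.* μ) ℕ.+ t ℕ.* (2 ℕ.* μ)          <⟨ +-monoˡ-< _ (m%n<n d (2 ℕ.* μ)) ⟩
        2 ℕ.* μ ℕ.+ t ℕ.* (2 ℕ.* μ)                ≡⟨ ℕ.*-comm (suc t) (2 ℕ.* μ) ⟩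
        2 ℕ.* μ ℕ.* suc t                          ∎
        where open ≤-Reasoning

      -- With e = d ∸ μ t one has d ≤ 2 e, so M ≤ 2 κ e; the factor 4 in `coverSize`, instead of 2,
      -- makes the inequality strict.
      M<μe : M < μ ℕ.* (d ∸ μ ℕ.* t)
      M<μe = begin-strict
        M                        ≤⟨ M≤κd ⟩
        κ ℕ.* d                  ≤⟨ *-monoʳ-≤ κ d≤2e ⟩
        κ ℕ.* (2 ℕ.* e)          ≡⟨ solve 2 (λ κ e → κ :* (con 2 :* e) := con 2 :* (κ :* e)) ≡.refl κ e ⟩
        2 ℕ.* (κ ℕ.* e)          <⟨ *-monoˡ-< (κ ℕ.* e) {{ℕ.>-nonZero (*-mono-≤ 0<κ 0<e)}} {2} {4} (s≤s (s≤s (s≤s z≤n))) ⟩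
        4 ℕ.* (κ ℕ.* e)          ≡⟨ ℕ.*-assoc 4 κ e ⟨
        4 ℕ.* κ ℕ.* e            ≡⟨ ≡.cong (ℕ._* e) (coverSize-≡ κ) ⟨
        μ ℕ.* e                  ∎
        where
        open ≤-Reasoning
        open +-*-Solver renaming (_:+_ to _⊞_)
        e = d ∸ μ ℕ.* t
        μt≤d : μ ℕ.* t ≤ d
        μt≤d = ≤-trans (*-monoˡ-≤ t (m≤n*m μ 2)) 2μt≤d
        d≤2e : d ≤ 2 ℕ.* e
        d≤2e = +-cancelʳ-≤ d d (2 ℕ.* e) (begin
          d ℕ.+ d                              ≡⟨ ≡.cong₂ ℕ._+_ (≡.sym (m∸n+n≡m μt≤d)) (≡.sym (m∸n+n≡m μt≤d)) ⟩
          (e ℕ.+ μ ℕ.* t) ℕ.+ (e ℕ.+ μ ℕ.* t)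
            ≡⟨ solve 3 (λ e μ t → (e ⊞ μ :* t) ⊞ (e ⊞ μ :* t) := con 2 :* e ⊞ con 2 :* μ :* t) ≡.refl e μ t ⟩
          2 ℕ.* e ℕ.+ 2 ℕ.* μ ℕ.* t            ≤⟨ +-monoʳ-≤ (2 ℕ.* e) 2μt≤d ⟩
          2 ℕ.* e ℕ.+ d                        ∎)
        0<e : 0 < e
        0<e = *-cancelˡ-< 2 0 e (≤-trans 0<d d≤2e)

      P : Subset
      P = Popular B (suc t)

      cover : ∃ λ X → length X ≤ μ × (∀ {y} → B y → Any (λ x → P (y - x)) X)
      cover = covering B-resp B≥d Δ≤M M<μe

      X = proj₁ cover

      -- `popular-sumset` compares j (t + 1) with n M ≤ n κ d, and t + 1 exceeds d / 2μ. The summand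
      -- Δ is kept in the conclusion so that the step can be repeated.
      popular-step : ∀ {Y n} → AtMost S (Y ⊕ Δ) n → AtMost S ((Y ⊕ P) ⊕ Δ) (step ℕ.* n)
      popular-step {Y} {n} YΔ≤n = AtMost-from-bound S {r} em _ λ {j} many → *-cancelʳ-≤ j _ d (begin
        j ℕ.* d                                  ≤⟨ *-monoʳ-≤ j (<⇒≤ d<2μ⟨1+t⟩) ⟩
        j ℕ.* (2 ℕ.* μ ℕ.* suc t)
          ≡⟨ solve 3 (λ j m t → j :* (m :* t) := m :* (j :* t)) ≡.refl j (2 ℕ.* μ) (suc t) ⟩
        2 ℕ.* μ ℕ.* (j ℕ.* suc t)                ≤⟨ *-monoʳ-≤ (2 ℕ.* μ) (popular-sumset YΔ≤n Δ≤M many) ⟩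
        2 ℕ.* μ ℕ.* (n ℕ.* M)                    ≤⟨ *-monoʳ-≤ (2 ℕ.* μ) (*-monoʳ-≤ n M≤κd) ⟩
        2 ℕ.* μ ℕ.* (n ℕ.* (κ ℕ.* d))
          ≡⟨ solve 4 (λ m n κ d → m :* (n :* (κ :* d)) := m :* κ :* n :* d) ≡.refl (2 ℕ.* μ) n κ d ⟩
        2 ℕ.* μ ℕ.* κ ℕ.* n ℕ.* d                ≡⟨ ≡.cong (λ s → s ℕ.* n ℕ.* d) (stepGrowth-≡ κ) ⟨
        step ℕ.* n ℕ.* d                         ∎)
        where
        open ≤-Reasoning
        open +-*-Solver

    -- Write d = x + p and d′ = x′ + p′ with covering points x, x′ and popular p, p′. Then y + δ +
    -- (d - d′) is the translate by x - x′ of y + p - p′ + δ, so μ² translates of Y + P + P + Δ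
    -- suffice.
    difference-step : ∀ {Y n} → AtMost S (Y ⊕ Δ) n → AtMost S ((Y ⊕ Δ) ⊕ Δ) (growth κ ℕ.* n)
    difference-step {Y} {n} YΔ≤n = AtMost-≤ S (≤-reflexive regroup)
      (AtMost-translates Shifted-resp id X (proj₁ (proj₂ cover))
        (AtMost-translates (⊕-resp _ _) -_ X (proj₁ (proj₂ cover)) (popular-step (popular-step YΔ≤n)) id)
        shifted)
      where
      open +-*-Solver using (solve; _:*_; _:=_)

      regroup : μ ℕ.* (μ ℕ.* (step ℕ.* (step ℕ.* n))) ≡ growth κ ℕ.* n
      regroup = ≡.trans
        (solve 3 (λ μ s n → μ :* (μ :* (s :* (s :* n))) := μ :* (μ :* (s :* s)) :* n) ≡.refl μ step n)
        (≡.cong (ℕ._* n) (≡.sym (growth-≡ κ)))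

      Shifted : Subset
      Shifted w = Any (λ x′ → (((Y ⊕ P) ⊕ P) ⊕ Δ) (w - - x′)) X

      Shifted-resp : Shifted Resp _≈_
      Shifted-resp w≈w′ = Any.map (⊕-resp _ _ (+-congʳ w≈w′))

      shifted : ∀ {v} → ((Y ⊕ Δ) ⊕ Δ) v → Any (λ x → Shifted (v - x)) X
      shifted {v} (yδ , dd , (y , δ , Yy , Δδ , yδ≈) , (d , d′ , Bd , Bd′ , dd≈) , v≈) =
        Any.map (λ {x} Pdx → Any.map (λ {x′} Pdx′ →
            ( (y + (d - x)) + - (d′ - x′) , δ
            , (y + (d - x) , - (d′ - x′) , (y , d - x , Yy , Pdx , refl) , Popular-neg B-resp Pdx′ , refl)
            , Δδ
            , trans (+-congʳ (+-congʳ (trans v≈ (+-cong yδ≈ dd≈))))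
                (prove (y ∷ δ ∷ d ∷ d′ ∷ x ∷ x′ ∷ [])
                  ((((v₀ :+ v₁) :+ (v₂ :- v₃)) :- v₄) :- (:- v₅))
                  (((v₀ :+ (v₂ :- v₄)) :+ :- (v₃ :- v₅)) :+ v₁) ≡.refl) ))
          (near Bd′)) (near Bd)
        where near = proj₂ (proj₂ cover)

    data Iterated : ℕ → Subset where
      none : ∀ {x} → x ≈ 0# → Iterated 0 x
      _∷⟨_⟩_ : ∀ {k x y δ} → Iterated k y → x ≈ y + δ → Δ δ → Iterated (suc k) x

    Iterated-bound : ∀ k → AtMost S (Iterated (suc k)) (growth κ ℕ.^ k ℕ.* M)
    Iterated-bound zero    = AtMost-≤ S (≤-reflexive (≡.sym (ℕ.*-identityˡ M))) (AtMost-⊆ S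
      (λ { (_∷⟨_⟩_ {δ = δ} (none o≈0) x≈ (b , b′ , Bb , Bb′ , δ≈)) → b , b′ , Bb , Bb′ ,
        trans x≈ (trans (+-congʳ o≈0) (trans (identityˡ δ) δ≈)) }) Δ≤M)
    Iterated-bound (suc k) = AtMost-≤ S (≤-reflexive (≡.sym (ℕ.*-assoc (growth κ) _ M)))
      (AtMost-⊆ S (λ { (_∷⟨_⟩_ {δ = δ} (_∷⟨_⟩_ {δ = δ′} I y≈ Δδ′) x≈ Δδ) →
          _ , δ , (_ , δ′ , I , Δδ′ , y≈) , Δδ , x≈ })
        (difference-step (AtMost-⊆ S (λ (_ , _ , I , Δδ , x≈) → I ∷⟨ x≈ ⟩ Δδ) (Iterated-bound k))))

-- Constants for the group of rational elements

opaque
  -- D = A·A has |D - D| ≤ L N ≤ L² |D|; let g be its `growth`. `coverGrowth` is twice g L, since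
  -- the sets to be covered have |Z - s A| ≤ g L N. `combinationGrowth` stands for two such
  -- coverings by multiples of fivefold sums of D - D, of size g⁴ L N. `groupGrowth` is the quotient
  -- of the (g L N)² pairs from A - A by the N / (2 `combinationGrowth`) pairs that each rational
  -- element has, apart from a factor N.
  coverGrowth combinationGrowth groupGrowth : ℕ → ℕ
  coverGrowth L = 2 ℕ.* (growth (L ℕ.* L) ℕ.* L)
  combinationGrowth L = coverGrowth L ℕ.* (coverGrowth L ℕ.* (growth (L ℕ.* L) ℕ.^ 4 ℕ.* L))
  groupGrowth L = 2 ℕ.* combinationGrowth L ℕ.* (growth (L ℕ.* L) ℕ.* L ℕ.* (growth (L ℕ.* L) ℕ.* L))

  coverGrowth-≡ : ∀ L → coverGrowth L ≡ 2 ℕ.* (growth (L ℕ.* L) ℕ.* L)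
  coverGrowth-≡ L = ≡.refl

  combinationGrowth-≡ : ∀ L → combinationGrowth L ≡ coverGrowth L ℕ.* (coverGrowth L ℕ.* (growth (L ℕ.* L) ℕ.^ 4 ℕ.* L))
  combinationGrowth-≡ L = ≡.refl

  groupGrowth-≡ : ∀ L → groupGrowth L ≡ 2 ℕ.* combinationGrowth L ℕ.* (growth (L ℕ.* L) ℕ.* L ℕ.* (growth (L ℕ.* L) ℕ.* L))
  groupGrowth-≡ L = ≡.refl

-- Growth of sums of products

module NonZeroDivisors (R : RingWithoutOne c ℓ) (p : Level) (em : ExcludedMiddle (c ⊔ ℓ ⊔ p)) where
  open RingWithoutOne R hiding (zero)
  open RingProperties R
  open Subsets R

  private
    stable-≈ : ∀ {x y} → ¬ ¬ (x ≈ y) → x ≈ y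
    stable-≈ = decidable-stable (map′ lower (lift {ℓ = c ⊔ p}) em)

  *-cancelˡ : ∀ {r} → NonZeroDivisor r → ∀ {x y} → r * x ≈ r * y → x ≈ y
  *-cancelˡ {r} r-nzd {x} {y} rx≈ry = stable-≈ λ x≉y →
    proj₁ (r-nzd (x + - y) λ x-y≈0 → x≉y (x∙y⁻¹≈ε⇒x≈y x y x-y≈0))
      (trans (distribˡ r x (- y)) (trans (+-congˡ (sym (-‿distribʳ-* r y))) (x≈y⇒x∙y⁻¹≈ε rx≈ry)))

  *-cancelʳ : ∀ {r} → NonZeroDivisor r → ∀ {x y} → x * r ≈ y * r → x ≈ y
  *-cancelʳ {r} r-nzd {x} {y} xr≈yr = stable-≈ λ x≉y →
    proj₂ (r-nzd (x + - y) λ x-y≈0 → x≉y (x∙y⁻¹≈ε⇒x≈y x y x-y≈0))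
      (trans (distribʳ r x (- y)) (trans (+-congˡ (sym (-‿distribˡ-* y r))) (x≈y⇒x∙y⁻¹≈ε xr≈yr)))

  NonZeroDivisor-* : ∀ {r s} → NonZeroDivisor r → NonZeroDivisor s → NonZeroDivisor (r * s)
  NonZeroDivisor-* {r} {s} r-nzd s-nzd x x≉0 =
      (λ rsx≈0 → proj₁ (r-nzd (s * x) (proj₁ (s-nzd x x≉0))) (trans (sym (*-assoc r s x)) rsx≈0))
    , (λ xrs≈0 → proj₂ (s-nzd (x * r) (proj₂ (r-nzd x x≉0))) (trans (*-assoc x r s) xrs≈0))

  nonZeroDivisor? : Decidable NonZeroDivisor
  nonZeroDivisor? x = map′ lower (lift {ℓ = p}) em

  -- pow u n is u^(n+1), as there is no unit.
  pow : Carrier → ℕ → Carrier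
  pow u zero    = u
  pow u (suc n) = pow u n * u

  NonZeroDivisor-pow : ∀ {u} → NonZeroDivisor u → ∀ n → NonZeroDivisor (pow u n)
  NonZeroDivisor-pow u-nzd zero    = u-nzd
  NonZeroDivisor-pow u-nzd (suc n) = NonZeroDivisor-* (NonZeroDivisor-pow u-nzd n) u-nzd

module Growth (R : RingWithoutOne c ℓ) (p : Level) (em : ExcludedMiddle (c ⊔ ℓ ⊔ p))
  (A : Pred (RingWithoutOne.Carrier R) p) (L N M d z : ℕ)
  (#A : HasCardinality (RingWithoutOne.setoid R) A N)
  (#AA-AA : HasCardinality (RingWithoutOne.setoid R)
    (Subsets._⊖_ R (Subsets._·_ R A A) (Subsets._·_ R A A)) M)
  (#AA : HasCardinality (RingWithoutOne.setoid R) (Subsets._·_ R A A) d)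
  (#Z : HasCardinality (RingWithoutOne.setoid R)
    (Subsets._⊖_ R A A ∖ Subsets.NonZeroDivisor R) z)
  (0<N : 0 < N) (0<L : 0 < L) (M≤LN : M ≤ L ℕ.* N) (N≤Ld : N ≤ L ℕ.* d)
  (few-zero-divisors : 2 ℕ.* combinationGrowth L ℕ.* z < N) where

  open RingWithoutOne R hiding (zero)
  open RingProperties R
  open Subsets R
  open NonZeroDivisors R p em
  open AbelianGroupSolver +-abelianGroup
  open Sumsets +-abelianGroup p em

  private
    S = setoid
    Subset = Pred Carrier (c ⊔ ℓ ⊔ p)
    module ≈-R = SetoidReasoning setoid

    D Δ : Subset
    D = A · A
    Δ = D ⊖ D

    D-resp : D Resp _≈_
    D-resp = HasCardinality⇒Respects S #AA

    Δ-resp : Δ Resp _≈_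
    Δ-resp = HasCardinality⇒Respects S #AA-AA

    A≥N : AtLeast S A N
    A≥N = HasCardinality⇒AtLeast S #A

    0<d : 0 < d
    0<d = *-cancelˡ-< L 0 d (≤-trans (s≤s (≤-reflexive (ℕ.*-zeroʳ L))) (≤-trans 0<N N≤Ld))

    open Doubling D D-resp (HasCardinality⇒AtLeast S #AA) (HasCardinality⇒AtMost S #AA-AA)
      0<d (*-mono-≤ 0<L 0<L)
      (≤-trans M≤LN (≤-trans (*-monoʳ-≤ L N≤Ld) (≤-reflexive (≡.sym (ℕ.*-assoc L L d)))))
      using (Iterated; none; _∷⟨_⟩_; Iterated-bound)

    -- Together with `*ʳ-Δ`, this is how the bound on D - D becomes available: a product of an
    -- element of A and one of A - A, in either order, is a difference of products.
    *ˡ-Δ : ∀ {t a} → (A ⊖ A) t → A a → Δ (t * a)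
    *ˡ-Δ {t} {a} (t₁ , t₂ , At₁ , At₂ , t≈) Aa = t₁ * a , t₂ * a
      , (t₁ , a , At₁ , Aa , refl) , (t₂ , a , At₂ , Aa , refl)
      , trans (*-congʳ t≈) (trans (distribʳ a t₁ (- t₂)) (+-congˡ (sym (-‿distribˡ-* t₂ a))))

    *ʳ-Δ : ∀ {a t} → A a → (A ⊖ A) t → Δ (a * t)
    *ʳ-Δ {a} {t} Aa (t₁ , t₂ , At₁ , At₂ , t≈) = a * t₁ , a * t₂
      , (a , t₁ , Aa , At₁ , refl) , (a , t₂ , Aa , At₂ , refl)
      , trans (*-congˡ t≈) (trans (distribˡ a t₁ (- t₂)) (+-congˡ (sym (-‿distribʳ-* a t₂))))

    Δ-neg : ∀ {x} → Δ x → Δ (- x)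
    Δ-neg {x} (y , y′ , Dy , Dy′ , x≈) = y′ , y , Dy′ , Dy
      , trans (-‿cong x≈) (prove (y ∷ y′ ∷ []) (:- (v₀ :- v₁)) (v₁ :- v₀) ≡.refl)

    ⊖-neg : ∀ {x} → (A ⊖ A) x → (A ⊖ A) (- x)
    ⊖-neg {x} (y , y′ , Ay , Ay′ , x≈) = y′ , y , Ay′ , Ay
      , trans (-‿cong x≈) (prove (y ∷ y′ ∷ []) (:- (v₀ :- v₁)) (v₁ :- v₀) ≡.refl)

    a₀ : Carrier
    a₀ with A≥N
    ... | []    , _ , _ , N≤0 = contradiction (≤-trans 0<N N≤0) λ ()
    ... | x ∷ _ , _           = x

    Aa₀ : A a₀
    Aa₀ with A≥N
    ... | []    , _ , _ , N≤0        = contradiction (≤-trans 0<N N≤0) λ ()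
    ... | x ∷ _ , _ , (Ax ∷ _) , _ = Ax

    Δ-0 : Δ 0#
    Δ-0 = a₀ * a₀ , a₀ * a₀ , Daa , Daa , sym (-‿inverseʳ _)
      where Daa = a₀ , a₀ , Aa₀ , Aa₀ , refl

    ⊖-0 : (A ⊖ A) 0#
    ⊖-0 = a₀ , a₀ , Aa₀ , Aa₀ , sym (-‿inverseʳ a₀)

    I₀ : Iterated 0 0#
    I₀ = none refl

    infixl 5 _▻_
    _▻_ : ∀ {k x y} → Iterated k x → Δ y → Iterated (suc k) (x + y)
    I ▻ Δy = I ∷⟨ refl ⟩ Δy

    Iterated-resp : ∀ {k} → Iterated k Resp _≈_
    Iterated-resp x≈y (none x≈0)       = none (trans (sym x≈y) x≈0)
    Iterated-resp x≈y (I ∷⟨ x≈ ⟩ Δδ) = I ∷⟨ trans (sym x≈y) x≈ ⟩ Δδ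

    g : ℕ
    g = growth (L ℕ.* L)

    0<g : 0 < g
    0<g = growth-positive (*-mono-≤ 0<L 0<L)

    0<coverGrowth : 0 < coverGrowth L
    0<coverGrowth = ≤-trans (*-mono-≤ (s≤s (z≤n {1})) (*-mono-≤ 0<g 0<L)) (≤-reflexive (≡.sym (coverGrowth-≡ L)))

    0<combinationGrowth : 0 < combinationGrowth L
    0<combinationGrowth = ≤-trans (*-mono-≤ 0<coverGrowth (*-mono-≤ 0<coverGrowth (*-mono-≤ (m^n>0 g {{ℕ.>-nonZero 0<g}} 4) 0<L)))
      (≤-reflexive (≡.sym (combinationGrowth-≡ L)))

    Iterated-bound′ : ∀ k → AtMost S (Iterated (suc k)) (g ℕ.^ k ℕ.* L ℕ.* N)
    Iterated-bound′ k = AtMost-≤ S (≤-trans (*-monoʳ-≤ (g ℕ.^ k) M≤LN)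
      (≤-reflexive (≡.sym (ℕ.*-assoc (g ℕ.^ k) L N)))) (Iterated-bound k)

  -- Already A - a₀ has N elements, more than the z zero divisors in A - A.
  exists-nonZeroDivisor : ∃ λ u → (A ⊖ A) u × NonZeroDivisor u
  exists-nonZeroDivisor with AtLeast-filter S nonZeroDivisor?
    (AtLeast-image S S {Q = A ⊖ A} (λ a → a + - a₀) (λ _ _ → +-cancelʳ (- a₀) _ _)
      (λ Aa → _ , a₀ , Aa , Aa₀ , refl) A≥N)
    (HasCardinality⇒AtMost S #Z)
  ... | x ∷ _ , _ , (A-Ax , x-nzd) ∷ _ , _ = x , A-Ax , x-nzd
  ... | [] , _ , _ , N∸z≤0 = contradiction (≤-trans few-zero-divisors
      (≤-trans (m∸n≡0⇒m≤n (n≤0⇒n≡0 N∸z≤0)) (m≤n*m z (2 ℕ.* combinationGrowth L) {{ℕ.>-nonZero (*-mono-≤ (s≤s (z≤n {1})) 0<combinationGrowth)}}))) (<-irrefl ≡.refl)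

  private
    u = proj₁ exists-nonZeroDivisor
    A-Au = proj₁ (proj₂ exists-nonZeroDivisor)
    u-nzd = proj₂ (proj₂ exists-nonZeroDivisor)

    -- Covering by dilates of A

    _∙A : Carrier → Subset
    (s ∙A) v = ∃ λ a → A a × v ≈ s * a

    InDilate : Carrier → Carrier → Set _
    InDilate s v = ∃₂ λ a b → A a × A b × v ≈ s * a + - (s * b)

    -- `covering` at threshold 0, where one realisation in s A suffices, so that differences land in
    -- s A - s A. The set s A has N elements because s cancels, and Z - s A lies in a translate of Δ
    -- - Δ because s A ⊆ Δ.
    dilate-cover : ∀ {Z : Subset} {s} z₀ → (∀ {z} → Z z → Δ (z + - z₀)) →
      (A ⊖ A) s → NonZeroDivisor s →
      ∃ λ X → length X ≤ coverGrowth L × (∀ {y} → Z y → Any (λ x → InDilate s (y + - x)) X)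
    dilate-cover {Z} {s} z₀ Z⊆ A-As s-nzd =
      let (X , X≤ρ , near) = covering sA-resp sA≥N Z-sA≤ big in
      X , X≤ρ , λ Zy → Any.map realised (near Zy)
      where
      sA-resp : (s ∙A) Resp _≈_
      sA-resp v≈w (a , Aa , e) = a , Aa , trans (sym v≈w) e

      sA≥N : AtLeast S (s ∙A) N
      sA≥N = AtLeast-image S S (s *_) (λ _ _ → *-cancelˡ s-nzd) (λ Aa → _ , Aa , refl) A≥N

      Z-sA≤ : AtMost S (Z ⊝ (s ∙A)) (1 ℕ.* (g ℕ.^ 1 ℕ.* L ℕ.* N))
      Z-sA≤ = AtMost-translates {m = 1} {n = g ℕ.^ 1 ℕ.* L ℕ.* N} Iterated-resp id (z₀ ∷ []) (s≤s z≤n) (Iterated-bound′ 1)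
        λ { {v} (z , w , Zz , (a , Aa , w≈) , v≈) → here (Iterated-resp
          (trans (prove (z ∷ z₀ ∷ s * a ∷ []) ((:0 :+ (v₀ :- v₁)) :- v₂) ((v₀ :- v₂) :- v₁) ≡.refl)
            (+-congʳ (sym (trans v≈ (+-congˡ (-‿cong w≈))))))
          (I₀ ▻ Z⊆ Zz ▻ Δ-neg (*ˡ-Δ A-As Aa))) }

      big : 1 ℕ.* (g ℕ.^ 1 ℕ.* L ℕ.* N) < coverGrowth L ℕ.* (N ∸ coverGrowth L ℕ.* 0)
      big = begin-strict
        1 ℕ.* (g ℕ.^ 1 ℕ.* L ℕ.* N)
          ≡⟨ ≡.cong (λ g → 1 ℕ.* (g ℕ.* L ℕ.* N)) (ℕ.*-identityʳ g) ⟩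
        1 ℕ.* (g ℕ.* L ℕ.* N)
          <⟨ *-monoˡ-< (g ℕ.* L ℕ.* N) {{ℕ.>-nonZero (*-mono-≤ (*-mono-≤ 0<g 0<L) 0<N)}} {1} {2} (s≤s (s≤s z≤n)) ⟩
        2 ℕ.* (g ℕ.* L ℕ.* N)         ≡⟨ ℕ.*-assoc 2 (g ℕ.* L) N ⟨
        2 ℕ.* (g ℕ.* L) ℕ.* N         ≡⟨ ≡.cong (ℕ._* N) (coverGrowth-≡ L) ⟨
        coverGrowth L ℕ.* N                     ≡⟨ ≡.cong (λ n → coverGrowth L ℕ.* (N ∸ n)) (ℕ.*-zeroʳ (coverGrowth L)) ⟨
        coverGrowth L ℕ.* (N ∸ coverGrowth L ℕ.* 0)       ∎
        where open ≤-Reasoning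

      realised : ∀ {x} → AtLeast S (Realises (s ∙A) x) 1 → InDilate s x
      realised ([] , _ , _ , ())
      realised {x} (w ∷ _ , _ , ((b , Ab , w≈) , (a , Aa , xw≈)) ∷ _ , _) = a , b , Aa , Ab
        , trans (prove (x ∷ w ∷ []) v₀ ((v₀ :+ v₁) :- v₁) ≡.refl) (+-cong xw≈ (-‿cong w≈))

    -- With σ = `combinationGrowth L`, rounding down from N - 1 keeps 2 σ k₀ < N strict while N ≤ 2
    -- σ (k₀ + 1) still holds.
    k₀ : ℕ
    k₀ = (N ∸ 1) / (2 ℕ.* combinationGrowth L)
      where instance _ = ℕ.>-nonZero (*-mono-≤ (s≤s (z≤n {1})) 0<combinationGrowth)

    2σk₀<N : 2 ℕ.* combinationGrowth L ℕ.* k₀ < N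
    2σk₀<N = ≤-trans (s≤s (≤-trans (≤-reflexive (ℕ.*-comm (2 ℕ.* combinationGrowth L) k₀)) (m/n*n≤m (N ∸ 1) (2 ℕ.* combinationGrowth L))))
      (≤-reflexive (ℕ.m+[n∸m]≡n 0<N))
      where instance _ = ℕ.>-nonZero (*-mono-≤ (s≤s (z≤n {1})) 0<combinationGrowth)

    N≤2σ⟨1+k₀⟩ : N ≤ 2 ℕ.* combinationGrowth L ℕ.* suc k₀
    N≤2σ⟨1+k₀⟩ = begin
      N                                                          ≡⟨ ℕ.m+[n∸m]≡n 0<N ⟨
      suc (N ∸ 1)                                                ≡⟨ ≡.cong suc (m≡m%n+[m/n]*n (N ∸ 1) (2 ℕ.* combinationGrowth L)) ⟩
      suc ((N ∸ 1) % (2 ℕ.* combinationGrowth L)) ℕ.+ k₀ ℕ.* (2 ℕ.* combinationGrowth L)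
        ≤⟨ ℕ.+-monoˡ-≤ (k₀ ℕ.* (2 ℕ.* combinationGrowth L)) (m%n<n (N ∸ 1) (2 ℕ.* combinationGrowth L)) ⟩
      2 ℕ.* combinationGrowth L ℕ.+ k₀ ℕ.* (2 ℕ.* combinationGrowth L)                           ≡⟨ ℕ.*-comm (suc k₀) (2 ℕ.* combinationGrowth L) ⟩
      2 ℕ.* combinationGrowth L ℕ.* suc k₀                                       ∎
      where
      open ≤-Reasoning
      instance _ = ℕ.>-nonZero (*-mono-≤ (s≤s (z≤n {1})) 0<combinationGrowth)

    -- Both 2 σ k₀ and 2 σ z are below N, hence σ (k₀ + z) < N. So N² pairs mapped to σ N values
    -- have a fibre of more than k₀ + z pairs, enough to discard z of them.
    collisions : combinationGrowth L ℕ.* N ℕ.* (k₀ ℕ.+ z) < N ℕ.* N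
    collisions = begin-strict
      combinationGrowth L ℕ.* N ℕ.* (k₀ ℕ.+ z)
        ≡⟨ solve 4 (λ s n k z → s :* n :* (k ⊞ z) := s :* (k ⊞ z) :* n) ≡.refl (combinationGrowth L) N k₀ z ⟩
      combinationGrowth L ℕ.* (k₀ ℕ.+ z) ℕ.* N     <⟨ *-monoˡ-< N {{ℕ.>-nonZero 0<N}} (*-cancelˡ-< 2 (combinationGrowth L ℕ.* (k₀ ℕ.+ z)) N (begin-strict
        2 ℕ.* (combinationGrowth L ℕ.* (k₀ ℕ.+ z))
          ≡⟨ solve 3 (λ s k z → con 2 :* (s :* (k ⊞ z)) := con 2 :* s :* k ⊞ con 2 :* s :* z) ≡.refl (combinationGrowth L) k₀ z ⟩
        2 ℕ.* combinationGrowth L ℕ.* k₀ ℕ.+ 2 ℕ.* combinationGrowth L ℕ.* z    <⟨ ℕ.+-mono-< 2σk₀<N few-zero-divisors ⟩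
        N ℕ.+ N                                 ≡⟨ ≡.cong (N ℕ.+_) (ℕ.+-identityʳ N) ⟨
        2 ℕ.* N                                 ∎)) ⟩
      N ℕ.* N                      ∎
      where
      open ≤-Reasoning
      open +-*-Solver renaming (_:+_ to _⊞_)

    -- Rational elements and the gap in their number of representations

    Quotient : Carrier → Carrier → Pred (Carrier × Carrier) (c ⊔ ℓ ⊔ p)
    Quotient w x (s , t) = ((A ⊖ A) s × NonZeroDivisor s × (A ⊖ A) t) × x * s ≈ w * t

    -- The elements w t s⁻¹ with s, t ∈ A - A, and those of them with many such representations.
    Rational Rich : Carrier → Carrier → Set (c ⊔ ℓ ⊔ p)
    Rational w x = ∃ (Quotient w x)
    Rich w x = AtLeast (S ×ₛ S) (Quotient w x) (suc k₀)

    Combination : Carrier → Carrier → Subset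
    Combination w x v = ∃₂ λ a b → A a × A b × v ≈ x * a + w * b

    -- If x A + w A is small then x a + w b = x a′ + w b′ has many solutions,
    -- few of which have a zero divisor a - a′.
    collide : ∀ {w x} → NonZeroDivisor w → AtMost S (Combination w x) (combinationGrowth L ℕ.* N) → Rich w x
    collide {w} {x} w-nzd small = from-fibre (large-fibre (S ×ₛ S) S {r = p} em
        (λ (a , b) → x * a + w * b) (λ { (lift (Aa , Ab)) → _ , _ , Aa , Ab , refl })
        (AtLeast-⊆ (S ×ₛ S) lift (AtLeast-× S S A≥N A≥N))
        small collisions)
      where
      Fibre : Carrier → Pred (Carrier × Carrier) _
      Fibre v (a , b) = Lift (c ⊔ ℓ) (A a × A b) × x * a + w * b ≈ v

      rearrange : ∀ {a a′ b b′} → x * a + w * b ≈ x * a′ + w * b′ → x * (a + - a′) ≈ w * (b′ + - b)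
      rearrange {a} {a′} {b} {b′} e = begin
        x * (a + - a′)                              ≈⟨ trans (distribˡ x a (- a′)) (+-congˡ (sym (-‿distribʳ-* x a′))) ⟩
        x * a + - (x * a′)
          ≈⟨ prove (x * a ∷ w * b ∷ x * a′ ∷ []) (v₀ :- v₂) (((v₀ :+ v₁) :- v₁) :- v₂) ≡.refl ⟩
        (x * a + w * b) + - (w * b) + - (x * a′)    ≈⟨ +-congʳ (+-congʳ e) ⟩
        (x * a′ + w * b′) + - (w * b) + - (x * a′)
          ≈⟨ prove (x * a′ ∷ w * b′ ∷ w * b ∷ []) (((v₀ :+ v₁) :- v₂) :- v₀) (v₁ :- v₂) ≡.refl ⟩
        w * b′ + - (w * b)                          ≈⟨ trans (distribˡ w b′ (- b)) (+-congˡ (sym (-‿distribʳ-* w b))) ⟨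
        w * (b′ + - b)                              ∎
        where open ≈-R

      from-fibre : (∃ λ v → AtLeast (S ×ₛ S) (Fibre v) (suc (k₀ ℕ.+ z))) → Rich w x
      from-fibre (v , ([] , _ , _ , ()))
      -- The first pair of the fibre is the base point. Within the fibre a determines b, since w
      -- cancels, so at most z pairs have a zero divisor a - a₁.
      from-fibre (v , many@((a₁ , b₁) ∷ _ , _ , (lift (Aa₁ , Ab₁) , e₁) ∷ _ , _)) =
        AtLeast-≤ (S ×ₛ S) (≤-reflexive (≡.sym (m+n∸n≡m (suc k₀) z)))
          (AtLeast-image (S ×ₛ S) (S ×ₛ S) (λ (a , b) → a + - a₁ , b₁ + - b)
            (λ _ _ (e , e′) → +-cancelʳ (- a₁) _ _ e , -‿injective (+-cancelˡ b₁ _ _ e′))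
            (λ { ((lift (Aa , Ab) , e) , nzd) →
                ((_ , _ , Aa , Aa₁ , refl) , nzd , (_ , _ , Ab₁ , Ab , refl))
              , rearrange (trans e (sym e₁)) })
            (AtLeast-filter (S ×ₛ S) (λ (a , _) → nonZeroDivisor? (a + - a₁)) many
              (AtMost-injection (S ×ₛ S) S {r = p} em (λ (a , _) → a + - a₁)
                (λ {ab} {ab′} → injective {ab} {ab′})
                (λ { ((lift (Aa , _) , _) , ¬nzd) → (_ , _ , Aa , Aa₁ , refl) , ¬nzd })
                (HasCardinality⇒AtMost S #Z))))
        where
        injective : ∀ {ab ab′} {P : Set (c ⊔ ℓ)} {P′ : Set (c ⊔ ℓ)} → Fibre v ab × P → Fibre v ab′ × P′ →
          proj₁ ab + - a₁ ≈ proj₁ ab′ + - a₁ → proj₁ ab ≈ proj₁ ab′ × proj₂ ab ≈ proj₂ ab′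
        injective {a , b} {a′ , b′} ((_ , e) , _) ((_ , e′) , _) a-a₁≈ =
          let a≈a′ = +-cancelʳ (- a₁) a a′ a-a₁≈ in
          a≈a′ , *-cancelˡ w-nzd (+-cancelˡ (x * a) _ _
            (trans e (trans (sym e′) (+-congʳ (*-congˡ (sym a≈a′))))))

    -- Five summands are what `Rich-+` produces: a difference of two elements of Δ from each of two
    -- coverings, and one more from w A.
    Multiple : Carrier → Subset
    Multiple w v = ∃ λ e → Iterated 5 e × v ≈ w * e

    Multiple-resp : ∀ {w} → Multiple w Resp _≈_
    Multiple-resp v≈v′ (e , I , v≈) = e , I , trans (sym v≈v′) v≈

    Multiple≤ : ∀ w → AtMost S (Multiple w) (g ℕ.^ 4 ℕ.* L ℕ.* N)
    Multiple≤ w = AtMost-image S S (w *_) *-congˡ id (Iterated-bound′ 4)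

    two-translates : coverGrowth L ℕ.* (coverGrowth L ℕ.* (g ℕ.^ 4 ℕ.* L ℕ.* N)) ≤ combinationGrowth L ℕ.* N
    two-translates = ≤-reflexive (≡.trans
      (solve 3 (λ r g n → r :* (r :* (g :* n)) := r :* (r :* g) :* n) ≡.refl (coverGrowth L) (g ℕ.^ 4 ℕ.* L) N)
      (≡.cong (ℕ._* N) (≡.sym (combinationGrowth-≡ L))))
      where open +-*-Solver

    one-translate : coverGrowth L ℕ.* (g ℕ.^ 4 ℕ.* L ℕ.* N) ≤ combinationGrowth L ℕ.* N
    one-translate = ≤-trans (m≤n*m _ (coverGrowth L) {{ℕ.>-nonZero 0<coverGrowth}}) two-translates

    *-sub : ∀ x y z → x * (y + - z) ≈ x * y + - (x * z)
    *-sub x y z = trans (distribˡ x y (- z)) (+-congˡ (sym (-‿distribʳ-* x z)))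

    -- Since x s a = w t a, multiplication by x carries s A - s A into w (t A - t A). A covering of
    -- Z by dilates of s thus becomes a covering of x Z by translates of parts of w (Δ - Δ).
    transfer : ∀ {w x s t v a b} → x * s ≈ w * t → v ≈ s * a + - (s * b) → x * v ≈ w * (t * a + - (t * b))
    transfer {w} {x} {s} {t} {v} {a} {b} xs≈wt v≈ = begin
      x * v                                  ≈⟨ *-congˡ v≈ ⟩
      x * (s * a + - (s * b))                ≈⟨ *-sub x (s * a) (s * b) ⟩
      x * (s * a) + - (x * (s * b))          ≈⟨ +-cong (swap a) (-‿cong (swap b)) ⟩
      w * (t * a) + - (w * (t * b))          ≈⟨ *-sub w (t * a) (t * b) ⟨
      w * (t * a + - (t * b))                ∎
      where
      open ≈-R
      swap : ∀ a → x * (s * a) ≈ w * (t * a)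
      swap a = trans (sym (*-assoc x s a)) (trans (*-congʳ xs≈wt) (*-assoc w t a))

    aA-Δ : ∀ {a v} → A a → (∃ λ b → A b × v ≈ a * b) → Δ (v + - (a * a₀))
    aA-Δ {a} Aa (b , Ab , v≈) = Δ-resp (trans (*-sub a b a₀) (+-congʳ (sym v≈)))
      (*ʳ-Δ Aa (b , a₀ , Ab , Aa₀ , refl))

    rational-cover : ∀ {Z : Subset} {w x} z₀ → (∀ {v} → Z v → Δ (v + - z₀)) → Rational w x →
      ∃ λ X → length X ≤ coverGrowth L × (∀ {v} → Z v →
        Any (λ x₁ → ∃₂ λ e e′ → Δ e × Δ e′ × x * (v + - x₁) ≈ w * (e + - e′)) X)
    rational-cover z₀ Z⊆ ((s , t) , (A-As , s-nzd , A-At) , xs≈wt) =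
      let (X , X≤ , near) = dilate-cover z₀ Z⊆ A-As s-nzd in
      X , X≤ , λ Zv → Any.map
        (λ (a , b , Aa , Ab , e) → t * a , t * b , *ˡ-Δ A-At Aa , *ˡ-Δ A-At Ab , transfer xs≈wt e)
        (near Zv)

    -- The factor u, a difference from A - A, brings A into Δ, where `dilate-cover` applies.
    cover-Au : ∀ {w x} → Rational w x → ∃ λ X → length X ≤ coverGrowth L × (∀ {a} → A a →
      Any (λ x₁ → ∃₂ λ e e′ → Δ e × Δ e′ × x * (a * u + - x₁) ≈ w * (e + - e′)) X)
    cover-Au Qx =
      let (X , X≤ , near) = rational-cover {Z = λ v → ∃ λ a → A a × v ≈ a * u} 0#
            (λ { {v} (a , Aa , v≈) → Δ-resp
              (trans (sym v≈) (prove (v ∷ []) v₀ (v₀ :- :0) ≡.refl)) (*ʳ-Δ Aa A-Au) }) Qx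
      in X , X≤ , λ Aa → near (_ , Aa , refl)

    cover-aA : ∀ {w x a} → Rational w x → A a → ∃ λ X → length X ≤ coverGrowth L × (∀ {b} → A b →
      Any (λ x₁ → ∃₂ λ e e′ → Δ e × Δ e′ × x * (a * b + - x₁) ≈ w * (e + - e′)) X)
    cover-aA {a = a} Qx Aa =
      let (X , X≤ , near) = rational-cover {Z = λ v → ∃ λ b → A b × v ≈ a * b} (a * a₀) (aA-Δ Aa) Qx
      in X , X≤ , λ Ab → near (_ , Ab , refl)

    -- Right multiplication by u is injective and turns (x + y) a + w b into x (a u) + y (a u) + w
    -- (b u). Coverings of x A u and y A u leave w times a sum of five elements of Δ. Only one
    -- representation of x and of y is consumed, so repeated addition loses nothing.
    Rich-+ : ∀ {w x y} → NonZeroDivisor w → Rational w x → Rational w y → Rich w (x + y)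
    Rich-+ {w} {x} {y} w-nzd Qx Qy = collide w-nzd (AtMost-≤ S two-translates
      (AtMost-injection S S {r = p} em (_* u) (λ _ _ → *-cancelʳ u-nzd) (λ Cv → _ , Cv , refl)
        (AtMost-translates {W = Shifted} Shifted-resp (x *_) X₁ X₁≤ρ
          (AtMost-translates {W = Multiple w} Multiple-resp (y *_) X₂ X₂≤ρ (Multiple≤ w) id)
          shifted)))
      where
      X₁ = proj₁ (cover-Au Qx)
      X₂ = proj₁ (cover-Au Qy)
      X₁≤ρ = proj₁ (proj₂ (cover-Au Qx))
      X₂≤ρ = proj₁ (proj₂ (cover-Au Qy))

      Shifted : Subset
      Shifted v = Any (λ x₂ → Multiple w (v + - (y * x₂))) X₂

      Shifted-resp : Shifted Resp _≈_
      Shifted-resp v≈v′ = Any.map (Multiple-resp (+-congʳ v≈v′))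

      shifted : ∀ {v} → (∃ λ v′ → Combination w (x + y) v′ × v ≈ v′ * u) →
                Any (λ x₁ → Shifted (v + - (x * x₁))) X₁
      shifted {v} (v′ , (a , b , Aa , Ab , v′≈) , v≈) =
        Any.map (λ {x₁} (e₁ , e₁′ , Δe₁ , Δe₁′ , eq₁) →
          Any.map (λ {x₂} (e₂ , e₂′ , Δe₂ , Δe₂′ , eq₂) →
              _ , (I₀ ▻ Δe₁ ▻ Δ-neg Δe₁′ ▻ Δe₂ ▻ Δ-neg Δe₂′ ▻ *ʳ-Δ Ab A-Au)
            , (begin
                v + - (x * x₁) + - (y * x₂)
                  ≈⟨ +-congʳ (+-congʳ (trans v≈ (*-congʳ v′≈))) ⟩
                ((x + y) * a + w * b) * u + - (x * x₁) + - (y * x₂)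
                  ≈⟨ +-congʳ (+-congʳ (trans (distribʳ u ((x + y) * a) (w * b))
                       (+-cong (trans (*-assoc (x + y) a u) (distribʳ (a * u) x y)) (*-assoc w b u)))) ⟩
                (x * (a * u) + y * (a * u)) + w * (b * u) + - (x * x₁) + - (y * x₂)
                  ≈⟨ prove (x * (a * u) ∷ y * (a * u) ∷ w * (b * u) ∷ x * x₁ ∷ y * x₂ ∷ [])
                       ((((v₀ :+ v₁) :+ v₂) :- v₃) :- v₄) (((v₀ :- v₃) :+ (v₁ :- v₄)) :+ v₂) ≡.refl ⟩
                (x * (a * u) + - (x * x₁)) + (y * (a * u) + - (y * x₂)) + w * (b * u)
                  ≈⟨ +-congʳ (+-cong (trans (sym (*-sub x (a * u) x₁)) eq₁) (trans (sym (*-sub y (a * u) x₂)) eq₂)) ⟩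
                w * (e₁ + - e₁′) + w * (e₂ + - e₂′) + w * (b * u)
                  ≈⟨ trans (distribˡ w (e₁ + - e₁′ + (e₂ + - e₂′)) (b * u)) (+-congʳ (distribˡ w (e₁ + - e₁′) (e₂ + - e₂′))) ⟨
                w * ((e₁ + - e₁′ + (e₂ + - e₂′)) + b * u)
                  ≈⟨ *-congˡ (+-congʳ (prove (e₁ ∷ e₁′ ∷ e₂ ∷ e₂′ ∷ []) ((v₀ :- v₁) :+ (v₂ :- v₃))
                       ((((:0 :+ v₀) :+ :- v₁) :+ v₂) :+ :- v₃) ≡.refl)) ⟩
                w * (0# + e₁ + - e₁′ + e₂ + - e₂′ + b * u) ∎))
            (proj₂ (proj₂ (cover-Au Qy)) Aa))
          (proj₂ (proj₂ (cover-Au Qx)) Aa)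
        where open ≈-R

    pad : ∀ {e e′ f} → Δ e → Δ e′ → Δ f → Iterated 5 (e + - e′ + f)
    pad {e} {e′} {f} Δe Δe′ Δf =
      Iterated-resp (prove (e ∷ e′ ∷ f ∷ []) (((((:0 :+ v₀) :+ :- v₁) :+ v₂) :+ :0) :+ :0) ((v₀ :- v₁) :+ v₂) ≡.refl)
        (I₀ ▻ Δe ▻ Δ-neg Δe′ ▻ Δf ▻ Δ-0 ▻ Δ-0)

    -- Translates of u A - u A cover a A, and u A ⊆ Δ; hence a A + u A is small.
    Rich-base : ∀ {a} → A a → Rich u a
    Rich-base {a} Aa = collide u-nzd (AtMost-≤ S one-translate
      (AtMost-translates Iterated-resp id X X≤ρ (Iterated-bound′ 4) shifted))
      where
      cover = dilate-cover {Z = λ v → ∃ λ b → A b × v ≈ a * b} (a * a₀) (aA-Δ Aa) A-Au u-nzd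
      X = proj₁ cover
      X≤ρ = proj₁ (proj₂ cover)

      shifted : ∀ {v} → Combination u a v → Any (λ x → Iterated 5 (v + - x)) X
      shifted {v} (b , b′ , Ab , Ab′ , v≈) = Any.map
        (λ {x} (a₁ , b₁ , Aa₁ , Ab₁ , eq) → Iterated-resp
          (trans (+-congʳ (sym eq)) (trans
            (prove (a * b ∷ x ∷ u * b′ ∷ []) ((v₀ :- v₁) :+ v₂) ((v₀ :+ v₂) :- v₁) ≡.refl)
            (+-congʳ (sym v≈))))
          (pad (*ˡ-Δ A-Au Aa₁) (*ˡ-Δ A-Au Ab₁) (*ˡ-Δ A-Au Ab′)))
        (proj₂ (proj₂ cover) (b , Ab , refl))

    -- In y (a b) + w (u b′) the first term is handled by the covering of a A, and u b′ already lies
    -- in Δ. The base grows from w to w u while the bound stays the same.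
    Rich-* : ∀ {w y a} → NonZeroDivisor w → Rational w y → A a → Rich (w * u) (y * a)
    Rich-* {w} {y} {a} w-nzd Qy Aa = collide (NonZeroDivisor-* w-nzd u-nzd) (AtMost-≤ S one-translate
      (AtMost-translates {W = Multiple w} Multiple-resp (y *_) X X≤ρ (Multiple≤ w) shifted))
      where
      X = proj₁ (cover-aA Qy Aa)
      X≤ρ = proj₁ (proj₂ (cover-aA Qy Aa))

      shifted : ∀ {v} → Combination (w * u) (y * a) v → Any (λ x₁ → Multiple w (v + - (y * x₁))) X
      shifted {v} (b , b′ , Ab , Ab′ , v≈) = Any.map
        (λ {x₁} (e , e′ , Δe , Δe′ , eq) → _ , pad Δe Δe′ (*ˡ-Δ A-Au Ab′)
          , (begin
              v + - (y * x₁)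
                ≈⟨ +-congʳ (trans v≈ (+-cong (*-assoc y a b) (*-assoc w u b′))) ⟩
              y * (a * b) + w * (u * b′) + - (y * x₁)
                ≈⟨ prove (y * (a * b) ∷ w * (u * b′) ∷ y * x₁ ∷ []) ((v₀ :+ v₁) :- v₂) ((v₀ :- v₂) :+ v₁) ≡.refl ⟩
              y * (a * b) + - (y * x₁) + w * (u * b′)
                ≈⟨ +-congʳ (trans (sym (*-sub y (a * b) x₁)) eq) ⟩
              w * (e + - e′) + w * (u * b′)
                ≈⟨ distribˡ w (e + - e′) (u * b′) ⟨
              w * (e + - e′ + u * b′) ∎))
        (proj₂ (proj₂ (cover-aA Qy Aa)) Ab)
        where open ≈-R

    Rich⇒Rational : ∀ {w x} → Rich w x → Rational w x
    Rich⇒Rational (st ∷ _ , _ , Qst ∷ _ , _) = st , Qst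
    Rich⇒Rational ([] , _ , _ , ())

    Rich-resp : ∀ {w} → Rich w Resp _≈_
    Rich-resp x≈y = AtLeast-⊆ (S ×ₛ S) λ (st∈ , xs≈wt) → st∈ , trans (*-congʳ (sym x≈y)) xs≈wt

    Rational-0 : ∀ {w} → Rational w 0#
    Rational-0 {w} = (u , 0#) , (A-Au , u-nzd , ⊖-0) , trans (zeroˡ u) (sym (zeroʳ w))

    Rational-neg : ∀ {w x} → Rational w x → Rational w (- x)
    Rational-neg {w} {x} ((s , t) , (A-As , s-nzd , A-At) , xs≈wt) =
      (s , - t) , (A-As , s-nzd , ⊖-neg A-At)
      , trans (sym (-‿distribˡ-* x s)) (trans (-‿cong xs≈wt) (-‿distribʳ-* w t))

    -- The gap itself: adding the rational element 0 turns one representation into more than k₀.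
    Rational⇒Rich : ∀ {w x} → NonZeroDivisor w → Rational w x → Rich w x
    Rational⇒Rich w-nzd Qx = Rich-resp (+-identityʳ _) (Rich-+ w-nzd Qx Rational-0)

    -- Product sets are built up from the left, whereas `Rich-*` multiplies on the right.
    powers-snoc : ∀ {n x} → (A ^ suc (suc n)) x → ∃₂ λ y a → (A ^ suc n) y × A a × x ≈ y * a
    powers-snoc (times {a = a} Aa (single {b} Ab) x≈) = a , b , single Aa , Ab , x≈
    powers-snoc (times {a = a} Aa (times {n = suc n} Ab z∈ y≈) x≈)
      with powers-snoc (times Ab z∈ y≈)
    ... | y′ , b , y′∈ , Ab′ , y≈y′b = a * y′ , b , times Aa y′∈ refl , Ab′
      , trans x≈ (trans (*-congˡ y≈y′b) (sym (*-assoc a y′ b)))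

    powers-Rich : ∀ n {x} → (A ^ suc n) x → Rich (pow u n) x
    powers-Rich zero (single Aa)  = Rich-base Aa
    powers-Rich zero (times _ () _)
    powers-Rich (suc n) x∈ = let (y , a , y∈ , Aa , x≈) = powers-snoc x∈ in
      Rich-resp (sym x≈) (Rich-* (NonZeroDivisor-pow u-nzd n) (Rich⇒Rational (powers-Rich n y∈)) Aa)

    generated-Rich : ∀ n {x} → Generated (A ^ suc n) x → Rich (pow u n) x
    generated-Rich n (gen x∈)    = powers-Rich n x∈
    generated-Rich n gen0        = Rational⇒Rich (NonZeroDivisor-pow u-nzd n) Rational-0
    generated-Rich n (add x∈ y∈) = Rich-+ (NonZeroDivisor-pow u-nzd n)
      (Rich⇒Rational (generated-Rich n x∈)) (Rich⇒Rational (generated-Rich n y∈))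
    generated-Rich n (neg x∈)    = Rational⇒Rich (NonZeroDivisor-pow u-nzd n)
      (Rational-neg (Rich⇒Rational (generated-Rich n x∈)))
    generated-Rich n (resp x≈y x∈) = Rich-resp x≈y (generated-Rich n x∈)

    A-A≤ : AtMost S (A ⊖ A) (g ℕ.* L ℕ.* N)
    A-A≤ = AtMost-injection S S {r = p} em (u *_) (λ _ _ → *-cancelˡ u-nzd)
      (λ { {v} (a , b , Aa , Ab , v≈) → Iterated-resp
          (trans (prove (u * a ∷ u * b ∷ []) ((:0 :+ v₀) :+ :- v₁) (v₀ :- v₁) ≡.refl)
            (trans (sym (*-sub u a b)) (*-congˡ (sym v≈))))
          (I₀ ▻ *ˡ-Δ A-Au Aa ▻ Δ-neg (*ˡ-Δ A-Au Ab)) })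
      (AtMost-≤ S (≤-reflexive (≡.cong (λ g → g ℕ.* L ℕ.* N) (ℕ.*-identityʳ g))) (Iterated-bound′ 1))

    -- A pair (s , t) determines x in x s = w t because s cancels, so the representations of
    -- distinct x are distinct pairs of elements of A - A. The count does not depend on w, which
    -- makes it uniform in the degree.
    Rich-bound : ∀ {w j} → AtLeast S (Rich w) j → j ≤ groupGrowth L ℕ.* N
    Rich-bound {w} {j} many = *-cancelʳ-≤ j (groupGrowth L ℕ.* N) N {{ℕ.>-nonZero 0<N}} (begin
      j ℕ.* N                              ≤⟨ *-monoʳ-≤ j N≤2σ⟨1+k₀⟩ ⟩
      j ℕ.* (2 ℕ.* combinationGrowth L ℕ.* suc k₀)
        ≡⟨ solve 3 (λ j s k → j :* (s :* k) := s :* (j :* k)) ≡.refl j (2 ℕ.* combinationGrowth L) (suc k₀) ⟩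
      2 ℕ.* combinationGrowth L ℕ.* (j ℕ.* suc k₀)         ≤⟨ *-monoʳ-≤ (2 ℕ.* combinationGrowth L) pairs ⟩
      2 ℕ.* combinationGrowth L ℕ.* (g ℕ.* L ℕ.* N ℕ.* (g ℕ.* L ℕ.* N))
        ≡⟨ solve 3 (λ s g n → s :* (g :* n :* (g :* n)) := s :* (g :* g) :* n :* n) ≡.refl (2 ℕ.* combinationGrowth L) (g ℕ.* L) N ⟩
      2 ℕ.* combinationGrowth L ℕ.* (g ℕ.* L ℕ.* (g ℕ.* L)) ℕ.* N ℕ.* N
        ≡⟨ ≡.cong (λ t → t ℕ.* N ℕ.* N) (groupGrowth-≡ L) ⟨
      groupGrowth L ℕ.* N ℕ.* N                      ∎)
      where
      open ≤-Reasoning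
      open +-*-Solver

      pairs : j ℕ.* suc k₀ ≤ g ℕ.* L ℕ.* N ℕ.* (g ℕ.* L ℕ.* N)
      pairs = AtLeast≤AtMost (S ×ₛ S)
        (AtLeast-fibres S (S ×ₛ S) (Quotient w) id
          (λ { _ ((A-As , _ , A-At) , _) → A-As , A-At })
          (λ { _ _ ((_ , s-nzd , _) , xs≈wt) (_ , x′s′≈wt′) (s≈s′ , t≈t′) → *-cancelʳ s-nzd
            (trans xs≈wt (trans (*-congˡ t≈t′) (trans (sym x′s′≈wt′) (*-congˡ (sym s≈s′))))) })
          many)
        (AtMost-× S S A-A≤ A-A≤)

  generated-bound : ∀ n {j} → AtLeast S (Generated (A ^ suc n)) j → j ≤ groupGrowth L ℕ.* N
  generated-bound n = Rich-bound ∘ AtLeast-⊆ S (generated-Rich n)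

  generated-finite : ∃ λ v → Generated (A ^ 1) v × NonZeroDivisor v ×
    (∀ n {j} → AtLeast S (Generated (A ^ suc n)) j → j ≤ groupGrowth L ℕ.* N)
  generated-finite = u , generated A-Au , u-nzd , generated-bound
    where
    generated : ∀ {v} → (A ⊖ A) v → Generated (A ^ 1) v
    generated (a , b , Aa , Ab , v≈) = resp (sym v≈) (add (gen (single Aa)) (neg (gen (single Ab))))

-- The twisted polynomial model

last-true : ExcludedMiddle ℓ → (P : ℕ → Set ℓ) → P 0 → ∀ n → ¬ P (suc n) → ∃ λ k → P k × ¬ P (suc k)
last-true em P P0 zero    ¬P1 = 0 , P0 , ¬P1
last-true em P P0 (suc n) ¬P  with em {P (suc n)}
... | yes Pn = suc n , Pn , ¬P
... | no ¬Pn = last-true em P P0 n ¬Pn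

module GradedModel (R : RingWithoutOne c ℓ) (p : Level) (em : ExcludedMiddle (c ⊔ ℓ ⊔ p))
  (A : Pred (RingWithoutOne.Carrier R) p) (u : RingWithoutOne.Carrier R)
  (u∈ : Subsets.Generated R (Subsets._^_ R A 1) u) (u-nzd : Subsets.NonZeroDivisor R u)
  (bound : ℕ)
  (bounded : ∀ n {j} → AtLeast (RingWithoutOne.setoid R) (Subsets.Generated R (Subsets._^_ R A (suc n))) j →
             j ≤ bound)
  where

  open RingWithoutOne R hiding (zero)
  open RingProperties R using (+-cancelˡ; +-inverseʳ-unique)
  open Subsets R
  open NonZeroDivisors R p em
  open SetoidReasoning setoid

  private
    S = setoid

    -- Indices are one below degrees, as for `pow`; hence the extra `suc` in the index of a product.
    G : ℕ → Pred Carrier (c ⊔ ℓ ⊔ p)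
    G n = Generated (A ^ suc n)

    G-cast : ∀ {m n x} → m ≡ n → G m x → G n x
    G-cast ≡.refl Gx = Gx

    G-* : ∀ {m n x y} → G m x → G n y → G (suc (m ℕ.+ n)) (x * y)
    G-* {m} {n} {x} {y} Gx Gy = G-cast (ℕ.+-suc m n) (proj₂ (graded-* A (suc m) (suc n) (x , Gx) (y , Gy)))

    u^ : ℕ → Carrier
    u^ = pow u

    u^-nzd : ∀ n → NonZeroDivisor (u^ n)
    u^-nzd = NonZeroDivisor-pow u-nzd

    G-u^ : ∀ n → G n (u^ n)
    G-u^ zero    = u∈
    G-u^ (suc n) = G-cast (≡.cong suc (ℕ.+-identityʳ n)) (G-* (G-u^ n) u∈)

    u^-comm : ∀ n → u^ n * u ≈ u * u^ n
    u^-comm zero    = refl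
    u^-comm (suc n) = trans (*-congʳ (u^-comm n)) (*-assoc u (u^ n) u)

    u^-* : ∀ m n → u^ m * u^ n ≈ u^ (suc (m ℕ.+ n))
    u^-* m zero    = reflexive (≡.cong (λ k → u^ k * u) (≡.sym (ℕ.+-identityʳ m)))
    u^-* m (suc n) = trans (sym (*-assoc (u^ m) (u^ n) u)) (trans (*-congʳ (u^-* m n))
      (reflexive (≡.cong (λ k → u^ k * u) (≡.sym (ℕ.+-suc m n)))))

    u^-comm′ : ∀ m n → u^ m * u^ n ≈ u^ n * u^ m
    u^-comm′ m n = trans (u^-* m n) (trans (reflexive (≡.cong (u^ ∘ suc) (ℕ.+-comm m n))) (sym (u^-* n m)))

    largest : ∃ λ k → (∃ λ m → AtLeast S (G m) k) × ¬ (∃ λ m → AtLeast S (G m) (suc k))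
    largest = last-true em (λ k → ∃ λ m → AtLeast S (G m) k) (0 , [] , [] , [] , z≤n) bound
      λ (m , many) → 1+n≰n (bounded m many)

    m₀ : ℕ
    m₀ = proj₁ (proj₁ (proj₂ largest))

    list : List Carrier
    list = proj₁ (proj₂ (proj₁ (proj₂ largest)))

  size : ℕ
  size = length list

  private
    list! : UniqueSetoid.Unique S list
    list! = proj₁ (proj₂ (proj₂ (proj₁ (proj₂ largest))))

    list⊆G : All (G m₀) list
    list⊆G = proj₁ (proj₂ (proj₂ (proj₂ (proj₁ (proj₂ largest)))))

  size-maximal : ∀ n {j} → AtLeast S (G n) j → j ≤ size
  size-maximal n {j} many with j ℕ.≤? size
  ... | yes j≤size = j≤size
  ... | no  j≰size = contradiction
    (n , AtLeast-≤ S (≤-trans (s≤s (proj₂ (proj₂ (proj₂ (proj₂ (proj₁ (proj₂ largest))))))) (ℕ.≰⇒> j≰size)) many)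
    (proj₂ (proj₂ largest))

  size-bounded : size ≤ bound
  size-bounded = bounded m₀ (list , list! , list⊆G , ≤-refl)

  private
    e : Fin size → Carrier
    e = lookup list

    e-injective : ∀ {i j} → e i ≈ e j → i ≡ j
    e-injective = lookup-injective S list!

    e∈ : ∀ i → G m₀ (e i)
    e∈ i = All.lookup list⊆G (∈-lookup i)

    -- Onto because ⟨ A ^ (m₀ + 1) ⟩ has the largest size among all the ⟨ A ^ n ⟩.
    saturated : ∀ n (f : Carrier → Carrier) → (∀ {x y} → f x ≈ f y → x ≈ y) →
                (∀ {x} → G m₀ x → G n (f x)) → ∀ {y} → G n y → ∃ λ i → f (e i) ≈ y
    saturated n f f-injective fG⊆G {y} Gy
      with em {Lift (c ⊔ p) (Any (λ x → f x ≈ y) list)}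
    ... | yes (lift found) = Any.index found , Any.lookup-index found
    ... | no  none = contradiction
      (size-maximal n
        ( y ∷ map f list
        , All.map⁺ (All.map (λ fx≉y y≈fx → fx≉y (sym y≈fx)) (All.¬Any⇒All¬ list (none ∘ lift)))
          ∷ Unique.map⁺ S S f-injective list!
        , Gy ∷ All.map⁺ (All.map fG⊆G list⊆G) , s≤s (≤-reflexive (≡.sym (length-map f list)))))
      1+n≰n

    index : ∀ {x} → G m₀ x → ∃ λ i → e i ≈ x
    index = saturated m₀ id id id

    divideʳ : ∀ {x} n → G (suc (m₀ ℕ.+ n)) x → ∃ λ i → e i * u^ n ≈ x
    divideʳ n = saturated (suc (m₀ ℕ.+ n)) (_* u^ n) (*-cancelʳ (u^-nzd n)) (λ Gx → G-* Gx (G-u^ n))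

    divideˡ : ∀ {x} n → G (suc (m₀ ℕ.+ n)) x → ∃ λ i → u^ n * e i ≈ x
    divideˡ n = saturated (suc (m₀ ℕ.+ n)) (u^ n *_) (*-cancelˡ (u^-nzd n))
      (λ Gx → G-cast (≡.cong suc (ℕ.+-comm n m₀)) (G-* (G-u^ n) Gx))

    b : Carrier
    b = u^ m₀

    b-cancelˡ : ∀ {x y} → b * x ≈ b * y → x ≈ y
    b-cancelˡ = *-cancelˡ (u^-nzd m₀)

    b-cancelʳ : ∀ {x y} → x * b ≈ y * b → x ≈ y
    b-cancelʳ = *-cancelʳ (u^-nzd m₀)

    -- The ring of fractions of degree 0

    infixl 6 _+₀_
    infixl 7 _*₀_

    _+₀_ _*₀_ : Fin size → Fin size → Fin size
    -₀_ σ φ : Fin size → Fin size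
    0₀ : Fin size

    i +₀ j = proj₁ (index (add (e∈ i) (e∈ j)))
    -₀ i   = proj₁ (index (neg (e∈ i)))
    0₀     = proj₁ (index gen0)

    -- The index i stands for the formal fraction e i · b⁻¹, of degree 0. The map σ is
    -- conjugation by b⁻¹ and φ is conjugation by u.
    σ i    = proj₁ (divideˡ m₀ (G-* (e∈ i) (G-u^ m₀)))
    i *₀ j = proj₁ (divideʳ m₀ (G-* (e∈ i) (e∈ (σ j))))
    φ i    = proj₁ (divideʳ 0 (G-cast (≡.cong suc (ℕ.+-comm 0 m₀)) (G-* u∈ (e∈ i))))

    e-+ : ∀ i j → e (i +₀ j) ≈ e i + e j
    e-+ i j = proj₂ (index (add (e∈ i) (e∈ j)))

    e-neg : ∀ i → e (-₀ i) ≈ - e i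
    e-neg i = proj₂ (index (neg (e∈ i)))

    e-0 : e 0₀ ≈ 0#
    e-0 = proj₂ (index gen0)

    e-σ : ∀ i → b * e (σ i) ≈ e i * b
    e-σ i = proj₂ (divideˡ m₀ (G-* (e∈ i) (G-u^ m₀)))

    -- Formally, e i b⁻¹ · e j b⁻¹ = e i (b⁻¹ e j b) b⁻² = e i e (σ j) b⁻². One division by b brings
    -- this back to a numerator of degree m₀ + 1.
    e-* : ∀ i j → e (i *₀ j) * b ≈ e i * e (σ j)
    e-* i j = proj₂ (divideʳ m₀ (G-* (e∈ i) (e∈ (σ j))))

    e-φ : ∀ i → e (φ i) * u ≈ u * e i
    e-φ i = proj₂ (divideʳ 0 (G-cast (≡.cong suc (ℕ.+-comm 0 m₀)) (G-* u∈ (e∈ i))))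

    σ-+ : ∀ i j → e (σ (i +₀ j)) ≈ e (σ i) + e (σ j)
    σ-+ i j = b-cancelˡ (begin
      b * e (σ (i +₀ j))               ≈⟨ e-σ (i +₀ j) ⟩
      e (i +₀ j) * b                   ≈⟨ *-congʳ (e-+ i j) ⟩
      (e i + e j) * b                  ≈⟨ distribʳ b (e i) (e j) ⟩
      e i * b + e j * b                ≈⟨ +-cong (e-σ i) (e-σ j) ⟨
      b * e (σ i) + b * e (σ j)        ≈⟨ distribˡ b _ _ ⟨
      b * (e (σ i) + e (σ j))          ∎)

    *-b-shift : ∀ x k → x * b * e (σ k) ≈ x * e k * b
    *-b-shift x k = trans (*-assoc x b _) (trans (*-congˡ (e-σ k)) (sym (*-assoc x _ b)))

    σ-* : ∀ j k → e (σ (j *₀ k)) * b ≈ e (σ j) * e (σ (σ k))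
    σ-* j k = b-cancelˡ (begin
      b * (e (σ (j *₀ k)) * b)           ≈⟨ *-assoc b _ b ⟨
      b * e (σ (j *₀ k)) * b             ≈⟨ *-congʳ (e-σ (j *₀ k)) ⟩
      e (j *₀ k) * b * b                 ≈⟨ *-congʳ (e-* j k) ⟩
      e j * e (σ k) * b                  ≈⟨ *-b-shift (e j) (σ k) ⟨
      e j * b * e (σ (σ k))              ≈⟨ *-congʳ (e-σ j) ⟨
      b * e (σ j) * e (σ (σ k))          ≈⟨ *-assoc b _ _ ⟩
      b * (e (σ j) * e (σ (σ k)))        ∎)

    -- Each multiplication in R₀ hides one division by b, so the identity is checked in R after
    -- multiplying by b twice.
    *₀-assoc : ∀ i j k → (i *₀ j) *₀ k ≡ i *₀ (j *₀ k)
    *₀-assoc i j k = e-injective (b-cancelʳ (b-cancelʳ (begin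
      e ((i *₀ j) *₀ k) * b * b          ≈⟨ *-congʳ (e-* (i *₀ j) k) ⟩
      e (i *₀ j) * e (σ k) * b           ≈⟨ *-b-shift (e (i *₀ j)) (σ k) ⟨
      e (i *₀ j) * b * e (σ (σ k))       ≈⟨ *-congʳ (e-* i j) ⟩
      e i * e (σ j) * e (σ (σ k))        ≈⟨ *-assoc (e i) _ _ ⟩
      e i * (e (σ j) * e (σ (σ k)))      ≈⟨ *-congˡ (σ-* j k) ⟨
      e i * (e (σ (j *₀ k)) * b)         ≈⟨ *-assoc (e i) _ b ⟨
      e i * e (σ (j *₀ k)) * b           ≈⟨ *-congʳ (e-* i (j *₀ k)) ⟨
      e (i *₀ (j *₀ k)) * b * b          ∎)))

    *₀-distribˡ : ∀ i j k → i *₀ (j +₀ k) ≡ (i *₀ j) +₀ (i *₀ k)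
    *₀-distribˡ i j k = e-injective (b-cancelʳ (begin
      e (i *₀ (j +₀ k)) * b                        ≈⟨ e-* i (j +₀ k) ⟩
      e i * e (σ (j +₀ k))                         ≈⟨ *-congˡ (σ-+ j k) ⟩
      e i * (e (σ j) + e (σ k))                    ≈⟨ distribˡ (e i) _ _ ⟩
      e i * e (σ j) + e i * e (σ k)                ≈⟨ +-cong (e-* i j) (e-* i k) ⟨
      e (i *₀ j) * b + e (i *₀ k) * b              ≈⟨ distribʳ b _ _ ⟨
      (e (i *₀ j) + e (i *₀ k)) * b                ≈⟨ *-congʳ (e-+ _ _) ⟨
      e ((i *₀ j) +₀ (i *₀ k)) * b                 ∎))

    *₀-distribʳ : ∀ i j k → (j +₀ k) *₀ i ≡ (j *₀ i) +₀ (k *₀ i)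
    *₀-distribʳ i j k = e-injective (b-cancelʳ (begin
      e ((j +₀ k) *₀ i) * b                        ≈⟨ e-* (j +₀ k) i ⟩
      e (j +₀ k) * e (σ i)                         ≈⟨ *-congʳ (e-+ j k) ⟩
      (e j + e k) * e (σ i)                        ≈⟨ distribʳ (e (σ i)) _ _ ⟩
      e j * e (σ i) + e k * e (σ i)                ≈⟨ +-cong (e-* j i) (e-* k i) ⟨
      e (j *₀ i) * b + e (k *₀ i) * b              ≈⟨ distribʳ b _ _ ⟨
      (e (j *₀ i) + e (k *₀ i)) * b                ≈⟨ *-congʳ (e-+ _ _) ⟨
      e ((j *₀ i) +₀ (k *₀ i)) * b                 ∎))

  -- Indices serve as elements, so equality is propositional, finiteness is immediate and R₀ has
  -- level 0 whatever the levels of R. Each law is an identity in R pulled back along the injective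
  -- map `e`.
  R₀ : RingWithoutOne 0ℓ 0ℓ
  R₀ = record
    { Carrier = Fin size
    ; _≈_     = _≡_
    ; _+_     = _+₀_
    ; _*_     = _*₀_
    ; -_      = -₀_
    ; 0#      = 0₀
    ; isRingWithoutOne = record
      { +-isAbelianGroup = record
        { isGroup = record
          { isMonoid = record
            { isSemigroup = record
              { isMagma = record
                { isEquivalence = ≡.isEquivalence
                ; ∙-cong        = ≡.cong₂ _+₀_
                }
              ; assoc = λ i j k → e-injective
                  (trans (e-+ (i +₀ j) k) (trans (+-congʳ (e-+ i j)) (trans (+-assoc (e i) (e j) (e k))
                    (sym (trans (e-+ i (j +₀ k)) (+-congˡ (e-+ j k)))))))
              }
            ; identity = (λ i → e-injective (trans (e-+ 0₀ i) (trans (+-congʳ e-0) (+-identityˡ (e i)))))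
                       , (λ i → e-injective (trans (e-+ i 0₀) (trans (+-congˡ e-0) (+-identityʳ (e i)))))
            }
          ; inverse = (λ i → e-injective (trans (e-+ (-₀ i) i) (trans (+-congʳ (e-neg i))
                               (trans (-‿inverseˡ (e i)) (sym e-0)))))
                    , (λ i → e-injective (trans (e-+ i (-₀ i)) (trans (+-congˡ (e-neg i))
                               (trans (-‿inverseʳ (e i)) (sym e-0)))))
          ; ⁻¹-cong = ≡.cong -₀_
          }
        ; comm = λ i j → e-injective (trans (e-+ i j) (trans (+-comm (e i) (e j)) (sym (e-+ j i))))
        }
      ; *-cong  = ≡.cong₂ _*₀_
      ; *-assoc = *₀-assoc
      ; distrib = *₀-distribˡ , *₀-distribʳ
      }
    }

  #R₀ : HasCardinality (RingWithoutOne.setoid R₀) U size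
  #R₀ = record
    { elements = allFin size
    ; unique   = UniqueP.allFin⁺ size
    ; complete = λ i → mk⇔ (λ _ → ∈-allFin i) _
    ; size     = length-tabulate {n = size} id
    }

  -- Conjugation by u as an automorphism

  private
    u-cancelʳ : ∀ {x y} → x * u ≈ y * u → x ≈ y
    u-cancelʳ = *-cancelʳ u-nzd

    φ-+ : ∀ i j → φ (i +₀ j) ≡ φ i +₀ φ j
    φ-+ i j = e-injective (u-cancelʳ (begin
      e (φ (i +₀ j)) * u               ≈⟨ e-φ (i +₀ j) ⟩
      u * e (i +₀ j)                   ≈⟨ *-congˡ (e-+ i j) ⟩
      u * (e i + e j)                  ≈⟨ distribˡ u (e i) (e j) ⟩
      u * e i + u * e j                ≈⟨ +-cong (e-φ i) (e-φ j) ⟨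
      e (φ i) * u + e (φ j) * u        ≈⟨ distribʳ u _ _ ⟨
      (e (φ i) + e (φ j)) * u          ≈⟨ *-congʳ (e-+ _ _) ⟨
      e (φ i +₀ φ j) * u               ∎))

    -- Conjugations by powers of u commute: σ (φ i) satisfies the equation that defines φ (σ i).
    σφ : ∀ i → e (σ (φ i)) * u ≈ u * e (σ i)
    σφ i = b-cancelˡ (begin
      b * (e (σ (φ i)) * u)            ≈⟨ *-assoc b _ u ⟨
      b * e (σ (φ i)) * u              ≈⟨ *-congʳ (e-σ (φ i)) ⟩
      e (φ i) * b * u                  ≈⟨ trans (*-assoc _ b u) (*-congˡ (u^-comm m₀)) ⟩
      e (φ i) * (u * b)                ≈⟨ *-assoc _ u b ⟨
      e (φ i) * u * b                  ≈⟨ *-congʳ (e-φ i) ⟩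
      u * e i * b                      ≈⟨ trans (*-assoc u _ b) (*-congˡ (sym (e-σ i))) ⟩
      u * (b * e (σ i))                ≈⟨ *-assoc u b _ ⟨
      u * b * e (σ i)                  ≈⟨ *-congʳ (u^-comm m₀) ⟨
      b * u * e (σ i)                  ≈⟨ *-assoc b u _ ⟩
      b * (u * e (σ i))                ∎)

    φ-* : ∀ i j → φ (i *₀ j) ≡ φ i *₀ φ j
    φ-* i j = e-injective (b-cancelʳ (u-cancelʳ (begin
      e (φ (i *₀ j)) * b * u           ≈⟨ trans (*-assoc _ b u) (*-congˡ (u^-comm m₀)) ⟩
      e (φ (i *₀ j)) * (u * b)         ≈⟨ *-assoc _ u b ⟨
      e (φ (i *₀ j)) * u * b           ≈⟨ *-congʳ (e-φ (i *₀ j)) ⟩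
      u * e (i *₀ j) * b               ≈⟨ trans (*-assoc u _ b) (*-congˡ (e-* i j)) ⟩
      u * (e i * e (σ j))              ≈⟨ *-assoc u _ _ ⟨
      u * e i * e (σ j)                ≈⟨ *-congʳ (e-φ i) ⟨
      e (φ i) * u * e (σ j)            ≈⟨ trans (*-assoc _ u _) (*-congˡ (sym (σφ j))) ⟩
      e (φ i) * (e (σ (φ j)) * u)      ≈⟨ *-assoc _ _ u ⟨
      e (φ i) * e (σ (φ j)) * u        ≈⟨ *-congʳ (e-* (φ i) (φ j)) ⟨
      e (φ i *₀ φ j) * b * u           ∎)))

    φ-0 : φ 0₀ ≡ 0₀
    φ-0 = e-injective (u-cancelʳ (trans (e-φ 0₀) (trans (*-congˡ e-0) (trans (zeroʳ u)
      (sym (trans (*-congʳ e-0) (zeroˡ u)))))))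

    φ-neg : ∀ i → φ (-₀ i) ≡ -₀ φ i
    φ-neg i = R₀.+-inverseʳ-unique (φ i) (φ (-₀ i))
      (≡.trans (≡.sym (φ-+ i (-₀ i))) (≡.trans (≡.cong φ (RingWithoutOne.-‿inverseʳ R₀ i)) φ-0))
      where module R₀ = RingProperties R₀

    φ-injective : ∀ {i j} → φ i ≡ φ j → i ≡ j
    φ-injective {i} {j} φi≡φj = e-injective (*-cancelˡ u-nzd
      (trans (sym (e-φ i)) (trans (*-congʳ (reflexive (≡.cong e φi≡φj))) (e-φ j))))

    -- Dividing e j u by u on the left inverts the conjugation.
    φ-surjective : ∀ j → ∃ λ i → ∀ {k} → k ≡ i → φ k ≡ j
    φ-surjective j = let (i , ui≈ju) = divideˡ 0 (G-* (e∈ j) u∈) in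
      i , λ { ≡.refl → e-injective (u-cancelʳ (trans (e-φ i) ui≈ju)) }

  automorphism : IsAutomorphism R₀ φ
  automorphism = record
    { isRingWithoutOneMonomorphism = record
      { isRingWithoutOneHomomorphism = record
        { +-isGroupHomomorphism = record
          { isMonoidHomomorphism = record
            { isMagmaHomomorphism = record
              { isRelHomomorphism = record { cong = ≡.cong φ }
              ; homo = φ-+
              }
            ; ε-homo = φ-0
            }
          ; ⁻¹-homo = φ-neg
          }
        ; *-homo = φ-*
        }
      ; injective = φ-injective
      }
    ; surjective = φ-surjective
    }

  -- The embeddings of the graded pieces

  private
    open Twisted R₀ φ (IsRingWithoutOneIsoMorphism.isRingWithoutOneHomomorphism automorphism)

    φ^-u^ : ∀ n i → e ((φ^ suc n) i) * u^ n ≈ u^ n * e i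
    φ^-u^ zero    i = e-φ i
    φ^-u^ (suc n) i = begin
      e (φ ((φ^ suc n) i)) * (u^ n * u)        ≈⟨ *-congˡ (u^-comm n) ⟩
      e (φ ((φ^ suc n) i)) * (u * u^ n)        ≈⟨ *-assoc _ u _ ⟨
      e (φ ((φ^ suc n) i)) * u * u^ n          ≈⟨ *-congʳ (e-φ ((φ^ suc n) i)) ⟩
      u * e ((φ^ suc n) i) * u^ n              ≈⟨ *-assoc u _ _ ⟩
      u * (e ((φ^ suc n) i) * u^ n)            ≈⟨ *-congˡ (φ^-u^ n i) ⟩
      u * (u^ n * e i)                         ≈⟨ *-assoc u _ _ ⟨
      u * u^ n * e i                           ≈⟨ *-congʳ (u^-comm n) ⟨
      u^ n * u * e i                           ∎

    σφ^-u^ : ∀ n i → e (σ ((φ^ suc n) i)) * u^ n ≈ u^ n * e (σ i)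
    σφ^-u^ zero    i = σφ i
    σφ^-u^ (suc n) i = begin
      e (σ (φ ((φ^ suc n) i))) * (u^ n * u)    ≈⟨ *-congˡ (u^-comm n) ⟩
      e (σ (φ ((φ^ suc n) i))) * (u * u^ n)    ≈⟨ *-assoc _ u _ ⟨
      e (σ (φ ((φ^ suc n) i))) * u * u^ n      ≈⟨ *-congʳ (σφ ((φ^ suc n) i)) ⟩
      u * e (σ ((φ^ suc n) i)) * u^ n          ≈⟨ *-assoc u _ _ ⟩
      u * (e (σ ((φ^ suc n) i)) * u^ n)        ≈⟨ *-congˡ (σφ^-u^ n i) ⟩
      u * (u^ n * e (σ i))                     ≈⟨ *-assoc u _ _ ⟨
      u * u^ n * e (σ i)                       ≈⟨ *-congʳ (u^-comm n) ⟨
      u^ n * u * e (σ i)                       ∎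

    -- The formal fraction g u⁻⁽ⁿ⁺¹⁾, the coefficient of tⁿ⁺¹ in the image of g.
    leading : ∀ n → Σ Carrier (G n) → Fin size
    leading n (x , Gx) = proj₁ (divideʳ n (G-cast (≡.cong suc (ℕ.+-comm n m₀)) (G-* Gx (G-u^ m₀))))

    e-leading : ∀ n g → e (leading n g) * u^ n ≈ proj₁ g * b
    e-leading n (x , Gx) = proj₂ (divideʳ n (G-cast (≡.cong suc (ℕ.+-comm n m₀)) (G-* Gx (G-u^ m₀))))

    -- As u^ n cancels, an identity for `leading` only requires its defining equation, free of
    -- denominators, to be checked in R.
    leading-unique : ∀ n g {i} → e i * u^ n ≈ proj₁ g * b → leading n g ≡ i
    leading-unique n g eiu≈gb = e-injective (*-cancelʳ (u^-nzd n) (trans (e-leading n g) (sym eiu≈gb)))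

    leading-+ : ∀ n g h → leading n (proj₁ g + proj₁ h , add (proj₂ g) (proj₂ h)) ≡ leading n g +₀ leading n h
    leading-+ n g h = leading-unique n (proj₁ g + proj₁ h , add (proj₂ g) (proj₂ h)) (begin
      e (leading n g +₀ leading n h) * u^ n                        ≈⟨ *-congʳ (e-+ _ _) ⟩
      (e (leading n g) + e (leading n h)) * u^ n                   ≈⟨ distribʳ (u^ n) _ _ ⟩
      e (leading n g) * u^ n + e (leading n h) * u^ n              ≈⟨ +-cong (e-leading n g) (e-leading n h) ⟩
      proj₁ g * b + proj₁ h * b                                    ≈⟨ distribʳ b _ _ ⟨
      (proj₁ g + proj₁ h) * b                                      ∎)

    leading-0 : ∀ n → leading n (0# , gen0) ≡ 0₀
    leading-0 n = leading-unique n (0# , gen0) (trans (*-congʳ e-0) (trans (zeroˡ (u^ n)) (sym (zeroˡ b))))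

    leading-cong : ∀ n {g h} → proj₁ g ≈ proj₁ h → leading n g ≡ leading n h
    leading-cong n {g} {h} g≈h = leading-unique n g (trans (e-leading n h) (*-congʳ (sym g≈h)))

    leading-neg : ∀ n g → leading n (- proj₁ g , neg (proj₂ g)) ≡ -₀ leading n g
    leading-neg n g = R₀.+-inverseʳ-unique (leading n g) _ (≡.trans (≡.sym (leading-+ n g -g))
      (≡.trans (leading-cong n {proj₁ g + - proj₁ g , add (proj₂ g) (proj₂ -g)} {0# , gen0} (-‿inverseʳ (proj₁ g)))
        (leading-0 n)))
      where
      -g = - proj₁ g , neg (proj₂ g)
      module R₀ = RingProperties R₀

    leading-injective : ∀ n {g h} → leading n g ≡ leading n h → proj₁ g ≈ proj₁ h
    leading-injective n {g} {h} eq = b-cancelʳ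
      (trans (sym (e-leading n g)) (trans (*-congʳ (reflexive (≡.cong e eq))) (e-leading n h)))

    -- Formally, with M = m + 1 and N = n + 1, it says g u⁻ᴹ · uᴹ (h u⁻ᴺ) u⁻ᴹ = g h u⁻ᴹ⁻ᴺ.
    leading-* : ∀ m n g h → leading m g *₀ (φ^ suc m) (leading n h) ≡
      leading (m ℕ.+ suc n) (graded-* A (suc m) (suc n) g h)
    leading-* m n g h = ≡.sym (leading-unique (m ℕ.+ suc n) (graded-* A (suc m) (suc n) g h) (b-cancelʳ (begin
      e ij * u^ (m ℕ.+ suc n) * b                 ≈⟨ trans (*-assoc _ _ b) (*-congˡ (u^-comm′ (m ℕ.+ suc n) m₀)) ⟩
      e ij * (b * u^ (m ℕ.+ suc n))               ≈⟨ *-assoc _ b _ ⟨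
      e ij * b * u^ (m ℕ.+ suc n)                 ≈⟨ *-congʳ (e-* i j↑) ⟩
      e i * e (σ j↑) * u^ (m ℕ.+ suc n)
        ≈⟨ *-congˡ (trans (u^-* m n) (reflexive (≡.cong u^ (≡.sym (ℕ.+-suc m n))))) ⟨
      e i * e (σ j↑) * (u^ m * u^ n)             ≈⟨ *-assoc _ (u^ m) _ ⟨
      e i * e (σ j↑) * u^ m * u^ n               ≈⟨ *-congʳ (trans (*-assoc (e i) _ _) (*-congˡ (σφ^-u^ m j))) ⟩
      e i * (u^ m * e (σ j)) * u^ n              ≈⟨ *-congʳ (*-assoc (e i) _ _) ⟨
      e i * u^ m * e (σ j) * u^ n                ≈⟨ *-congʳ (*-congʳ (e-leading m g)) ⟩
      x * b * e (σ j) * u^ n                     ≈⟨ *-congʳ (*-b-shift x j) ⟩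
      x * e j * b * u^ n                         ≈⟨ trans (*-assoc _ b _) (*-congˡ (u^-comm′ m₀ n)) ⟩
      x * e j * (u^ n * b)                       ≈⟨ *-assoc _ (u^ n) b ⟨
      x * e j * u^ n * b                         ≈⟨ *-congʳ (trans (*-assoc x _ _) (*-congˡ (e-leading n h))) ⟩
      x * (y * b) * b                            ≈⟨ *-congʳ (*-assoc x y b) ⟨
      x * y * b * b                              ∎)))
      where
      x = proj₁ g
      y = proj₁ h
      i = leading m g
      j = leading n h
      j↑ = (φ^ suc m) j
      ij = i *₀ j↑

    monomial-cong : ∀ n {i j} → i ≡ j → monomial i n ≋ monomial j n
    monomial-cong n ≡.refl = coeffs λ _ → ≡.refl

    coeff-monomial-+ : ∀ n i j k → coeff (monomial (i +₀ j) n) k ≡ coeff (monomial i n) k +₀ coeff (monomial j n) k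
    coeff-monomial-+ zero    i j zero    = ≡.refl
    coeff-monomial-+ zero    i j (suc k) = ≡.sym (RingWithoutOne.+-identityˡ R₀ 0₀)
    coeff-monomial-+ (suc n) i j zero    = ≡.sym (RingWithoutOne.+-identityˡ R₀ 0₀)
    coeff-monomial-+ (suc n) i j (suc k) = coeff-monomial-+ n i j k

    coeff-monomial-0 : ∀ n k → coeff (monomial 0₀ n) k ≡ 0₀
    coeff-monomial-0 zero    zero    = ≡.refl
    coeff-monomial-0 zero    (suc k) = ≡.refl
    coeff-monomial-0 (suc n) zero    = ≡.refl
    coeff-monomial-0 (suc n) (suc k) = coeff-monomial-0 n k

    coeff-monomial-neg : ∀ n i k → coeff (monomial (-₀ i) n) k ≡ -₀ coeff (monomial i n) k
    coeff-monomial-neg zero    i zero    = ≡.refl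
    coeff-monomial-neg zero    i (suc k) = ≡.sym (RingProperties.-0#≈0# R₀)
    coeff-monomial-neg (suc n) i zero    = ≡.sym (RingProperties.-0#≈0# R₀)
    coeff-monomial-neg (suc n) i (suc k) = coeff-monomial-neg n i k

    coeff-monomial : ∀ n i → coeff (monomial i n) n ≡ i
    coeff-monomial zero    i = ≡.refl
    coeff-monomial (suc n) i = coeff-monomial n i

    ι : ∀ n → AbelianGroup.Carrier ⟨ A ^ n ⟩ → Poly
    ι zero    g = []
    ι (suc n) g = monomial (leading n g) (suc n)

  gradedEmbedding : GradedEmbedding R A R₀ φ automorphism
  gradedEmbedding = record
    { ι           = ι
    ; homogeneous = λ { (suc n) _ g → leading n g , monomial-cong (suc n) ≡.refl }
    ; embedding   = λ { (suc n) _ → record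
      { isGroupHomomorphism = record
        { isMonoidHomomorphism = record
          { isMagmaHomomorphism = record
            { isRelHomomorphism = record { cong = λ {g} {h} g≈h → monomial-cong (suc n) (leading-cong n {g} {h} g≈h) }
            ; homo = λ g h → coeffs λ k → ≡.trans (coeff-≈ (monomial-cong (suc n) (leading-+ n g h)) k)
                (≡.trans (coeff-monomial-+ (suc n) (leading n g) (leading n h) k)
                  (≡.sym (coeff-⊕ (monomial (leading n g) (suc n)) (monomial (leading n h) (suc n)) k)))
            }
          ; ε-homo = coeffs λ k → ≡.trans (coeff-≈ (monomial-cong (suc n) (leading-0 n)) k) (coeff-monomial-0 (suc n) k)
          }
        ; ⁻¹-homo = λ g → coeffs λ k → ≡.trans (coeff-≈ (monomial-cong (suc n) (leading-neg n g)) k)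
            (≡.trans (coeff-monomial-neg (suc n) (leading n g) k) (≡.sym (coeff-⊝ (monomial (leading n g) (suc n)) k)))
        }
      ; injective = λ {g} {h} ιg≋ιh → leading-injective n {g} {h}
          (≡.trans (≡.sym (coeff-monomial (suc n) (leading n g)))
            (≡.trans (coeff-≈ ιg≋ιh (suc n)) (coeff-monomial (suc n) (leading n h))))
      } }
    ; ι-*         = λ { (suc m) (suc n) _ _ g h → coeffs λ k → ≡.trans
        (coeff-≈ (monomial-⊛ (leading m g) (suc m) (leading n h) (suc n)) k)
        (coeff-≈ (monomial-cong (suc (m ℕ.+ suc n)) (leading-* m n g h)) k) }
    }

  model : ∃₂ λ (R₀ : RingWithoutOne 0ℓ 0ℓ) n → HasCardinality (RingWithoutOne.setoid R₀) U n ×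
    (∀ m {j} → AtLeast setoid (Generated (A ^ suc m)) j → j ≤ n) × n ≤ bound ×
    ∃₂ λ φ (φ-auto : IsAutomorphism R₀ φ) → GradedEmbedding R A R₀ φ φ-auto
  model = R₀ , size , #R₀ , size-maximal , size-bounded , φ , automorphism , gradedEmbedding

-- Real parameters

opaque
  cast : ℕ → ℚ
  cast n = + n ℚ./ 1

  cast-≡ : ∀ n → cast n ≡ + n ℚ./ 1
  cast-≡ n = ≡.refl

  seq-fromℕ : ∀ k n → seq (fromℕ k) n ≡ cast k
  seq-fromℕ k n = ≡.refl

  toℚᵘ-cast : ∀ n → toℚᵘ (cast n) ℚᵘ.≃ mkℚᵘ (+ n) 0
  toℚᵘ-cast n = ℚ.toℚᵘ-fromℚᵘ (mkℚᵘ (+ n) 0)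

cast-* : ∀ m n → cast (m ℕ.* n) ≡ cast m ℚ.* cast n
cast-* m n = ℚ.toℚᵘ-injective (ℚᵘ.≃-trans (toℚᵘ-cast (m ℕ.* n)) (ℚᵘ.≃-trans
  (*≡* (≡.cong (ℤ._* + 1) (ℤ.pos-* m n)))
  (ℚᵘ.≃-sym (ℚᵘ.≃-trans (ℚ.toℚᵘ-homo-* (cast m) (cast n))
    (ℚᵘ.*-cong (toℚᵘ-cast m) (toℚᵘ-cast n))))))

cast-+ : ∀ m n → cast (m ℕ.+ n) ≡ cast m ℚ.+ cast n
cast-+ m n = ℚ.toℚᵘ-injective (ℚᵘ.≃-trans (toℚᵘ-cast (m ℕ.+ n)) (ℚᵘ.≃-trans
  (*≡* (≡.cong (ℤ._* + 1) (≡.trans (ℤ.pos-+ m n)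
    (≡.sym (≡.cong₂ ℤ._+_ (ℤ.*-identityʳ (+ m)) (ℤ.*-identityʳ (+ n)))))))
  (ℚᵘ.≃-sym (ℚᵘ.≃-trans (ℚ.toℚᵘ-homo-+ (cast m) (cast n))
    (ℚᵘ.+-cong (toℚᵘ-cast m) (toℚᵘ-cast n))))))

cast-mono-≤ : ∀ {m n} → m ≤ n → cast m ℚ.≤ cast n
cast-mono-≤ {m} {n} m≤n = ℚ.toℚᵘ-cancel-≤ (ℚᵘ.≤-trans (ℚᵘ.≤-reflexive (toℚᵘ-cast m)) (ℚᵘ.≤-trans
  (*≤* (ℤ.*-monoʳ-≤-nonNeg (+ 1) (ℤ.+≤+ m≤n))) (ℚᵘ.≤-reflexive (ℚᵘ.≃-sym (toℚᵘ-cast n)))))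

0≤cast : ∀ n → 0ℚ ℚ.≤ cast n
0≤cast n = ≡.subst (ℚ._≤ cast n) (cast-≡ 0) (cast-mono-≤ {0} {n} z≤n)

archimedean : ∀ q → ∃ λ n → q ℚ.≤ cast n
archimedean q@(mkℚ i d _) = ℤ.∣ i ∣ , ℚ.toℚᵘ-cancel-≤ (ℚᵘ.≤-trans
  (*≤* (≡.subst₂ ℤ._≤_ (≡.sym (ℤ.*-identityʳ i)) (ℤ.pos-* ℤ.∣ i ∣ (suc d))
    (ℤ.≤-trans (i≤∣i∣ i) (ℤ.+≤+ (ℕ.m≤m*n ℤ.∣ i ∣ (suc d))))))
  (ℚᵘ.≤-reflexive (ℚᵘ.≃-sym (toℚᵘ-cast ℤ.∣ i ∣))))
  where
  i≤∣i∣ : ∀ i → i ℤ.≤ + ℤ.∣ i ∣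
  i≤∣i∣ (+ n)        = ℤ.≤-refl
  i≤∣i∣ (ℤ.-[1+ n ]) = ℤ.-≤+

0<½ : 0ℚ ℚ.< ½
0<½ = ℚ.positive⁻¹ ½

½<1 : ½ ℚ.< 1ℚ
½<1 = ℚ.*<* (ℤ.+<+ (s≤s (s≤s z≤n)))

0≤½ : 0ℚ ℚ.≤ ½
0≤½ = ℚ.<⇒≤ 0<½

ceiling : ∀ q → 0ℚ ℚ.< q → ∃ λ n → q ℚ.≤ cast (suc n) × cast n ℚ.< q
ceiling q 0<q = let (n , q≤n) = archimedean q in search n q≤n
  where
  search : ∀ n → q ℚ.≤ cast n → ∃ λ n → q ℚ.≤ cast (suc n) × cast n ℚ.< q
  search zero    q≤0 = contradiction (ℚ.<-≤-trans 0<q (≡.subst (q ℚ.≤_) (cast-≡ 0) q≤0)) (ℚ.<-irrefl ≡.refl)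
  search (suc n) q≤  with q ℚ.≤? cast n
  ... | yes q≤n = search n q≤n
  ... | no  q≰n = n , q≤ , ℚ.≰⇒> q≰n

*-mono-≤-nonNeg : ∀ p q r s → 0ℚ ℚ.≤ p → p ℚ.≤ q → 0ℚ ℚ.≤ r → r ℚ.≤ s → p ℚ.* r ℚ.≤ q ℚ.* s
*-mono-≤-nonNeg p q r s 0≤p p≤q 0≤r r≤s = ℚ.≤-trans
  (ℚ.*-monoʳ-≤-nonNeg r {{ℚ.nonNegative 0≤r}} p≤q)
  (ℚ.*-monoˡ-≤-nonNeg q {{ℚ.nonNegative (ℚ.≤-trans 0≤p p≤q)}} r≤s)

p≤q+r⇒p-r≤q : ∀ p q r → p ℚ.≤ q ℚ.+ r → p ℚ.- r ℚ.≤ q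
p≤q+r⇒p-r≤q p q r p≤q+r = ℚ.≤-trans (ℚ.+-monoˡ-≤ (ℚ.- r) p≤q+r)
  (ℚ.≤-reflexive (solve 2 (λ q r → q :+ r :- r := q) ≡.refl q r))
  where open ℚSolver.+-*-Solver

0≤p*q : ∀ p q → 0ℚ ℚ.≤ p → 0ℚ ℚ.≤ q → 0ℚ ℚ.≤ p ℚ.* q
0≤p*q p q 0≤p 0≤q = ℚ.≤-trans (ℚ.≤-reflexive (≡.sym (ℚ.*-zeroˡ q)))
  (ℚ.*-monoʳ-≤-nonNeg q {{ℚ.nonNegative 0≤q}} 0≤p)

seq-*ᴿ : ∀ x y n → seq (x *ᴿ y) n ≡ seq x n ℚ.* seq y n
seq-*ᴿ x y n = ≡.refl

module _ (K : ℝ) (1≤K : fromℕ 1 ≤ᴿ K) where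
  open ℚ.≤-Reasoning

  -- The order on reals gives K ≥ 1 only up to an error along the sequence. The induction halves it,
  -- as (1 - η / 2)² ≥ 1 - η.
  ^ᴿ-near-1 : ∀ m η → 0ℚ ℚ.< η → η ℚ.≤ 1ℚ → ∃ λ N → ∀ n → N ≤ n → 1ℚ ℚ.- η ℚ.≤ seq (K ^ᴿ m) n
  ^ᴿ-near-1 zero    η 0<η η≤1 = 0 , λ _ _ → p≤q+r⇒p-r≤q 1ℚ 1ℚ η (begin
    1ℚ           ≡⟨ ℚ.+-identityʳ 1ℚ ⟨
    1ℚ ℚ.+ 0ℚ    ≤⟨ ℚ.+-monoʳ-≤ 1ℚ (ℚ.<⇒≤ 0<η) ⟩
    1ℚ ℚ.+ η     ∎)
  ^ᴿ-near-1 (suc m) η 0<η η≤1 = N₁ ℕ.⊔ N₂ , λ n N≤n → begin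
    1ℚ ℚ.- η
      ≡⟨ ≡.trans (≡.sym (ℚ.+-identityʳ (1ℚ ℚ.- η))) (≡.cong (λ η → 1ℚ ℚ.- η ℚ.+ 0ℚ) (≡.sym halves)) ⟩
    1ℚ ℚ.- (h ℚ.+ h) ℚ.+ 0ℚ                            ≤⟨ ℚ.+-monoʳ-≤ (1ℚ ℚ.- (h ℚ.+ h)) (0≤p*q h h (ℚ.<⇒≤ 0<h) (ℚ.<⇒≤ 0<h)) ⟩
    1ℚ ℚ.- (h ℚ.+ h) ℚ.+ h ℚ.* h
      ≡⟨ solve 1 (λ h → con 1ℚ :- (h :+ h) :+ h :* h := (con 1ℚ :- h) :* (con 1ℚ :- h)) ≡.refl h ⟩
    (1ℚ ℚ.- h) ℚ.* (1ℚ ℚ.- h)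
      ≤⟨ *-mono-≤-nonNeg (1ℚ ℚ.- h) (seq K n) (1ℚ ℚ.- h) (seq (K ^ᴿ m) n)
           0≤1-h (p≤q+r⇒p-r≤q 1ℚ (seq K n) h (proj₂ close n (ℕ.≤-trans (ℕ.m≤m⊔n N₁ N₂) N≤n)))
           0≤1-h (proj₂ rest n (ℕ.≤-trans (ℕ.m≤n⊔m N₁ N₂) N≤n)) ⟩
    seq K n ℚ.* seq (K ^ᴿ m) n                         ∎
    where
    open ℚSolver.+-*-Solver
    h = ½ ℚ.* η

    halves : h ℚ.+ h ≡ η
    halves = ≡.trans (≡.sym (ℚ.*-distribʳ-+ η ½ ½)) (ℚ.*-identityˡ η)

    0<h : 0ℚ ℚ.< h
    0<h = ℚ.≤-<-trans (ℚ.≤-reflexive (≡.sym (ℚ.*-zeroʳ ½))) (ℚ.*-monoʳ-<-pos ½ 0<η)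

    h≤1 : h ℚ.≤ 1ℚ
    h≤1 = begin
      h            ≡⟨ ℚ.+-identityʳ h ⟨
      h ℚ.+ 0ℚ     ≤⟨ ℚ.+-monoʳ-≤ h (ℚ.<⇒≤ 0<h) ⟩
      h ℚ.+ h      ≡⟨ halves ⟩
      η            ≤⟨ η≤1 ⟩
      1ℚ           ∎

    0≤1-h : 0ℚ ℚ.≤ 1ℚ ℚ.- h
    0≤1-h = ℚ.≤-trans (ℚ.≤-reflexive (≡.sym (ℚ.+-inverseʳ h))) (ℚ.+-monoˡ-≤ (ℚ.- h) h≤1)

    close = 1≤K h 0<h
    rest = ^ᴿ-near-1 m h 0<h h≤1
    N₁ = proj₁ close
    N₂ = proj₁ rest

  ^ᴿ-+ : ∀ k j n → seq (K ^ᴿ (k ℕ.+ j)) n ≡ seq (K ^ᴿ k) n ℚ.* seq (K ^ᴿ j) n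
  ^ᴿ-+ zero    j n = ≡.sym (ℚ.*-identityˡ (seq (K ^ᴿ j) n))
  ^ᴿ-+ (suc k) j n = ≡.trans (≡.cong (seq K n ℚ.*_) (^ᴿ-+ k j n)) (≡.sym (ℚ.*-assoc (seq K n) _ _))

  record IntegerBound : Set where
    field
      L N     : ℕ
      0<L     : 0 < L
      above   : ∀ n → N ≤ n → seq K n ℚ.≤ cast L
      below   : ∀ n → N ≤ n → cast L ℚ.≤ cast 5 ℚ.* seq K n
      0≤K     : ∀ n → N ≤ n → 0ℚ ℚ.≤ seq K n

  integerBound : IntegerBound
  integerBound = record
    { L     = suc (proj₁ L-1)
    ; N     = N
    ; 0<L   = s≤s z≤n
    ; above = λ n N≤n → begin
        seq K n                       ≡⟨ split (seq K n) x ⟩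
        (seq K n ℚ.- x) ℚ.+ x         ≤⟨ ℚ.+-monoˡ-≤ x (ℚ.≤-trans (p≤∣p∣ _) (ℚ.<⇒≤ (proj₂ cauchy-½ n N (N₁≤ n N≤n) (N₁≤ N ℕ.≤-refl)))) ⟩
        ½ ℚ.+ x                       ≡⟨ ℚ.+-comm ½ x ⟩
        x ℚ.+ ½                       ≤⟨ proj₁ (proj₂ L-1) ⟩
        cast (suc (proj₁ L-1))        ∎
    -- L ≤ 1 + (x + ½) and x ≤ seq K n + ½ give L ≤ seq K n + 4 · ½, and ½ ≤ seq K n eventually;
    -- hence the 5.
    ; below = λ n N≤n → begin
        cast (suc (proj₁ L-1))        ≡⟨ ≡.trans (cast-+ 1 (proj₁ L-1)) (≡.cong (ℚ._+ cast (proj₁ L-1)) (cast-≡ 1)) ⟩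
        1ℚ ℚ.+ cast (proj₁ L-1)       ≤⟨ ℚ.+-monoʳ-≤ 1ℚ (ℚ.<⇒≤ (proj₂ (proj₂ L-1))) ⟩
        1ℚ ℚ.+ (x ℚ.+ ½)              ≡⟨ ≡.cong (λ y → 1ℚ ℚ.+ (y ℚ.+ ½)) (split x (seq K n)) ⟩
        1ℚ ℚ.+ ((x ℚ.- seq K n) ℚ.+ seq K n ℚ.+ ½)
          ≤⟨ ℚ.+-monoʳ-≤ 1ℚ (ℚ.+-mono-≤ (ℚ.+-monoˡ-≤ (seq K n)
               (ℚ.≤-trans (p≤∣p∣ _) (ℚ.<⇒≤ (proj₂ cauchy-½ N n (N₁≤ N ℕ.≤-refl) (N₁≤ n N≤n)))))
               (ℚ.≤-refl {½})) ⟩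
        (½ ℚ.+ ½) ℚ.+ (½ ℚ.+ seq K n ℚ.+ ½)
          ≤⟨ ℚ.+-mono-≤ (ℚ.+-mono-≤ (½≤ n N≤n) (½≤ n N≤n))
               (ℚ.+-mono-≤ (ℚ.+-monoˡ-≤ (seq K n) (½≤ n N≤n)) (½≤ n N≤n)) ⟩
        (seq K n ℚ.+ seq K n) ℚ.+ (seq K n ℚ.+ seq K n ℚ.+ seq K n)
          ≡⟨ solve 1 (λ y → (y :+ y) :+ (y :+ y :+ y) := con (+ 5 ℚ./ 1) :* y) ≡.refl (seq K n) ⟩
        (+ 5 ℚ./ 1) ℚ.* seq K n       ≡⟨ ≡.cong (ℚ._* seq K n) (cast-≡ 5) ⟨
        cast 5 ℚ.* seq K n            ∎
    ; 0≤K   = λ n N≤n → ℚ.≤-trans 0≤½ (½≤ n N≤n)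
    }
    where
    open ℚSolver.+-*-Solver

    p≤∣p∣ : ∀ p → p ℚ.≤ ℚ.∣ p ∣
    p≤∣p∣ p with ℚ.≤-total 0ℚ p
    ... | inj₁ 0≤p = ℚ.≤-reflexive (≡.sym (ℚ.0≤p⇒∣p∣≡p 0≤p))
    ... | inj₂ p≤0 = ℚ.≤-trans p≤0 (ℚ.0≤∣p∣ p)

    split : ∀ p q → p ≡ (p ℚ.- q) ℚ.+ q
    split = solve 2 (λ p q → p := (p :- q) :+ q) ≡.refl

    cauchy-½ = cauchy K ½ 0<½
    N₁ = proj₁ cauchy-½
    N₂ = proj₁ (1≤K ½ 0<½)
    N = N₁ ℕ.⊔ N₂
    x = seq K N

    N₁≤ : ∀ n → N ≤ n → N₁ ≤ n
    N₁≤ n N≤n = ℕ.≤-trans (ℕ.m≤m⊔n N₁ N₂) N≤n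

    ½≤ : ∀ n → N ≤ n → ½ ℚ.≤ seq K n
    ½≤ n N≤n = p≤q+r⇒p-r≤q 1ℚ (seq K n) ½ (proj₂ (1≤K ½ 0<½) n (ℕ.≤-trans (ℕ.m≤n⊔m N₁ N₂) N≤n))

    L-1 : ∃ λ n → x ℚ.+ ½ ℚ.≤ cast (suc n) × cast n ℚ.< x ℚ.+ ½
    L-1 = ceiling (x ℚ.+ ½) (ℚ.<-≤-trans 0<½ (begin
      ½            ≡⟨ ℚ.+-identityˡ ½ ⟨
      0ℚ ℚ.+ ½     ≤⟨ ℚ.+-monoˡ-≤ ½ (ℚ.≤-trans 0≤½ (½≤ N ℕ.≤-refl)) ⟩
      x ℚ.+ ½      ∎))

  open IntegerBound integerBound

  -- For integers an error of ½ is harmless: L y < x would give L y + 1 ≤ x ≤ L y + ½.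
  ≤ᴿ⇒≤ : ∀ x y → fromℕ x ≤ᴿ K *ᴿ fromℕ y → x ≤ L ℕ.* y
  ≤ᴿ⇒≤ x y x≤Ky = ℕ.≮⇒≥ λ Ly<x →
    ℚ.<-irrefl ≡.refl (ℚ.<-≤-trans (ℚ.+-monoʳ-< (cast (L ℕ.* y)) ½<1) (bad Ly<x))
    where
    n₀ = N ℕ.⊔ proj₁ (x≤Ky ½ 0<½)

    bad : L ℕ.* y < x → cast (L ℕ.* y) ℚ.+ 1ℚ ℚ.≤ cast (L ℕ.* y) ℚ.+ ½
    bad Ly<x = begin
      cast (L ℕ.* y) ℚ.+ 1ℚ                ≡⟨ ≡.trans (ℚ.+-comm (cast (L ℕ.* y)) 1ℚ) (≡.sym (≡.trans (cast-+ 1 (L ℕ.* y)) (≡.cong (ℚ._+ cast (L ℕ.* y)) (cast-≡ 1)))) ⟩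
      cast (suc (L ℕ.* y))                 ≤⟨ cast-mono-≤ Ly<x ⟩
      cast x                               ≡⟨ seq-fromℕ x n₀ ⟨
      seq (fromℕ x) n₀                     ≤⟨ proj₂ (x≤Ky ½ 0<½) n₀ (ℕ.m≤n⊔m N _) ⟩
      seq (K *ᴿ fromℕ y) n₀ ℚ.+ ½
        ≡⟨ ≡.cong (ℚ._+ ½) (≡.trans (seq-*ᴿ K (fromℕ y) n₀) (≡.cong (seq K n₀ ℚ.*_) (seq-fromℕ y n₀))) ⟩
      seq K n₀ ℚ.* cast y ℚ.+ ½
        ≤⟨ ℚ.+-monoˡ-≤ ½ (ℚ.*-monoʳ-≤-nonNeg (cast y) {{ℚ.nonNegative (0≤cast y)}} (above n₀ (ℕ.m≤m⊔n N _))) ⟩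
      cast L ℚ.* cast y ℚ.+ ½              ≡⟨ ≡.cong (ℚ._+ ½) (cast-* L y) ⟨
      cast (L ℕ.* y) ℚ.+ ½                 ∎

  0≤^ᴿ : ∀ m n → N ≤ n → 0ℚ ℚ.≤ seq (K ^ᴿ m) n
  0≤^ᴿ zero    n N≤n = ℚ.<⇒≤ (ℚ.positive⁻¹ 1ℚ)
  0≤^ᴿ (suc m) n N≤n = 0≤p*q (seq K n) (seq (K ^ᴿ m) n) (0≤K n N≤n) (0≤^ᴿ m n N≤n)

  L^≤ : ∀ k n → N ≤ n → cast (L ℕ.^ k) ℚ.≤ cast (5 ℕ.^ k) ℚ.* seq (K ^ᴿ k) n
  L^≤ zero    n N≤n = ℚ.≤-reflexive (≡.sym (ℚ.*-identityʳ (cast 1)))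
  L^≤ (suc k) n N≤n = begin
    cast (L ℕ.* L ℕ.^ k)                   ≡⟨ cast-* L (L ℕ.^ k) ⟩
    cast L ℚ.* cast (L ℕ.^ k)              ≤⟨ *-mono-≤-nonNeg (cast L) (cast 5 ℚ.* seq K n) (cast (L ℕ.^ k)) (cast (5 ℕ.^ k) ℚ.* seq (K ^ᴿ k) n)
           (0≤cast L) (below n N≤n) (0≤cast (L ℕ.^ k)) (L^≤ k n N≤n) ⟩
    (cast 5 ℚ.* seq K n) ℚ.* (cast (5 ℕ.^ k) ℚ.* seq (K ^ᴿ k) n)
      ≡⟨ solve 4 (λ a b c d → (a :* b) :* (c :* d) := (a :* c) :* (b :* d)) ≡.refl (cast 5) (seq K n) (cast (5 ℕ.^ k)) (seq (K ^ᴿ k) n) ⟩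
    (cast 5 ℚ.* cast (5 ℕ.^ k)) ℚ.* (seq K n ℚ.* seq (K ^ᴿ k) n)
      ≡⟨ ≡.cong (ℚ._* (seq K n ℚ.* seq (K ^ᴿ k) n)) (cast-* 5 (5 ℕ.^ k)) ⟨
    cast (5 ℕ.* 5 ℕ.^ k) ℚ.* (seq K n ℚ.* seq (K ^ᴿ k) n)  ∎
    where open ℚSolver.+-*-Solver

  -- One C has to serve as factor and as exponent. With j = 2 c 5^k, the bound c 5^k K^k equals j
  -- K^k / 2, and eventually K^j ≥ ½, so it is at most j K^(k + j), with j ≤ C = k + j.
  ≤⇒≤ᴿ : ∀ c k x y → x ≤ c ℕ.* L ℕ.^ k ℕ.* y →
    let C = k ℕ.+ 2 ℕ.* (c ℕ.* 5 ℕ.^ k) in fromℕ x ≤ᴿ fromℕ C *ᴿ K ^ᴿ C *ᴿ fromℕ y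
  ≤⇒≤ᴿ c k x y x≤ ε 0<ε = N ℕ.⊔ proj₁ near , λ n N≤n →
    let P = seq (K ^ᴿ k) n
        Q = seq (K ^ᴿ j) n
        N≤ = ℕ.≤-trans (ℕ.m≤m⊔n N _) N≤n
        ½≤Q = proj₂ near n (ℕ.≤-trans (ℕ.m≤n⊔m N _) N≤n)
        0≤P = 0≤^ᴿ k n N≤
    in begin
      seq (fromℕ x) n                                  ≡⟨ seq-fromℕ x n ⟩
      cast x                                           ≤⟨ cast-mono-≤ x≤ ⟩
      cast (c ℕ.* L ℕ.^ k ℕ.* y)                       ≡⟨ cast-* (c ℕ.* L ℕ.^ k) y ⟩
      cast (c ℕ.* L ℕ.^ k) ℚ.* cast y                  ≤⟨ ℚ.*-monoʳ-≤-nonNeg (cast y) {{ℚ.nonNegative (0≤cast y)}} (begin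
        cast (c ℕ.* L ℕ.^ k)                           ≡⟨ cast-* c (L ℕ.^ k) ⟩
        cast c ℚ.* cast (L ℕ.^ k)                      ≤⟨ ℚ.*-monoˡ-≤-nonNeg (cast c) {{ℚ.nonNegative (0≤cast c)}} (L^≤ k n N≤) ⟩
        cast c ℚ.* (cast (5 ℕ.^ k) ℚ.* P)
          ≡⟨ solve 3 (λ c f P → c :* (f :* P) := (con (+ 2 ℚ./ 1) :* (c :* f)) :* (P :* con ½)) ≡.refl (cast c) (cast (5 ℕ.^ k)) P ⟩
        ((+ 2 ℚ./ 1) ℚ.* (cast c ℚ.* cast (5 ℕ.^ k))) ℚ.* (P ℚ.* ½)
          ≡⟨ ≡.cong (ℚ._* (P ℚ.* ½)) (≡.trans (cast-* 2 (c ℕ.* 5 ℕ.^ k)) (≡.cong₂ ℚ._*_ (cast-≡ 2) (cast-* c (5 ℕ.^ k)))) ⟨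
        cast j ℚ.* (P ℚ.* ½)
          ≤⟨ *-mono-≤-nonNeg (cast j) (cast C) (P ℚ.* ½) (P ℚ.* Q)
               (0≤cast j) (cast-mono-≤ (ℕ.m≤n+m j k)) (0≤p*q P ½ 0≤P 0≤½)
               (*-mono-≤-nonNeg P P ½ Q 0≤P ℚ.≤-refl 0≤½ ½≤Q) ⟩
        cast C ℚ.* (P ℚ.* Q)                           ≡⟨ ≡.cong (cast C ℚ.*_) (^ᴿ-+ k j n) ⟨
        cast C ℚ.* seq (K ^ᴿ C) n                      ∎) ⟩
      cast C ℚ.* seq (K ^ᴿ C) n ℚ.* cast y
        ≡⟨ ≡.cong₂ (λ p q → p ℚ.* seq (K ^ᴿ C) n ℚ.* q) (seq-fromℕ C n) (seq-fromℕ y n) ⟨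
      seq (fromℕ C) n ℚ.* seq (K ^ᴿ C) n ℚ.* seq (fromℕ y) n
        ≡⟨ ≡.trans (seq-*ᴿ (fromℕ C *ᴿ K ^ᴿ C) (fromℕ y) n)
             (≡.cong (ℚ._* seq (fromℕ y) n) (seq-*ᴿ (fromℕ C) (K ^ᴿ C) n)) ⟨
      seq (fromℕ C *ᴿ K ^ᴿ C *ᴿ fromℕ y) n             ≤⟨ p≤p+ε (seq (fromℕ C *ᴿ K ^ᴿ C *ᴿ fromℕ y) n) ⟩
      seq (fromℕ C *ᴿ K ^ᴿ C *ᴿ fromℕ y) n ℚ.+ ε       ∎
    where
    open ℚSolver.+-*-Solver
    j = 2 ℕ.* (c ℕ.* 5 ℕ.^ k)
    C = k ℕ.+ j

    p≤p+ε : ∀ p → p ℚ.≤ p ℚ.+ ε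
    p≤p+ε p = ℚ.≤-trans (ℚ.≤-reflexive (≡.sym (ℚ.+-identityʳ p))) (ℚ.+-monoʳ-≤ p (ℚ.<⇒≤ 0<ε))

    near = ^ᴿ-near-1 j ½ 0<½ (ℚ.<⇒≤ ½<1)

-- Polynomial dependence of the constants on L

PolynomiallyBounded : (ℕ → ℕ) → Set
PolynomiallyBounded f = ∃₂ λ c k → ∀ L → 0 < L → f L ≤ c ℕ.* L ℕ.^ k

polynomial-const : ∀ c → PolynomiallyBounded (λ _ → c)
polynomial-const c = c , 0 , λ L _ → ≤-reflexive (≡.sym (ℕ.*-identityʳ c))

polynomial-id : PolynomiallyBounded id
polynomial-id = 1 , 1 , λ L _ → ≤-reflexive (≡.sym (≡.trans (ℕ.*-identityˡ (L ℕ.^ 1)) (ℕ.^-identityʳ L)))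

polynomial-* : ∀ {f g} → PolynomiallyBounded f → PolynomiallyBounded g → PolynomiallyBounded (λ L → f L ℕ.* g L)
polynomial-* {f} {g} (c , k , f≤) (d , l , g≤) = c ℕ.* d , k ℕ.+ l , λ L 0<L → begin
  f L ℕ.* g L                              ≤⟨ *-mono-≤ (f≤ L 0<L) (g≤ L 0<L) ⟩
  (c ℕ.* L ℕ.^ k) ℕ.* (d ℕ.* L ℕ.^ l)
    ≡⟨ solve 4 (λ c p d q → (c :* p) :* (d :* q) := (c :* d) :* (p :* q)) ≡.refl c (L ℕ.^ k) d (L ℕ.^ l) ⟩
  c ℕ.* d ℕ.* (L ℕ.^ k ℕ.* L ℕ.^ l)        ≡⟨ ≡.cong (c ℕ.* d ℕ.*_) (ℕ.^-distribˡ-+-* L k l) ⟨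
  c ℕ.* d ℕ.* L ℕ.^ (k ℕ.+ l)              ∎
  where
  open ≤-Reasoning
  open +-*-Solver

polynomial-^ : ∀ {f} → PolynomiallyBounded f → ∀ n → PolynomiallyBounded (λ L → f L ℕ.^ n)
polynomial-^ f zero    = polynomial-const 1
polynomial-^ f (suc n) = polynomial-* f (polynomial-^ f n)

polynomial-cong : ∀ {f g} → (∀ L → f L ≡ g L) → PolynomiallyBounded g → PolynomiallyBounded f
polynomial-cong f≗g (c , k , g≤) = c , k , λ L 0<L → ≤-trans (≤-reflexive (f≗g L)) (g≤ L 0<L)

square-polynomial : PolynomiallyBounded (λ L → L ℕ.* L)
square-polynomial = polynomial-* polynomial-id polynomial-id

coverSize-polynomial : PolynomiallyBounded (λ L → coverSize (L ℕ.* L))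
coverSize-polynomial = polynomial-cong (λ L → coverSize-≡ (L ℕ.* L))
  (polynomial-* (polynomial-const 4) square-polynomial)

stepGrowth-polynomial : PolynomiallyBounded (λ L → stepGrowth (L ℕ.* L))
stepGrowth-polynomial = polynomial-cong (λ L → stepGrowth-≡ (L ℕ.* L))
  (polynomial-* (polynomial-* (polynomial-const 2) coverSize-polynomial) square-polynomial)

growth-polynomial : PolynomiallyBounded (λ L → growth (L ℕ.* L))
growth-polynomial = polynomial-cong (λ L → growth-≡ (L ℕ.* L))
  (polynomial-* coverSize-polynomial (polynomial-* coverSize-polynomial
    (polynomial-* stepGrowth-polynomial stepGrowth-polynomial)))

growth*L-polynomial : PolynomiallyBounded (λ L → growth (L ℕ.* L) ℕ.* L)
growth*L-polynomial = polynomial-* growth-polynomial polynomial-id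

coverGrowth-polynomial : PolynomiallyBounded coverGrowth
coverGrowth-polynomial = polynomial-cong coverGrowth-≡ (polynomial-* (polynomial-const 2) growth*L-polynomial)

combinationGrowth-polynomial : PolynomiallyBounded combinationGrowth
combinationGrowth-polynomial = polynomial-cong combinationGrowth-≡
  (polynomial-* coverGrowth-polynomial (polynomial-* coverGrowth-polynomial
    (polynomial-* (polynomial-^ growth-polynomial 4) polynomial-id)))

2*combinationGrowth-polynomial : PolynomiallyBounded (λ L → 2 ℕ.* combinationGrowth L)
2*combinationGrowth-polynomial = polynomial-* (polynomial-const 2) combinationGrowth-polynomial

groupGrowth-polynomial : PolynomiallyBounded groupGrowth
groupGrowth-polynomial = polynomial-cong groupGrowth-≡
  (polynomial-* 2*combinationGrowth-polynomial (polynomial-* growth*L-polynomial growth*L-polynomial))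

opaque
  -- Adding coefficients and exponents dominates both bounds because L ≥ 1. The successor keeps the
  -- coefficient positive, which gives 1 ≤ C in the end.
  common-bound : ∃₂ λ c k → 0 < c × ∀ L → 0 < L →
    2 ℕ.* combinationGrowth L ≤ c ℕ.* L ℕ.^ k × groupGrowth L ≤ c ℕ.* L ℕ.^ k
  common-bound = combine 2*combinationGrowth-polynomial groupGrowth-polynomial
    where
    combine : ∀ {f g} → PolynomiallyBounded f → PolynomiallyBounded g →
      ∃₂ λ c k → 0 < c × ∀ L → 0 < L → f L ≤ c ℕ.* L ℕ.^ k × g L ≤ c ℕ.* L ℕ.^ k
    combine (c , k , f≤) (d , l , g≤) = suc (c ℕ.+ d) , k ℕ.+ l , s≤s z≤n , λ L 0<L →
        ≤-trans (f≤ L 0<L) (*-mono-≤ (ℕ.m≤n⇒m≤1+n (ℕ.m≤m+n c d)) (ℕ.^-monoʳ-≤ L {{ℕ.>-nonZero 0<L}} (ℕ.m≤m+n k l)))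
      , ≤-trans (g≤ L 0<L) (*-mono-≤ (ℕ.m≤n⇒m≤1+n (ℕ.m≤n+m d c)) (ℕ.^-monoʳ-≤ L {{ℕ.>-nonZero 0<L}} (ℕ.m≤n+m l k)))

-- The dichotomy, with L and then with K

module _ {c ℓ p : Level} (em : ExcludedMiddle (c ⊔ ℓ ⊔ p)) (R : RingWithoutOne c ℓ)
  (A : Pred (RingWithoutOne.Carrier R) p) where
  open RingWithoutOne R using (Carrier; setoid; _+_; -_; +-cong; -‿cong; *-congˡ; *-congʳ; sym; trans)
  open Subsets R

  -- A - A has at most N² elements, so its zero divisors have a definite number z. Whether 2 σ z
  -- reaches N, with σ = `combinationGrowth L`, decides between the alternatives.
  integral-theorem : ∀ {N M d} → HasCardinality setoid A N → 0 < N →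
    HasCardinality setoid ((A · A) ⊖ (A · A)) M → HasCardinality setoid (A · A) d →
    ∀ L → 0 < L → M ≤ L ℕ.* N → N ≤ L ℕ.* d →
    (∃ λ z → HasCardinality setoid ((A ⊖ A) ∖ NonZeroDivisor) z × N ≤ 2 ℕ.* combinationGrowth L ℕ.* z) ⊎
    (∃₂ λ (R₀ : RingWithoutOne 0ℓ 0ℓ) (n : ℕ) → HasCardinality (RingWithoutOne.setoid R₀) U n ×
      N ≤ n × n ≤ groupGrowth L ℕ.* N ×
      ∃₂ λ φ (φ-auto : IsAutomorphism R₀ φ) → GradedEmbedding R A R₀ φ φ-auto)
  integral-theorem {N} #A 0<N #AA-AA #AA L 0<L M≤LN N≤Ld = cases (N ℕ.≤? 2 ℕ.* combinationGrowth L ℕ.* z)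
    where
    differences : AtMost setoid (A ⊖ A) (N ℕ.* N)
    differences = AtMost-image (setoid ×ₛ setoid) setoid (λ (a , b) → a + - b)
      (λ (a≈a′ , b≈b′) → +-cong a≈a′ (-‿cong b≈b′)) (λ (a , b , Aa , Ab , x≈) → (a , b) , (Aa , Ab) , x≈)
      (AtMost-× setoid setoid (HasCardinality⇒AtMost setoid #A) (HasCardinality⇒AtMost setoid #A))

    counted : ∃ λ z → HasCardinality setoid ((A ⊖ A) ∖ NonZeroDivisor) z
    counted = enumerate setoid {r = p} em
      (λ x≈y ((a , b , Aa , Ab , x≈) , ¬nzd) → (a , b , Aa , Ab , trans (sym x≈y) x≈)
        , λ y-nzd → ¬nzd λ v v≉0 →
            (λ xv≈0 → proj₁ (y-nzd v v≉0) (trans (*-congʳ (sym x≈y)) xv≈0))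
          , (λ vx≈0 → proj₂ (y-nzd v v≉0) (trans (*-congˡ (sym x≈y)) vx≈0)))
      (AtMost-⊆ setoid proj₁ differences)

    z = proj₁ counted
    #Z = proj₂ counted

    Model : Set _
    Model = ∃₂ λ (R₀ : RingWithoutOne 0ℓ 0ℓ) (n : ℕ) → HasCardinality (RingWithoutOne.setoid R₀) U n ×
      N ≤ n × n ≤ groupGrowth L ℕ.* N ×
      ∃₂ λ φ (φ-auto : IsAutomorphism R₀ φ) → GradedEmbedding R A R₀ φ φ-auto

    find-model : 2 ℕ.* combinationGrowth L ℕ.* z < N → Model
    find-model few =
      let (u , u∈ , u-nzd , bound) = Growth.generated-finite R p em A L _ _ _ z #A #AA-AA #AA #Z 0<N 0<L M≤LN N≤Ld few
          (R₀ , n , #R₀ , maximal , n≤ , embedding) = GradedModel.model R p em A u u∈ u-nzd (groupGrowth L ℕ.* N) bound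
      in R₀ , n , #R₀ , maximal 0 (AtLeast-⊆ setoid (gen ∘ single) (HasCardinality⇒AtLeast setoid #A)) , n≤ , embedding

    cases : Dec (N ≤ 2 ℕ.* combinationGrowth L ℕ.* z) → _ ⊎ Model
    cases (yes many) = inj₁ (z , #Z , many)
    cases (no few)   = inj₂ (find-model (ℕ.≰⇒> few))

theorem1p6 : ∀ {c ℓ p : Level} → ExcludedMiddle (c ⊔ ℓ ⊔ p) →
    ∃ λ (C : ℕ) → 1 ≤ C ×
    ((R : RingWithoutOne c ℓ) →
     let open RingWithoutOne R using (Carrier)
         open Subsets R
     in
     (A : Pred Carrier p) (|A| |A·A-A·A| |A·A| : ℕ) →
     HasCardinality (RingWithoutOne.setoid R) A |A| →
     Satisfiable A →
     HasCardinality (RingWithoutOne.setoid R) ((A · A) ⊖ (A · A)) |A·A-A·A| →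
     HasCardinality (RingWithoutOne.setoid R) (A · A) |A·A| →
     (K : ℝ) → fromℕ 1 ≤ᴿ K →
     fromℕ |A·A-A·A| ≤ᴿ K *ᴿ fromℕ |A| →
     fromℕ |A| ≤ᴿ K *ᴿ fromℕ |A·A| →
     (∃ λ (z : ℕ) →
        HasCardinality (RingWithoutOne.setoid R) ((A ⊖ A) ∖ NonZeroDivisor) z ×
        fromℕ |A| ≤ᴿ fromℕ C *ᴿ K ^ᴿ C *ᴿ fromℕ z)
     ⊎
     (∃₂ λ (R₀ : RingWithoutOne 0ℓ 0ℓ) (N : ℕ) →
        HasCardinality (RingWithoutOne.setoid R₀) U N ×
        |A| ≤ N ×
        fromℕ N ≤ᴿ fromℕ C *ᴿ K ^ᴿ C *ᴿ fromℕ |A| ×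
        ∃₂ λ φ (φ-auto : IsAutomorphism R₀ φ) →
          GradedEmbedding R A R₀ φ φ-auto))
theorem1p6 em = C , 1≤C , λ R A N M d #A (a , Aa) #AA-AA #AA K 1≤K M≤KN N≤Kd →
  let L = IntegerBound.L (integerBound K 1≤K)
      0<L = IntegerBound.0<L (integerBound K 1≤K)
      (zero-divisors , model) = proj₂ (proj₂ (proj₂ common-bound)) L 0<L
      S = RingWithoutOne.setoid R
      0<N = AtLeast≤AtMost S (a ∷ [] , [] ∷ [] , Aa ∷ [] , ≤-refl) (HasCardinality⇒AtMost S #A)
  in Sum.map
    (λ (z , #Z , N≤) → z , #Z , ≤⇒≤ᴿ K 1≤K coefficient exponent N z (≤-trans N≤ (*-monoˡ-≤ z zero-divisors)))
    (λ (R₀ , n , #R₀ , N≤n , n≤ , embedding) →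
      R₀ , n , #R₀ , N≤n , ≤⇒≤ᴿ K 1≤K coefficient exponent n N (≤-trans n≤ (*-monoˡ-≤ N model)) , embedding)
    (integral-theorem em R A #A 0<N #AA-AA #AA L 0<L (≤ᴿ⇒≤ K 1≤K M N M≤KN) (≤ᴿ⇒≤ K 1≤K N d N≤Kd))
  where
  coefficient = proj₁ common-bound
  exponent = proj₁ (proj₂ common-bound)
  C = exponent ℕ.+ 2 ℕ.* (coefficient ℕ.* 5 ℕ.^ exponent)

  1≤C : 1 ≤ C
  1≤C = ≤-trans (*-mono-≤ (s≤s (z≤n {1})) (*-mono-≤ (proj₁ (proj₂ (proj₂ common-bound))) (ℕ.m^n>0 5 exponent)))
    (ℕ.m≤n+m (2 ℕ.* (coefficient ℕ.* 5 ℕ.^ exponent)) exponent)
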